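{- For integers $d,e>1$ and $w\ge 0$, the number of $d$-balanced $e$-regular partitions is the same in every block of $e$-weight $w$; in particular, it depends only on $d$, $e$ and $w$.
   Context: A partition $\lambda=(\lambda_1\ge\lambda_2\ge\dots\ge\lambda_\ell>0)$ has Young diagram $[\lambda]=\{(r,c):1\le r\le \ell,\ 1\le c\le\lambda_r\}$ and size $|\lambda|=\sum\lambda_j$; $\lambda'$ denotes the conjugate partition. It is $e$-regular if no part is repeated $e$ or more times. For $(r,c)\in[\lambda]$ the arm length of the hook at $(r,c)$ is $a_{rc}(\lambda)=\lambda_r-c$ and its hook length is $h_{rc}(\lambda)=a_{rc}(\lambda)+(\lambda'_c-r)+1$. The partition $\lambda$ is $d$-balanced (with respect to $e$) if $d\mid a_{rc}(\lambda)$ for every node $(r,c)\in[\lambda]$ with $e\mid h_{rc}(\lambda)$. The $\beta$-set of $\lambda$ is $B_0(\lambda)=\{\lambda_j-j: j\ge 1\}$ (with $\lambda_j=0$ for $j>\ell$). The $e$-core of $\lambda$ is the partition whose $\beta$-set is obtained from $B_0(\lambda)$ by repeatedly replacing an element $b$ by $b-e$ whenever $b-e$ is not in the set, until this is no longer possible (equivalently, by removing rim hooks of length $e$ until none remain). The $e$-weight of $\lambda$ is $(|\lambda|-|\gamma|)/e$, where $\gamma$ is the $e$-core of $\lambda$. A block is the set of all partitions with a given $e$-core $\gamma$ (a partition equal to its own $e$-core) and a given $e$-weight $w\geq 0$, called the $e$-core and $e$-weight of the block. -}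

module Defs where

open import Data.Nat using (ℕ; zero; suc; _+_; _*_; _∸_; _≤_; _<_; _≥_; _≤?_; _≟_)
open import Data.Nat.Divisibility using (_∣_)
open import Data.Integer as ℤ using (ℤ; +_)
open import Data.List using (List; []; _∷_; length; filter; sum)
open import Data.List.Membership.Propositional using (_∈_)
open import Data.List.Relation.Unary.All using (All)
open import Data.List.Relation.Unary.Linked using (Linked)
open import Data.List.Relation.Unary.Unique.Propositional using (Unique)
open import Data.Product using (Σ; ∃; _×_; _,_)
open import Data.Sum using (_⊎_)
open import Function.Bundles using (_⇔_)
open import Level using (0ℓ)
open import Relation.Binary.Construct.Closure.ReflexiveTransitive using (Star)
open import Relation.Binary.PropositionalEquality using (_≡_; _≢_)
open import Relation.Nullary using (¬_)
open import Relation.Unary using (Pred)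

record Partition : Set where
  constructor mkPartition
  field
    parts      : List ℕ
    decreasing : Linked _≥_ parts
    positive   : All (0 <_) parts

open Partition public

size : Partition → ℕ
size μ = sum (parts μ)

numParts : Partition → ℕ
numParts μ = length (parts μ)

-- Parts are indexed from 1 and are 0 beyond the last one; index 0 is a dummy
-- value that is never used.
nth : List ℕ → ℕ → ℕ
nth _        zero          = 0
nth []       (suc _)       = 0
nth (x ∷ _)  (suc zero)    = x
nth (_ ∷ xs) (suc (suc j)) = nth xs (suc j)

part : Partition → ℕ → ℕ
part μ j = nth (parts μ) j

-- The part with index c ≥ 1 of the conjugate partition, i.e. the length of
-- column c of the Young diagram.
conjugatePart : Partition → ℕ → ℕ
conjugatePart μ c = length (filter (c ≤?_) (parts μ))

Node : Partition → ℕ → ℕ → Set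
Node μ r c = (1 ≤ r × r ≤ numParts μ) × (1 ≤ c × c ≤ part μ r)

-- No truncation occurs in these subtractions when (r , c) is a node.
arm : Partition → ℕ → ℕ → ℕ
arm μ r c = part μ r ∸ c

hook : Partition → ℕ → ℕ → ℕ
hook μ r c = arm μ r c + (conjugatePart μ c ∸ r) + 1

Regular : ℕ → Pred Partition 0ℓ
Regular e μ = ∀ x → x ∈ parts μ → length (filter (x ≟_) (parts μ)) < e

Balanced : (d e : ℕ) → Pred Partition 0ℓ
Balanced d e μ = ∀ r c → Node μ r c → e ∣ hook μ r c → d ∣ arm μ r c

β-set : Partition → Pred ℤ 0ℓ
β-set μ b = ∃ λ j → 1 ≤ j × b ≡ + part μ j ℤ.- + j

CanMove : ℕ → Partition → Pred ℤ 0ℓ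
CanMove e μ b = β-set μ b × ¬ β-set μ (b ℤ.- + e)

-- One replacement of b by b - e in the β-set.  The resulting set is always the
-- β-set of a partition, so the process can be followed on partitions.
Step : ℕ → Partition → Partition → Set
Step e μ ν = ∃ λ b → CanMove e μ b ×
  (∀ x → β-set ν x ⇔ (x ≡ b ℤ.- + e ⊎ (β-set μ x × x ≢ b)))

-- γ is the e-core of μ.
HasCore : ℕ → Partition → Partition → Set
HasCore e μ γ = Star (Step e) μ γ × ¬ ∃ (CanMove e γ)

IsCore : ℕ → Pred Partition 0ℓ
IsCore e γ = HasCore e γ γ

-- The block of e-core γ and e-weight w.  The second condition is
-- w = (|μ| - |γ|) / e, with the (exact) division cleared.
Block : (e : ℕ) (γ : Partition) (w : ℕ) → Pred Partition 0ℓ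
Block e γ w μ = HasCore e μ γ × size μ ≡ size γ + w * e

-- Exactly N partitions satisfy P.
Count : Pred Partition 0ℓ → ℕ → Set
Count P N = Σ (List Partition) λ L →
  Unique L × (∀ μ → μ ∈ L ⇔ P μ) × length L ≡ N

{-# OPTIONS --safe #-}

-- Write W(x) for the number of gaps of the β-set in (x , x + e].  A partition is
-- d-balanced iff d ∣ W(x) whenever x and x + e lie between the first gap and the
-- last bead of their runner, and e-regular iff W(x) ≥ 1 for all x above the first
-- gap.  Every nonempty core becomes a smaller one when two adjacent runners are
-- exchanged, so it suffices to compare the blocks of two such cores.  Fix all
-- runners but these two, and the number of beads in each pair of adjacent positions
-- on them; what remains free is the order (bead, gap) = A or (gap, bead) = R in the
-- pairs with one bead, a word in A and R.  The divisibility conditions then say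
-- that, in a cyclic order of the pairs determined by the fixed data, all A's
-- precede all R's (or that the word has only one letter).  Hence there is exactly
-- one admissible word with the numbers of A's and R's exchanged, and replacing the
-- word by it is a bijection between the two blocks.  This is the reflection of the
-- crystal of e-regular partitions.
module Submission where

open import Defs
open import Data.Bool as Bool using (Bool; true; false; _∨_)
open import Data.Bool.Properties using (T-≡)
open import Data.Empty using (⊥; ⊥-elim)
open import Data.Integer as ℤ using (ℤ; -[1+_]) renaming (+_ to pos)
import Data.Integer.Properties as ℤ
import Data.Integer.Tactic.RingSolver as ℤSolver
open import Data.List using (List; []; _∷_; length; filter; map; upTo; cartesianProductWith; deduplicate)
import Data.List.Properties as List
open import Data.List.Properties using (filter-accept; filter-reject; filter-none)
open import Data.List.Membership.Propositional using (_∈_)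
open import Data.List.Membership.Propositional.Properties using (∈-filter⁺; ∈-filter⁻; ∈-map⁺; ∈-upTo⁺; ∈-cartesianProductWith⁺; ∈-deduplicate⁺; ∈-deduplicate⁻)
open import Data.List.Relation.Unary.All as All using (All; []; _∷_)
open import Data.List.Relation.Unary.AllPairs using (AllPairs; []; _∷_)
open import Data.List.Relation.Unary.Any using (here; there)
open import Data.List.Relation.Unary.Linked as Linked using ([])
open import Data.List.Relation.Unary.Linked.Properties using (Linked⇒AllPairs; AllPairs⇒Linked)
open import Data.List.Relation.Unary.Unique.Propositional using (Unique)
import Data.List.Relation.Unary.Unique.DecPropositional.Properties as Unique
open import Data.Nat
open import Data.Nat.DivMod
open import Data.Nat.Divisibility using (_∣_; divides; _∣?_; _∣0; >⇒∤; n∣m*n; ∣⇒≤; ∣m+n∣m⇒∣n; ∣m∣n⇒∣m+n)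
open import Data.Nat.Induction using (<-rec)
open import Data.Nat.ListAction using (sum)
open import Data.Nat.Properties
open import Algebra.Properties.CommutativeSemigroup +-commutativeSemigroup using (interchange; xy∙z≈xz∙y; xy∙z≈x∙zy)
open import Data.Nat.Tactic.RingSolver using (solve-∀)
open import Data.Product using (∃; ∃₂; ∃-syntax; _×_; _,_; proj₁; proj₂)
open import Data.Sum using (_⊎_; inj₁; inj₂; [_,_]′)
open import Data.Unit using (tt)
open import Function.Bundles using (_⇔_; mk⇔; Equivalence)
open import Level using (0ℓ)
open import Relation.Binary.Construct.Closure.ReflexiveTransitive using (Star; ε; _◅_)
open import Relation.Binary.Definitions using (tri<; tri≈; tri>)
open import Relation.Binary.PropositionalEquality
open import Relation.Nullary using (¬_; Dec; yes; no; does)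
open import Relation.Nullary.Decidable using (_×-dec_; _⊎-dec_; _→-dec_; map′; dec-true; dec-false)
open import Relation.Unary using (Pred; Decidable; _∩_)

-- The cyclic order comes from `1 < d`. The windows that start at the two positions of the pair `j`
-- have `O j + gapʳ (T j) + gapˡ (T (suc j))` and `O j + gapʳ (T (suc j)) + gapˡ (T (suc j))` gaps,
-- numbers that differ by at most one. Where both must be divisible by `d`, the right runner cannot
-- change between bead and gap. If an R lies below an A, the left runner is constrained between them
-- while the right one does change, so at that place the right one must be unconstrained. There `d`
-- divides one less than `O j + s (suc j)`, at all other constrained places `O j + s (suc j)`
-- itself; hence this place, the cut, can be read off from data that the exchange preserves.
-- Regularity needs an argument of its own, since `d` also divides the size of a window without
-- gaps. Only windows that start on runner 0 can change. An empty one is excluded because neighbours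
-- R, A of the new word were R, A before (`oldRA`), and because every window above a gap with a
-- later bead on its runner has at least `d` gaps (`window≥d`).

-- Finite sums, beads and gaps

sumTo : ℕ → (ℕ → ℕ) → ℕ
sumTo zero    h = 0
sumTo (suc n) h = sumTo n h + h n

sumTo-cong : ∀ n {h k : ℕ → ℕ} → (∀ i → i < n → h i ≡ k i) → sumTo n h ≡ sumTo n k
sumTo-cong zero    eq = refl
sumTo-cong (suc n) eq = cong₂ _+_ (sumTo-cong n λ i i<n → eq i (m<n⇒m<1+n i<n)) (eq n ≤-refl)

sumTo-split : ∀ m n h → sumTo (m + n) h ≡ sumTo m h + sumTo n (λ i → h (m + i))
sumTo-split m zero    h rewrite +-identityʳ m = sym (+-identityʳ _)
sumTo-split m (suc n) h rewrite +-suc m n | sumTo-split m n h = +-assoc (sumTo m h) _ _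

sumTo-split′ : ∀ m n h → sumTo (m + n) h ≡ sumTo n h + sumTo m (λ i → h (n + i))
sumTo-split′ m n h = trans (cong (λ k → sumTo k h) (+-comm m n)) (sumTo-split n m h)

sumTo-+ : ∀ n h k → sumTo n (λ i → h i + k i) ≡ sumTo n h + sumTo n k
sumTo-+ zero    h k = refl
sumTo-+ (suc n) h k rewrite sumTo-+ n h k = interchange (sumTo n h) (sumTo n k) (h n) (k n)

sumTo-mono : ∀ n {h k : ℕ → ℕ} → (∀ i → i < n → h i ≤ k i) → sumTo n h ≤ sumTo n k
sumTo-mono zero    le = z≤n
sumTo-mono (suc n) le = +-mono-≤ (sumTo-mono n λ i i<n → le i (m<n⇒m<1+n i<n)) (le n ≤-refl)

sumTo-mono-< : ∀ n {h k : ℕ → ℕ} → (∀ i → i < n → h i ≤ k i) →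
  ∀ {p} → p < n → h p < k p → sumTo n h < sumTo n k
sumTo-mono-< (suc n) {h} {k} le {p} p<1+n lt with m<1+n⇒m<n∨m≡n p<1+n
... | inj₁ p<n  = +-mono-<-≤ (sumTo-mono-< n (λ i i<n → le i (m<n⇒m<1+n i<n)) p<n lt) (le n ≤-refl)
... | inj₂ refl = +-mono-≤-< (sumTo-mono n λ i i<n → le i (m<n⇒m<1+n i<n)) lt

sumTo-extend : ∀ {m n} h → m ≤ n → (∀ i → m ≤ i → h i ≡ 0) → sumTo n h ≡ sumTo m h
sumTo-extend {m} {zero}  h z≤n z = refl
sumTo-extend {m} {suc n} h m≤1+n z with m≤n⇒m<n∨m≡n m≤1+n
... | inj₂ refl      = refl
... | inj₁ (s≤s m≤n) rewrite z n m≤n | +-identityʳ (sumTo n h) = sumTo-extend h m≤n z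

sumTo≡0 : ∀ n {h} → sumTo n h ≡ 0 → ∀ {i} → i < n → h i ≡ 0
sumTo≡0 (suc n) {h} eq {i} i<1+n with m<1+n⇒m<n∨m≡n i<1+n
... | inj₁ i<n  = sumTo≡0 n (m+n≡0⇒m≡0 (sumTo n h) eq) i<n
... | inj₂ refl = m+n≡0⇒n≡0 (sumTo n h) eq

zero⇒sumTo≡0 : ∀ n {h} → (∀ i → i < n → h i ≡ 0) → sumTo n h ≡ 0
zero⇒sumTo≡0 zero z = refl
zero⇒sumTo≡0 (suc n) z = cong₂ _+_ (zero⇒sumTo≡0 n λ i i<n → z i (m<n⇒m<1+n i<n)) (z n ≤-refl)

sumTo-≤-arg : ∀ {m n} h → m ≤ n → sumTo m h ≤ sumTo n h
sumTo-≤-arg {m} {n} h m≤n with m≤n⇒∃[o]m+o≡n m≤n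
... | o , refl rewrite sumTo-split m o h = m≤m+n _ _

-- Partial sums of 0s and 1s grow by unit steps, so they pass through every value below the total;
-- `m` is the place where the value `x` is about to be left. This locates the gap with a given
-- number of gaps below it, and the end of a run of A's of given size.
sumTo-hits : ∀ n h → (∀ i → h i ≤ 1) → ∀ x → x < sumTo n h →
  ∃ λ m → m < n × sumTo m h ≡ x × h m ≡ 1
sumTo-hits (suc n) h le x lt with x <? sumTo n h
... | yes x<s with sumTo-hits n h le x x<s
...   | m , m<n , p , q = m , m<n⇒m<1+n m<n , p , q
sumTo-hits (suc n) h le x lt | no x≮s with h n in eq | le n
... | 0 | _ = ⊥-elim (x≮s (subst (x <_) (+-identityʳ _) lt))
... | suc zero | _ = n , ≤-refl , ≤-antisym (≮⇒≥ x≮s) (m<1+n⇒m≤n (subst (x <_) (+-comm _ 1) lt)) , eq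
... | suc (suc _) | s≤s ()

bead gap : Bool → ℕ
bead true  = 1
bead false = 0
gap true  = 0
gap false = 1

bead+gap : ∀ b → bead b + gap b ≡ 1
bead+gap true  = refl
bead+gap false = refl

gap≤1 : ∀ b → gap b ≤ 1
gap≤1 true = z≤n
gap≤1 false = ≤-refl

true∧false : ∀ {b} {X : Set} → b ≡ true → b ≡ false → X
true∧false refl ()

true⊎false : ∀ b → b ≡ true ⊎ b ≡ false
true⊎false true  = inj₁ refl
true⊎false false = inj₂ refl

-- Pairs of adjacent runners

-- Two horizontally adjacent abacus positions: both beads, bead and gap (an
-- addable node), gap and bead (a removable node), both gaps.
data Pair : Set where
  B A R E : Pair

gapˡ gapʳ gaps : Pair → ℕ
gapˡ B = 0
gapˡ A = 0
gapˡ R = 1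
gapˡ E = 1
gapʳ B = 0
gapʳ A = 1
gapʳ R = 0
gapʳ E = 1
gaps t = gapʳ t + gapˡ t

A≢R : ∀ {t} → t ≡ A → t ≢ R
A≢R refl ()

E≢B : ∀ {t} → t ≡ E → t ≢ B
E≢B refl ()

gapˡ≡1 : ∀ {t} → gapˡ t ≡ 1 → t ≡ R ⊎ t ≡ E
gapˡ≡1 {R} _ = inj₁ refl
gapˡ≡1 {E} _ = inj₂ refl

gapˡ≡0 : ∀ {t} → gapˡ t ≡ 0 → t ≡ A ⊎ t ≡ B
gapˡ≡0 {A} _ = inj₁ refl
gapˡ≡0 {B} _ = inj₂ refl

gapʳ≡1 : ∀ {t} → gapʳ t ≡ 1 → t ≡ A ⊎ t ≡ E
gapʳ≡1 {A} _ = inj₁ refl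
gapʳ≡1 {E} _ = inj₂ refl

gapʳ≡0 : ∀ {t} → gapʳ t ≡ 0 → t ≡ R ⊎ t ≡ B
gapʳ≡0 {R} _ = inj₁ refl
gapʳ≡0 {B} _ = inj₂ refl

≢A≢E⇒gapʳ≡0 : ∀ {t} → t ≢ A → t ≢ E → gapʳ t ≡ 0
≢A≢E⇒gapʳ≡0 {B} _ _ = refl
≢A≢E⇒gapʳ≡0 {A} a _ = ⊥-elim (a refl)
≢A≢E⇒gapʳ≡0 {R} _ _ = refl
≢A≢E⇒gapʳ≡0 {E} _ e = ⊥-elim (e refl)

≢R≢B⇒gapʳ≡1 : ∀ {t} → t ≢ R → t ≢ B → gapʳ t ≡ 1
≢R≢B⇒gapʳ≡1 {B} _ n = ⊥-elim (n refl)
≢R≢B⇒gapʳ≡1 {A} _ _ = refl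
≢R≢B⇒gapʳ≡1 {R} r _ = ⊥-elim (r refl)
≢R≢B⇒gapʳ≡1 {E} _ _ = refl

gapʳ≤1 : ∀ t → gapʳ t ≤ 1
gapʳ≤1 B = z≤n
gapʳ≤1 A = ≤-refl
gapʳ≤1 R = z≤n
gapʳ≤1 E = ≤-refl

1≤gaps : ∀ {t} → 1 ≤ gaps t → t ≡ R ⊎ gapʳ t ≡ 1
1≤gaps {A} _ = inj₂ refl
1≤gaps {R} _ = inj₁ refl
1≤gaps {E} _ = inj₂ refl

gaps≤1 : ∀ {t} → gaps t ≤ 1 → t ≡ A ⊎ gapʳ t ≡ 0
gaps≤1 {B} _ = inj₂ refl
gaps≤1 {A} _ = inj₁ refl
gaps≤1 {R} _ = inj₂ refl
gaps≤1 {E} (s≤s ())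

gaps≡2 : ∀ {t} → gaps t ≡ 2 → t ≡ E
gaps≡2 {E} _ = refl

gaps≡0 : ∀ {t} → gaps t ≡ 0 → t ≡ B
gaps≡0 {B} _ = refl

gaps≡1 : ∀ {t} → gaps t ≡ 1 → t ≡ A ⊎ t ≡ R
gaps≡1 {A} _ = inj₁ refl
gaps≡1 {R} _ = inj₂ refl

gapʳ≡1⇒1≤gaps : ∀ {t} → gapʳ t ≡ 1 → 1 ≤ gaps t
gapʳ≡1⇒1≤gaps {A} _ = ≤-refl
gapʳ≡1⇒1≤gaps {E} _ = s≤s z≤n

gapʳ≡0⇒gaps≤1 : ∀ {t} → gapʳ t ≡ 0 → gaps t ≤ 1
gapʳ≡0⇒gaps≤1 {B} _ = z≤n
gapʳ≡0⇒gaps≤1 {R} _ = ≤-refl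

gapˡ≡1⇒1≤gaps : ∀ {t} → gapˡ t ≡ 1 → 1 ≤ gaps t
gapˡ≡1⇒1≤gaps {R} _ = ≤-refl
gapˡ≡1⇒1≤gaps {E} _ = s≤s z≤n

gapˡ≡0⇒gaps≤1 : ∀ {t} → gapˡ t ≡ 0 → gaps t ≤ 1
gapˡ≡0⇒gaps≤1 {B} _ = z≤n
gapˡ≡0⇒gaps≤1 {A} _ = ≤-refl

-- Threshold words and the divisibility conditions on two runners

-- Positions are compared in the cyclic order that starts at c.
Before : ℕ → ℕ → ℕ → Set
Before c i j = (i < j × (j < c ⊎ c ≤ i)) ⊎ (c ≤ i × j < c)

Threshold : ℕ → (ℕ → Pair) → Set
Threshold c T = ∀ {i j} → Before c i j → T i ≡ R → T j ≢ A

crossing : ∀ (h : ℕ → ℕ) → (∀ n → h n ≤ 1) → ∀ {i} k → i ≤ k → h i ≡ 0 → h k ≡ 1 →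
  ∃ λ m → i ≤ m × m < k × h m ≡ 0 × h (suc m) ≡ 1
crossing h h≤1 zero z≤n hi hk with trans (sym hi) hk
... | ()
crossing h h≤1 {i} (suc k) i≤1+k hi hk with m≤n⇒m<n∨m≡n i≤1+k
crossing h h≤1 {i} (suc k) i≤1+k hi hk | inj₂ refl with trans (sym hi) hk
... | ()
crossing h h≤1 {i} (suc k) i≤1+k hi hk | inj₁ (s≤s i≤k) with h k in eq | h≤1 k
... | 0 | _ = k , i≤k , ≤-refl , eq , hk
... | suc (suc _) | s≤s ()
... | 1 | _ with crossing h h≤1 k i≤k hi eq
...   | m , p , q , r , t = m , p , m<n⇒m<1+n q , r , t

-- O j is the number of gaps strictly between the pairs j and j + 1.
module TwoRunners {d : ℕ} (1<d : 1 < d) (O : ℕ → ℕ) where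

  -- A row is constrained on a runner if that runner has a gap at or below it and a bead above it.
  -- The numbers to be divided are the gap counts of the windows that start at the left and at the
  -- right position of the pair `j`; see `window-left` and `window-right`.
  LeftOK RightOK : (ℕ → Pair) → Set
  LeftOK T  = ∀ {i j k} → i ≤ j → j < k → gapˡ (T i) ≡ 1 → gapˡ (T k) ≡ 0 →
    d ∣ O j + (gapʳ (T j) + gapˡ (T (suc j)))
  RightOK T = ∀ {i j k} → i ≤ j → j < k → gapʳ (T i) ≡ 1 → gapʳ (T k) ≡ 0 →
    d ∣ O j + gaps (T (suc j))

  -- s j is the number of gaps of the pair j.  The cut c is 0 if all A's precede all
  -- R's in the natural order; otherwise it is the only place where O j + s (j + 1) ≡ 1.
  record FrameOK (s : ℕ → ℕ) (c : ℕ) : Set where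
    field
      noEB : ∀ {i k} → i < k → s i ≡ 2 → s k ≢ 0
      noE  : ∀ {i} → i < c → s i ≢ 2
      noB  : ∀ {i} → 0 < c → c ≤ i → s i ≢ 0
      off  : ∀ {i j k} → i ≤ j → j < k → 1 ≤ s i → s k ≤ 1 → suc j ≢ c → d ∣ O j + s (suc j)
      -- At the cut only the left window is constrained. The pair before the cut has no right gap
      -- and the pair after it has one, so this window misses one gap of `s (suc j)`.
      on   : ∀ {i j k} → i ≤ j → j < k → 1 ≤ s i → s k ≤ 1 → suc j ≡ c → d ∣ O j + pred (s (suc j))
      -- This keeps the condition at a positive cut from being vacuous; `cut-unique` relies on it.
      span : 0 < c → ∃₂ λ i k → i < c × c ≤ k × s i ≡ 1 × s k ≡ 1

  FrameOK-resp : ∀ {s s′ c} → (∀ j → s j ≡ s′ j) → FrameOK s c → FrameOK s′ c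
  FrameOK-resp {s} {s′} {c} eq F = record
    { noEB = λ {i} {k} i<k p q → noEB i<k (trans (eq i) p) (trans (eq k) q)
    ; noE  = λ {i} i<c p → noE i<c (trans (eq i) p)
    ; noB  = λ {i} 0<c c≤i p → noB 0<c c≤i (trans (eq i) p)
    ; off  = λ {i} {j} {k} i≤j j<k p q n → subst (λ z → d ∣ O j + z) (eq (suc j))
        (off i≤j j<k (subst (1 ≤_) (sym (eq i)) p) (subst (_≤ 1) (sym (eq k)) q) n)
    ; on   = λ {i} {j} {k} i≤j j<k p q n → subst (λ z → d ∣ O j + pred z) (eq (suc j))
        (on i≤j j<k (subst (1 ≤_) (sym (eq i)) p) (subst (_≤ 1) (sym (eq k)) q) n)
    ; span = λ 0<c → let i , k , a , b , p , q = span 0<c in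
        i , k , a , b , trans (sym (eq i)) p , trans (sym (eq k)) q
    }
    where open FrameOK F

  ∤consecutive : ∀ {x} → d ∣ x → ¬ d ∣ suc x
  ∤consecutive {x} p q =
    >⇒∤ 1<d (∣m+n∣m⇒∣n (subst (d ∣_) (+-comm 1 x) q) p)

  -- The two multiples of `d` differ by at most one, so they are equal.
  gapʳ-unique : ∀ o t t′ y → d ∣ o + (gapʳ t + y) → d ∣ o + (gapʳ t′ + y) → gapʳ t ≡ gapʳ t′
  gapʳ-unique o t t′ y p q with gapʳ t | gapʳ≤1 t | gapʳ t′ | gapʳ≤1 t′
  ... | 0 | _ | 0 | _ = refl
  ... | 1 | _ | 1 | _ = refl
  ... | 0 | _ | 1 | _ = ⊥-elim (∤consecutive p (subst (d ∣_) (+-suc o y) q))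
  ... | 1 | _ | 0 | _ = ⊥-elim (∤consecutive q (subst (d ∣_) (+-suc o y) p))
  ... | suc (suc _) | s≤s () | _ | _
  ... | 0 | _ | suc (suc _) | s≤s ()
  ... | 1 | _ | suc (suc _) | s≤s ()

  module _ {T : ℕ → Pair} (L : LeftOK T) (Rt : RightOK T) where

    -- Where both runners are constrained, the right one cannot change, since d ∤ 1.
    constant : ∀ {i k i′ k′} → gapˡ (T i) ≡ 1 → gapˡ (T k) ≡ 0 → gapʳ (T i′) ≡ 1 → gapʳ (T k′) ≡ 0 →
      ∀ {p} q → i ≤ p → i′ ≤ p → p ≤ q → q ≤ k → q ≤ k′ → gapʳ (T p) ≡ gapʳ (T q)
    constant ai ak bi bk zero _ _ z≤n _ _ = refl
    constant ai ak bi bk {p} (suc q) i≤p i′≤p p≤1+q q<k q<k′ with m≤n⇒m<n∨m≡n p≤1+q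
    ... | inj₂ refl = refl
    ... | inj₁ (s≤s p≤q) = trans
      (constant ai ak bi bk q i≤p i′≤p p≤q (<⇒≤ q<k) (<⇒≤ q<k′))
      (gapʳ-unique (O q) (T q) (T (suc q)) _
        (L (≤-trans i≤p p≤q) q<k ai ak) (Rt (≤-trans i′≤p p≤q) q<k′ bi bk))

    -- An E below a B would constrain both runners in between, although the right runner changes
    -- from gap to bead.
    ¬E<B : ∀ {i k} → i < k → T i ≡ E → T k ≢ B
    ¬E<B {i} {k} i<k ei ek
      with trans (sym (cong gapʳ ei)) (trans (constant (cong gapˡ ei) (cong gapˡ ek) (cong gapʳ ei) (cong gapʳ ek)
             k ≤-refl ≤-refl (<⇒≤ i<k) ≤-refl ≤-refl) (cong gapʳ ek))
    ... | ()

  module _ {T : ℕ → Pair} {c : ℕ} (thr : Threshold c T) where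

    -- After an R and before the cut there is no A by the threshold and no E by assumption; B and R
    -- both have a right bead. Dually, `right-run` leaves only A and E between the cut and an A.
    left-run : (∀ {i} → i < c → T i ≢ E) → ∀ {i m} → T i ≡ R → i ≤ m → m < c → gapʳ (T m) ≡ 0
    left-run noE {i} {m} ri i≤m m<c with m≤n⇒m<n∨m≡n i≤m
    ... | inj₂ refl = cong gapʳ ri
    ... | inj₁ i<m  = ≢A≢E⇒gapʳ≡0 (thr (inj₁ (i<m , inj₁ m<c)) ri) (noE m<c)

    ≢R-before-A : ∀ {m k} → T k ≡ A → c ≤ m → m ≤ k → T m ≢ R
    ≢R-before-A {m} {k} ak c≤m m≤k rm with m≤n⇒m<n∨m≡n m≤k
    ... | inj₁ m<k  = thr (inj₁ (m<k , inj₂ c≤m)) rm ak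
    ... | inj₂ refl = A≢R ak rm

    right-run : (∀ {i} → c ≤ i → T i ≢ B) → ∀ {m k} → T k ≡ A → c ≤ m → m ≤ k → gapʳ (T m) ≡ 1
    right-run noB ak c≤m m≤k = ≢R≢B⇒gapʳ≡1 (≢R-before-A ak c≤m m≤k) (noB c≤m)

  module Synthesis {T : ℕ → Pair} {c : ℕ} (F : FrameOK (λ j → gaps (T j)) c) (thr : Threshold c T) where
    open FrameOK F

    noE′ : ∀ {i} → i < c → T i ≢ E
    noE′ i<c eq = noE i<c (cong gaps eq)

    noB′ : 0 < c → ∀ {i} → c ≤ i → T i ≢ B
    noB′ 0<c c≤i eq = noB 0<c c≤i (cong gaps eq)

    noEB′ : ∀ {i k} → i < k → T i ≡ E → T k ≢ B
    noEB′ i<k p q = noEB i<k (cong gaps p) (cong gaps q)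

    -- At the cut the right runner is unconstrained: a right gap below it belongs to an A, as E is
    -- excluded there, and a right bead above it to an R, as B is excluded there. These two
    -- contradict the threshold. Elsewhere `off` applies directly.
    rightOK : RightOK T
    rightOK {i} {j} {k} i≤j j<k bi bk with suc j ≟ c
    ... | no j+1≢c = off i≤j j<k (gapʳ≡1⇒1≤gaps bi) (gapʳ≡0⇒gaps≤1 bk) j+1≢c
    ... | yes refl with gapʳ≡1 bi | gapʳ≡0 bk
    ...   | inj₂ ei | _       = ⊥-elim (noE′ (s≤s i≤j) ei)
    ...   | _       | inj₂ nk = ⊥-elim (noB′ (s≤s z≤n) j<k nk)
    ...   | inj₁ ai | inj₁ rk = ⊥-elim (thr (inj₂ (j<k , s≤s i≤j)) rk ai)

    -- This turns a left window into a right window, which `off` controls. Below the cut the left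
    -- gap at `i` is an R and fixes the right runner up to the cut; above a positive cut the left
    -- bead at `k` is an A and fixes it back to the cut. For `c` equal to 0 the ends `i` and `k` fix
    -- it on the whole interval, with `noEB` in the role of `noE` and `noB`.
    right-constant : ∀ {i j k} → i ≤ j → j < k → gapˡ (T i) ≡ 1 → gapˡ (T k) ≡ 0 → suc j ≢ c →
      gapʳ (T j) ≡ gapʳ (T (suc j))
    right-constant {i} {j} {k} i≤j j<k ai ak j+1≢c with j <? c
    ... | yes j<c with gapˡ≡1 ai
    ...   | inj₂ ei = ⊥-elim (noE′ (≤-<-trans i≤j j<c) ei)
    ...   | inj₁ ri = trans (left-run thr noE′ ri i≤j j<c)
                       (sym (left-run thr noE′ ri (m≤n⇒m≤1+n i≤j) (≤∧≢⇒< j<c j+1≢c)))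
    right-constant {i} {j} {k} i≤j j<k ai ak j+1≢c | no j≮c with 0 <? c
    ... | yes 0<c with gapˡ≡0 ak
    ...   | inj₂ nk = ⊥-elim (noB′ 0<c (≤-trans (≮⇒≥ j≮c) (<⇒≤ j<k)) nk)
    ...   | inj₁ Ak = trans (right-run thr (noB′ 0<c) Ak (≮⇒≥ j≮c) (<⇒≤ j<k))
                       (sym (right-run thr (noB′ 0<c) Ak (m≤n⇒m≤1+n (≮⇒≥ j≮c)) j<k))
    right-constant {i} {j} {k} i≤j j<k ai ak j+1≢c | no j≮c | no 0≮c with gapˡ≡0 ak | gapˡ≡1 ai
    ... | inj₁ Ak | inj₁ ri = ⊥-elim (≢R-before-A thr Ak (c≤ i) (≤-trans i≤j (<⇒≤ j<k)) ri)
      where c≤ : ∀ n → c ≤ n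
            c≤ n = ≤-trans (≮⇒≥ 0≮c) z≤n
    ... | inj₁ Ak | inj₂ ei = trans (one i≤j (<⇒≤ j<k)) (sym (one (m≤n⇒m≤1+n i≤j) j<k))
      where one : ∀ {m} → i ≤ m → m ≤ k → gapʳ (T m) ≡ 1
            one i≤m m≤k = ≢R≢B⇒gapʳ≡1 (≢R-before-A thr Ak (≤-trans (≮⇒≥ 0≮c) z≤n) m≤k) λ nm →
              [ (λ i<m → noEB′ i<m ei nm) , (λ { refl → E≢B ei nm }) ]′ (m≤n⇒m<n∨m≡n i≤m)
    ... | inj₂ nk | inj₂ ei = ⊥-elim (noEB′ (≤-<-trans i≤j j<k) ei nk)
    ... | inj₂ nk | inj₁ ri = trans (zer i≤j (<⇒≤ j<k)) (sym (zer (m≤n⇒m≤1+n i≤j) j<k))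
      where zer : ∀ {m} → i ≤ m → m ≤ k → gapʳ (T m) ≡ 0
            zer i≤m m≤k = ≢A≢E⇒gapʳ≡0
              ([ (λ i<m → thr (inj₁ (i<m , inj₂ (≤-trans (≮⇒≥ 0≮c) z≤n))) ri) , (λ { refl → λ ak → A≢R ak ri }) ]′ (m≤n⇒m<n∨m≡n i≤m))
              ([ (λ m<k em → noEB′ m<k em nk) , (λ { refl → λ em → E≢B em nk }) ]′ (m≤n⇒m<n∨m≡n m≤k))

    leftOK : LeftOK T
    leftOK {i} {j} {k} i≤j j<k ai ak with suc j ≟ c
    ... | no j+1≢c = subst (λ z → d ∣ O j + (z + gapˡ (T (suc j)))) (sym (right-constant i≤j j<k ai ak j+1≢c))
                       (off i≤j j<k (gapˡ≡1⇒1≤gaps ai) (gapˡ≡0⇒gaps≤1 ak) j+1≢c)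
    ... | yes refl with gapˡ≡1 ai | gapˡ≡0 ak
    ...   | inj₂ ei | _       = ⊥-elim (noE′ (s≤s i≤j) ei)
    ...   | _       | inj₂ nk = ⊥-elim (noB′ (s≤s z≤n) j<k nk)
    ...   | inj₁ ri | inj₁ Ak =
      subst₂ (λ z w → d ∣ O j + (z + w)) (sym (left-run thr noE′ ri i≤j ≤-refl))
        (cong (λ z → pred (z + gapˡ (T (suc j)))) (right-run thr (noB′ (s≤s z≤n)) Ak ≤-refl j<k))
        (on i≤j j<k (gapˡ≡1⇒1≤gaps ai) (gapˡ≡0⇒gaps≤1 ak) refl)

  module Analysis {T : ℕ → Pair} (L : LeftOK T) (Rt : RightOK T) where

    1≢0′ : ∀ {x y} {z : Set} → x ≡ 1 → y ≡ 0 → x ≡ y → z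
    1≢0′ refl () refl

    -- The right runner alone yields every condition: an R at `i`, which has no right gap, is
    -- replaced by the A at `α` below it, and an A at `k`, which has no right bead, by the R at `ρ`
    -- above it.
    untwisted : ∀ {α ρ} → T α ≡ A → T ρ ≡ R → (∀ {i k} → i < k → T i ≡ R → T k ≢ A) →
      FrameOK (λ j → gaps (T j)) 0 × Threshold 0 T
    untwisted {α} {ρ} Aα Rρ ¬RA = record
      { noEB = λ i<k p q → ¬E<B L Rt i<k (gaps≡2 p) (gaps≡0 q)
      ; noE  = λ ()
      ; noB  = λ ()
      ; off  = λ {i} {j} {k} i≤j j<k p q _ →
          let i′ , i′≤i , bi = start p
              k′ , k≤k′ , bk = end q
          in Rt (≤-trans i′≤i i≤j) (<-≤-trans j<k k≤k′) bi bk
      ; on   = λ _ _ _ _ ()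
      ; span = λ ()
      } , λ { (inj₁ (i<j , _)) → ¬RA i<j ; (inj₂ (_ , ())) }
      where
      start : ∀ {i} → 1 ≤ gaps (T i) → ∃ λ i′ → i′ ≤ i × gapʳ (T i′) ≡ 1
      start {i} p with 1≤gaps p
      ... | inj₂ b  = i , ≤-refl , b
      ... | inj₁ ri = α , ≮⇒≥ (λ i<α → ¬RA i<α ri Aα) , cong gapʳ Aα
      end : ∀ {k} → gaps (T k) ≤ 1 → ∃ λ k′ → k ≤ k′ × gapʳ (T k′) ≡ 0
      end {k} p with gaps≤1 p
      ... | inj₂ b  = k , ≤-refl , b
      ... | inj₁ Ak = ρ , ≮⇒≥ (λ ρ<k → ¬RA ρ<k Rρ Ak) , cong gapʳ Rρ

    -- The left runner is constrained from the R to the A, and the right one turns from bead to gap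
    -- somewhere between; the cut is placed there. Any violation of the exclusions or of the
    -- threshold would constrain both runners along a stretch on which the right one changes,
    -- contrary to `constant`.
    twisted : ∀ {i k} → i < k → T i ≡ R → T k ≡ A →
      ∃ λ c → FrameOK (λ j → gaps (T j)) c × Threshold c T
    twisted {r} {a} r<a Rr Aa with crossing (λ n → gapʳ (T n)) (λ n → gapʳ≤1 (T n)) a (<⇒≤ r<a) (cong gapʳ Rr) (cong gapʳ Aa)
    ... | l , r≤l , l<a , bl , bc = c , F , thr
      where
      c = suc l
      la : gapˡ (T a) ≡ 0
      la = cong gapˡ Aa
      lr : gapˡ (T r) ≡ 1
      lr = cong gapˡ Rr
      b≢ : ∀ {m t} → T m ≡ t → gapʳ t ≡ 1 → m ≢ l
      b≢ eq b refl = 1≢0′ b refl (trans (sym (cong gapʳ eq)) bl)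
      notboth : ∀ {m n} → m < c → c ≤ n → gapʳ (T m) ≡ 1 → gapʳ (T n) ≡ 0 → ⊥
      notboth (s≤s m≤l) c≤n bm bn =
        1≢0′ bc bl (sym (constant L Rt lr la bm bn c r≤l m≤l (n≤1+n l) l<a c≤n))
      <l : ∀ {m t} → T m ≡ t → gapʳ t ≡ 1 → m < c → m < l
      <l eq b (s≤s m≤l) = ≤∧≢⇒< m≤l (b≢ eq b)
      noE′ : ∀ {m} → m < c → T m ≢ E
      noE′ {m} m<c em = 1≢0′ (cong gapʳ em) bl
        (constant L Rt (cong gapˡ em) la (cong gapʳ em) bl l ≤-refl ≤-refl (m<1+n⇒m≤n m<c) (<⇒≤ l<a) ≤-refl)
      noB′ : ∀ {m} → c ≤ m → T m ≢ B
      noB′ {m} c≤m nm = 1≢0′ bc (cong gapʳ nm)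
        (constant L Rt lr (cong gapˡ nm) bc (cong gapʳ nm) m (m≤n⇒m≤1+n r≤l) ≤-refl c≤m ≤-refl ≤-refl)
      thr : Threshold c T
      thr {i} {j} (inj₁ (i<j , inj₁ j<c)) ri aj = 1≢0′ (cong gapʳ aj) bl
        (constant L Rt (cong gapˡ ri) la (cong gapʳ aj) bl l (<⇒≤ i<j) ≤-refl (m<1+n⇒m≤n j<c) (<⇒≤ l<a) ≤-refl)
      thr {i} {j} (inj₁ (i<j , inj₂ c≤i)) ri aj = 1≢0′ bc (cong gapʳ ri)
        (constant L Rt lr (cong gapˡ aj) bc (cong gapʳ ri) i (m≤n⇒m≤1+n r≤l) ≤-refl c≤i (<⇒≤ i<j) ≤-refl)
      thr {i} {j} (inj₂ (c≤i , j<c)) ri aj = notboth j<c c≤i (cong gapʳ aj) (cong gapʳ ri)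
      -- A right gap at `i` constrains the right runner up to its bead at `l`. An R at `i`
      -- constrains the left runner instead, and then `left-run` makes the left and right windows
      -- equally large.
      offLeft : ∀ {i j} → i ≤ j → j < l → 1 ≤ gaps (T i) → d ∣ O j + gaps (T (suc j))
      offLeft {i} {j} i≤j j<l p with 1≤gaps p
      ... | inj₂ b  = Rt i≤j j<l b bl
      ... | inj₁ ri = subst (λ z → d ∣ O j + (z + gapˡ (T (suc j))))
        (trans (left-run thr noE′ ri i≤j (m<n⇒m<1+n j<l)) (sym (left-run thr noE′ ri (m≤n⇒m≤1+n i≤j) (s≤s j<l))))
        (L i≤j (<-trans j<l l<a) (cong gapˡ ri) la)
      offRight : ∀ {j k} → c ≤ j → j < k → gaps (T k) ≤ 1 → d ∣ O j + gaps (T (suc j))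
      offRight {j} {k} c≤j j<k p with gaps≤1 p
      ... | inj₂ b  = Rt c≤j j<k bc b
      ... | inj₁ Ak = subst (λ z → d ∣ O j + (z + gapˡ (T (suc j))))
        (trans (right-run thr noB′ Ak c≤j (<⇒≤ j<k)) (sym (right-run thr noB′ Ak (m≤n⇒m≤1+n c≤j) j<k)))
        (L (≤-trans (m≤n⇒m≤1+n r≤l) c≤j) j<k lr (cong gapˡ Ak))
      F : FrameOK (λ j → gaps (T j)) c
      F = record
        { noEB = λ i<k p q → ¬E<B L Rt i<k (gaps≡2 p) (gaps≡0 q)
        ; noE  = λ i<c p → noE′ i<c (gaps≡2 p)
        ; noB  = λ _ c≤i p → noB′ c≤i (gaps≡0 p)
        ; off  = λ {i} {j} {k} i≤j j<k p q j+1≢c → [ (λ j<l → offLeft i≤j j<l p) , (λ c≤j → offRight c≤j j<k q) ]′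
            (side j (λ { refl → j+1≢c refl }))
        ; on   = λ {i} {j} {k} i≤j j<k p q j+1≡c → onn j (suc-injective j+1≡c)
        ; span = λ _ → r , a , s≤s r≤l , l<a , cong gaps Rr , cong gaps Aa
        }
        where
        side : ∀ j → j ≢ l → j < l ⊎ l < j
        side j j≢l with <-cmp j l
        ... | tri< p _ _ = inj₁ p
        ... | tri≈ _ p _ = ⊥-elim (j≢l p)
        ... | tri> _ _ p = inj₂ p
        onn : ∀ j → j ≡ l → d ∣ O j + pred (gaps (T (suc j)))
        onn j refl = subst₂ (λ z w → d ∣ O j + (z + w)) bl (sym (cong (λ z → pred (z + gapˡ (T c))) bc)) (L r≤l l<a lr la)

-- Words in A and R with given frame and given number of A's

isA isR single : Pair → ℕ
isA A = 1
isA _ = 0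
isR R = 1
isR _ = 0
single t = isA t + isR t

single≤1 : ∀ t → single t ≤ 1
single≤1 B = z≤n
single≤1 A = ≤-refl
single≤1 R = ≤-refl
single≤1 E = z≤n

flip : Pair → Pair
flip B = B
flip A = R
flip R = A
flip E = E

gapˡ-flip : ∀ t → gapˡ (flip t) ≡ gapʳ t
gapˡ-flip B = refl
gapˡ-flip A = refl
gapˡ-flip R = refl
gapˡ-flip E = refl

gapʳ-flip : ∀ t → gapʳ (flip t) ≡ gapˡ t
gapʳ-flip B = refl
gapʳ-flip A = refl
gapʳ-flip R = refl
gapʳ-flip E = refl

gaps-flip : ∀ t → gaps (flip t) ≡ gaps t
gaps-flip B = refl
gaps-flip A = refl
gaps-flip R = refl
gaps-flip E = refl

flip≡A : ∀ {t} → flip t ≡ A → t ≡ R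
flip≡A {R} _ = refl

flip≡R : ∀ {t} → flip t ≡ R → t ≡ A
flip≡R {A} _ = refl

isA-flip : ∀ t → isA (flip t) ≡ isR t
isA-flip B = refl
isA-flip A = refl
isA-flip R = refl
isA-flip E = refl

_≟ᴾ_ : (t t′ : Pair) → Dec (t ≡ t′)
B ≟ᴾ B = yes refl
B ≟ᴾ A = no λ ()
B ≟ᴾ R = no λ ()
B ≟ᴾ E = no λ ()
A ≟ᴾ B = no λ ()
A ≟ᴾ A = yes refl
A ≟ᴾ R = no λ ()
A ≟ᴾ E = no λ ()
R ≟ᴾ B = no λ ()
R ≟ᴾ A = no λ ()
R ≟ᴾ R = yes refl
R ≟ᴾ E = no λ ()
E ≟ᴾ B = no λ ()
E ≟ᴾ A = no λ ()
E ≟ᴾ R = no λ ()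
E ≟ᴾ E = yes refl

select : Pair → Bool → Pair
select B _ = B
select E _ = E
select A true = A
select R true = A
select A false = R
select R false = R

gaps-select : ∀ t b → gaps (select t b) ≡ gaps t
gaps-select B _ = refl
gaps-select E _ = refl
gaps-select A true = refl
gaps-select R true = refl
gaps-select A false = refl
gaps-select R false = refl

isA-select-false : ∀ t → isA (select t false) ≡ 0
isA-select-false B = refl
isA-select-false E = refl
isA-select-false A = refl
isA-select-false R = refl

isA-select-true : ∀ t → isA (select t true) ≡ single t
isA-select-true B = refl
isA-select-true E = refl
isA-select-true A = refl
isA-select-true R = refl

module _ {P : Set} (t : Pair) where

  chosen : Dec P → ℕ
  chosen p = isA (select t (does p))

  chosen-yes : ∀ p → P → chosen p ≡ single t
  chosen-yes p x rewrite dec-true p x = isA-select-true t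

  chosen-no : ∀ p → ¬ P → chosen p ≡ 0
  chosen-no p ¬x rewrite dec-false p ¬x = isA-select-false t

chosen-cong : ∀ {P Q : Set} t (p : Dec P) (q : Dec Q) → (P → Q) → (Q → P) → chosen t p ≡ chosen t q
chosen-cong t p (yes y) f g = trans (chosen-yes t p (g y)) (sym (isA-select-true t))
chosen-cong t p (no ¬y) f g = trans (chosen-no t p λ x → ¬y (f x)) (sym (isA-select-false t))

chosen-split : ∀ {P Q S : Set} t (p : Dec P) (q : Dec Q) (s : Dec S) →
  (S → P ⊎ Q) → (P → S) → (Q → S) → (P → ¬ Q) → chosen t s ≡ chosen t p + chosen t q
chosen-split t (yes x) q s f g h n =
  trans (chosen-yes t s (g x)) (trans (sym (+-identityʳ _)) (sym (cong₂ _+_ (isA-select-true t) (chosen-no t q (n x)))))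
chosen-split t (no ¬x) q s f g h n =
  trans (chosen-cong t s q (λ z → [ (λ x → ⊥-elim (¬x x)) , (λ y → y) ]′ (f z)) h)
    (sym (cong (_+ chosen t q) (isA-select-false t)))

select≡A : ∀ {P : Set} t (p : Dec P) → select t (does p) ≡ A → P
select≡A t (yes x) _ = x
select≡A B (no _) ()
select≡A E (no _) ()
select≡A A (no _) ()
select≡A R (no _) ()

select≡R : ∀ {P : Set} t (p : Dec P) → select t (does p) ≡ R → ¬ P
select≡R t (no x) _ = x
select≡R B (yes _) ()
select≡R E (yes _) ()
select≡R A (yes _) ()
select≡R R (yes _) ()

single-gaps : ∀ {t t′} → gaps t ≡ gaps t′ → single t ≡ single t′
single-gaps {B} {B} _ = refl
single-gaps {A} {A} _ = refl
single-gaps {A} {R} _ = refl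
single-gaps {R} {A} _ = refl
single-gaps {R} {R} _ = refl
single-gaps {E} {E} _ = refl

gaps-differ : ∀ {t t′} → gaps t ≡ gaps t′ → t ≡ t′ ⊎ (t ≡ A × t′ ≡ R) ⊎ (t ≡ R × t′ ≡ A)
gaps-differ {B} {B} _ = inj₁ refl
gaps-differ {A} {A} _ = inj₁ refl
gaps-differ {A} {R} _ = inj₂ (inj₁ (refl , refl))
gaps-differ {R} {A} _ = inj₂ (inj₂ (refl , refl))
gaps-differ {R} {R} _ = inj₁ refl
gaps-differ {E} {E} _ = inj₁ refl

isA≡0 : ∀ {t} → t ≢ A → isA t ≡ 0
isA≡0 {A} n = ⊥-elim (n refl)
isA≡0 {B} n = refl
isA≡0 {R} n = refl
isA≡0 {E} n = refl

isR≡0 : ∀ {t} → t ≢ R → isR t ≡ 0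
isR≡0 {R} n = ⊥-elim (n refl)
isR≡0 {B} n = refl
isR≡0 {A} n = refl
isR≡0 {E} n = refl

countA countR : ℕ → (ℕ → Pair) → ℕ
countA K T = sumTo K (λ j → isA (T j))
countR K T = sumTo K (λ j → isR (T j))

countA+countR : ∀ K T → countA K T + countR K T ≡ sumTo K (λ j → single (T j))
countA+countR K T = sym (sumTo-+ K _ _)

Before-total : ∀ c {i j} → i ≢ j → Before c i j ⊎ Before c j i
Before-total c {i} {j} i≢j with i <? c | j <? c
... | yes i<c | no j≮c = inj₂ (inj₂ (≮⇒≥ j≮c , i<c))
... | no i≮c | yes j<c = inj₁ (inj₂ (≮⇒≥ i≮c , j<c))
... | yes i<c | yes j<c with <-cmp i j
...   | tri< p _ _ = inj₁ (inj₁ (p , inj₁ j<c))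
...   | tri≈ _ p _ = ⊥-elim (i≢j p)
...   | tri> _ _ p = inj₂ (inj₁ (p , inj₁ i<c))
Before-total c {i} {j} i≢j | no i≮c | no j≮c with <-cmp i j
...   | tri< p _ _ = inj₁ (inj₁ (p , inj₂ (≮⇒≥ i≮c)))
...   | tri≈ _ p _ = ⊥-elim (i≢j p)
...   | tri> _ _ p = inj₂ (inj₁ (p , inj₂ (≮⇒≥ j≮c)))

module _ (c K : ℕ) (T : ℕ → Pair) where

  private
    high low : ℕ → ℕ
    high j = isA (select (T j) (does (c ≤? j)))
    low  j = isA (select (T j) (does (j <? c)))

    select≤1 : ∀ t b → isA (select t b) ≤ 1
    select≤1 t true  rewrite isA-select-true t = single≤1 t
    select≤1 t false rewrite isA-select-false t = z≤n

    high+low : sumTo K high + sumTo K low ≡ sumTo K (λ j → single (T j))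
    high+low = trans (sym (sumTo-+ K high low)) (sumTo-cong K λ j _ → pt j)
      where
      pt : ∀ j → high j + low j ≡ single (T j)
      pt j = trans (sym (chosen-split (T j) (c ≤? j) (j <? c) (yes tt) (λ _ → ≤-<-connex c j) _ _ (λ p q → <⇒≱ q p)))
               (isA-select-true (T j))

  -- In the cyclic order the pairs from `c` on come first. If they offer more than `x` places, the
  -- A's fill these places below some `θ`; otherwise the A's take all of them and continue from pair
  -- 0 up to `θ`. The strict bound on `x` is what `sumTo-hits` requires to find `θ`.
  thresholdWord : ∀ x → x < sumTo K (λ j → single (T j)) →
    ∃ λ T′ → Threshold c T′ × (∀ j → gaps (T′ j) ≡ gaps (T j)) × countA K T′ ≡ x
  thresholdWord x x<t with x <? sumTo K high
  ... | yes x<h with sumTo-hits K high (λ j → select≤1 (T j) _) x x<h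
  ...   | θ , θ<K , eq , _ = T′ , thr , (λ j → gaps-select (T j) _) , cnt
    where
    P? : ∀ j → Dec (c ≤ j × j < θ)
    P? j = (c ≤? j) ×-dec (j <? θ)
    T′ : ℕ → Pair
    T′ j = select (T j) (does (P? j))
    thr : Threshold c T′
    thr {i} {j} b ri aj with b | select≡A (T j) (P? j) aj | select≡R (T i) (P? i) ri
    ... | inj₁ (i<j , inj₁ j<c) | c≤j , _ | _ = <⇒≱ j<c c≤j
    ... | inj₁ (i<j , inj₂ c≤i) | _ , j<θ | ¬P = ¬P (c≤i , <-trans i<j j<θ)
    ... | inj₂ (_ , j<c) | c≤j , _ | _ = <⇒≱ j<c c≤j
    cnt : countA K T′ ≡ x
    cnt = trans (sumTo-extend _ (<⇒≤ θ<K) zero′) (trans (sumTo-cong θ below) eq)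
      where
      zero′ : ∀ j → θ ≤ j → isA (T′ j) ≡ 0
      zero′ j θ≤j = chosen-no (T j) (P? j) λ p → <⇒≱ (proj₂ p) θ≤j
      below : ∀ j → j < θ → isA (T′ j) ≡ high j
      below j j<θ = chosen-cong (T j) (P? j) (c ≤? j) proj₁ (_, j<θ)
  thresholdWord x x<t | no x≮h with sumTo-hits K low (λ j → select≤1 (T j) _) (x ∸ sumTo K high) x-h<l
    where
    x-h<l : x ∸ sumTo K high < sumTo K low
    x-h<l = +-cancelˡ-< (sumTo K high) _ _
      (subst₂ _<_ (sym (m+[n∸m]≡n (≮⇒≥ x≮h))) (sym high+low) x<t)
  ... | θ , θ<K , eq , _ = T′ , thr , (λ j → gaps-select (T j) _) , cnt
    where
    P? : ∀ j → Dec (c ≤ j ⊎ j < θ)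
    P? j = (c ≤? j) ⊎-dec (j <? θ)
    Q? : ∀ j → Dec (j < c × j < θ)
    Q? j = (j <? c) ×-dec (j <? θ)
    T′ : ℕ → Pair
    T′ j = select (T j) (does (P? j))
    lower : ℕ → ℕ
    lower j = isA (select (T j) (does (Q? j)))
    thr : Threshold c T′
    thr {i} {j} b ri aj with b | select≡A (T j) (P? j) aj | select≡R (T i) (P? i) ri
    ... | inj₁ (i<j , inj₁ j<c) | inj₁ c≤j | _ = <⇒≱ j<c c≤j
    ... | inj₁ (i<j , inj₁ j<c) | inj₂ j<θ | ¬P = ¬P (inj₂ (<-trans i<j j<θ))
    ... | inj₁ (i<j , inj₂ c≤i) | _ | ¬P = ¬P (inj₁ c≤i)
    ... | inj₂ (c≤i , _) | _ | ¬P = ¬P (inj₁ c≤i)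
    pt : ∀ j → isA (T′ j) ≡ high j + lower j
    pt j = chosen-split (T j) (c ≤? j) (Q? j) (P? j)
      (λ { (inj₁ c≤j) → inj₁ c≤j ; (inj₂ j<θ) → [ inj₁ , (λ j<c → inj₂ (j<c , j<θ)) ]′ (≤-<-connex c j) })
      inj₁ (λ q → inj₂ (proj₂ q)) (λ c≤j q → <⇒≱ (proj₁ q) c≤j)
    zero′ : ∀ j → θ ≤ j → lower j ≡ 0
    zero′ j θ≤j = chosen-no (T j) (Q? j) λ p → <⇒≱ (proj₂ p) θ≤j
    below : ∀ j → j < θ → lower j ≡ low j
    below j j<θ = chosen-cong (T j) (Q? j) (j <? c) proj₁ (_, j<θ)
    cnt : countA K T′ ≡ x
    cnt = trans (sumTo-cong K λ j _ → pt j) (trans (sumTo-+ K high lower)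
      (trans (cong (sumTo K high +_) (trans (sumTo-extend lower (<⇒≤ θ<K) zero′) (trans (sumTo-cong θ below) eq)))
        (m+[n∸m]≡n (≮⇒≥ x≮h))))

-- By the threshold an R directly followed by an A must straddle the cut, where the two pairs are
-- the last and the first of the cyclic order. Any threshold word that uses both letters has R in
-- the last and A in the first of them, once these are one-bead pairs.
Threshold-RA : ∀ {c T T′} → Threshold c T → Threshold c T′ → (∀ j → gaps (T′ j) ≡ gaps (T j)) →
  ∀ {α ρ} → T α ≡ A → T ρ ≡ R → ∀ j → T′ j ≡ R → T′ (suc j) ≡ A → T j ≡ R × T (suc j) ≡ A
Threshold-RA {c} {T} {T′} thr thr′ same {α} {ρ} Aα Rρ j r′ a′ with <-cmp (suc j) c
... | tri< p _ _ = ⊥-elim (thr′ (inj₁ (≤-refl , inj₁ p)) r′ a′)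
... | tri> _ _ (s≤s p) = ⊥-elim (thr′ (inj₁ (≤-refl , inj₂ p)) r′ a′)
... | tri≈ _ refl _ = Rj , Ac
  where
  Rj : T j ≡ R
  Rj with gaps≡1 (trans (sym (same j)) (cong gaps r′))
  ... | inj₂ r = r
  ... | inj₁ a with ρ ≟ j
  ...   | yes refl = Rρ
  ...   | no ρ≢j with ρ <? suc j
  ...     | yes (s≤s ρ≤j) = ⊥-elim (thr (inj₁ (≤∧≢⇒< ρ≤j ρ≢j , inj₁ ≤-refl)) Rρ a)
  ...     | no ρ≮c = ⊥-elim (thr (inj₂ (≮⇒≥ ρ≮c , ≤-refl)) Rρ a)
  Ac : T (suc j) ≡ A
  Ac with gaps≡1 (trans (sym (same (suc j))) (cong gaps a′))
  ... | inj₁ a = a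
  ... | inj₂ r with α ≟ suc j
  ...   | yes refl = Aα
  ...   | no α≢c with α <? suc j
  ...     | yes α<c = ⊥-elim (thr (inj₂ (≤-refl , α<c)) r Aα)
  ...     | no α≮c = ⊥-elim (thr (inj₁ (≤∧≢⇒< (≮⇒≥ α≮c) (λ e → α≢c (sym e)) , inj₂ ≤-refl)) r Aα)

-- The A's of threshold words with the same cut and frame are initial segments of one chain, hence
-- nested; a single difference decides the direction.
Threshold-< : ∀ {c T T′} → Threshold c T → Threshold c T′ → (∀ j → gaps (T′ j) ≡ gaps (T j)) →
  ∀ {K p} → p < K → T p ≡ A → T′ p ≡ R → countA K T′ < countA K T
Threshold-< {c} {T} {T′} thr thr′ same {K} {p} p<K ap rp =
  sumTo-mono-< K (λ q _ → le q) p<K (subst₂ _<_ (sym (cong isA rp)) (sym (cong isA ap)) (s≤s z≤n))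
  where
  le : ∀ q → isA (T′ q) ≤ isA (T q)
  le q with gaps-differ (same q)
  ... | inj₁ eq = ≤-reflexive (cong isA eq)
  ... | inj₂ (inj₂ (r , a)) = ≤-trans (≤-reflexive (cong isA r)) z≤n
  ... | inj₂ (inj₁ (a , r)) with Before-total c {p} {q} (λ { refl → A≢R a rp })
  ...   | inj₁ b = ⊥-elim (thr′ b rp a)
  ...   | inj₂ b = ⊥-elim (thr b r ap)

-- Existence and uniqueness of the reflected word

module Reflection {d : ℕ} (1<d : 1 < d) (O : ℕ → ℕ) (K : ℕ) where
  open TwoRunners 1<d O

  Valid : (ℕ → Pair) → Set
  Valid T = LeftOK T × RightOK T

  Bounded : (ℕ → Pair) → Set
  Bounded T = ∀ {j} → K ≤ j → T j ≡ E

  bounded : ∀ {T} → Bounded T → ∀ {j t} → t ≢ E → T j ≡ t → j < K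
  bounded bd t≢E eq = ≰⇒> λ K≤j → t≢E (trans (sym eq) (bd K≤j))

  cut : ∀ {T} → Bounded T → Valid T → ∀ {α ρ} → T α ≡ A → T ρ ≡ R →
    ∃ λ c → FrameOK (λ j → gaps (T j)) c × Threshold c T
  cut {T} bd (L , Rt) Aα Rρ with anyUpTo? (λ k → (T k ≟ᴾ A) ×-dec anyUpTo? (λ i → T i ≟ᴾ R) k) K
  ... | yes (k , _ , Ak , i , i<k , Ri) = Analysis.twisted L Rt i<k Ri Ak
  ... | no ¬RA = 0 , Analysis.untwisted L Rt Aα Rρ
    λ {i} {k} i<k ri ak → ¬RA (k , bounded bd (λ ()) ak , ak , i , i<k , ri)

  module _ {T : ℕ → Pair} (valid : Valid T) where
    private
      L = proj₁ valid
      Rt = proj₂ valid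

    -- After the flip the left window has `O j + (gapˡ (T j) + gapʳ (T (suc j)))` gaps. This is the
    -- old right window as soon as the left runner does not change from `j` to `suc j`.
    flip-leftOK : (∀ {i j k} → i ≤ j → j < k → gapʳ (T i) ≡ 1 → gapʳ (T k) ≡ 0 → gapˡ (T j) ≡ gapˡ (T (suc j))) →
      LeftOK (λ j → flip (T j))
    flip-leftOK const {i} {j} {k} i≤j j<k ai ak = subst (λ z → d ∣ O j + z) eq (Rt i≤j j<k bi bk)
      where
      bi = trans (sym (gapˡ-flip (T i))) ai
      bk = trans (sym (gapˡ-flip (T k))) ak
      eq : gaps (T (suc j)) ≡ gapʳ (flip (T j)) + gapˡ (flip (T (suc j)))
      eq rewrite gapʳ-flip (T j) | gapˡ-flip (T (suc j)) | const i≤j j<k bi bk = +-comm (gapʳ (T (suc j))) _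

    flip-rightOK : (∀ {i j k} → i ≤ j → j < k → gapˡ (T i) ≡ 1 → gapˡ (T k) ≡ 0 → gapʳ (T j) ≡ gapʳ (T (suc j))) →
      RightOK (λ j → flip (T j))
    flip-rightOK const {i} {j} {k} i≤j j<k bi bk = subst (λ z → d ∣ O j + z) eq (L i≤j j<k ai ak)
      where
      ai = trans (sym (gapʳ-flip (T i))) bi
      ak = trans (sym (gapʳ-flip (T k))) bk
      eq : gapʳ (T j) + gapˡ (T (suc j)) ≡ gaps (flip (T (suc j)))
      eq rewrite gaps-flip (T (suc j)) | const i≤j j<k ai ak = refl

    private
      upto : ∀ {k} {P : ℕ → Set} → P k → (∀ {m} → m < k → P m) → ∀ {m} → m ≤ k → P m
      upto Pk P m≤k with m≤n⇒m<n∨m≡n m≤k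
      ... | inj₁ m<k = P m<k
      ... | inj₂ refl = Pk
      from : ∀ {i} {P : ℕ → Set} → P i → (∀ {m} → i < m → P m) → ∀ {m} → i ≤ m → P m
      from Pi P i≤m with m≤n⇒m<n∨m≡n i≤m
      ... | inj₁ i<m = P i<m
      ... | inj₂ refl = Pi
      ≢E : ∀ {k} → T k ≡ B → ∀ {m} → m ≤ k → T m ≢ E
      ≢E {k} nk = upto {k} {λ m → T m ≢ E} (λ em → E≢B em nk) λ m<k e → ¬E<B L Rt m<k e nk
      ≢B : ∀ {i} → T i ≡ E → ∀ {m} → i ≤ m → T m ≢ B
      ≢B {i} ei = from {i} {λ m → T m ≢ B} (E≢B ei) λ i<m → ¬E<B L Rt i<m ei
      g0 : ∀ {t} → t ≢ R → t ≢ E → gapˡ t ≡ 0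
      g0 {B} _ _ = refl
      g0 {A} _ _ = refl
      g0 {R} r _ = ⊥-elim (r refl)
      g0 {E} _ e = ⊥-elim (e refl)
      g1 : ∀ {t} → t ≢ A → t ≢ B → gapˡ t ≡ 1
      g1 {B} _ n = ⊥-elim (n refl)
      g1 {A} a _ = ⊥-elim (a refl)
      g1 {R} _ _ = refl
      g1 {E} _ _ = refl

    -- Without R, a right bead belongs to a B, below which there is no E, so the left runner has
    -- only beads up to it. Likewise a left gap belongs to an E, and from there on the right runner
    -- has only gaps. Both runners are thus constant wherever the flip needs it.
    flip-valid-noR : (∀ j → T j ≢ R) → Valid (λ j → flip (T j))
    flip-valid-noR noR = flip-leftOK left , flip-rightOK right
      where
      left : ∀ {i j k} → i ≤ j → j < k → gapʳ (T i) ≡ 1 → gapʳ (T k) ≡ 0 → gapˡ (T j) ≡ gapˡ (T (suc j))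
      left {i} {j} {k} i≤j j<k bi bk with gapʳ≡0 bk
      ... | inj₁ rk = ⊥-elim (noR k rk)
      ... | inj₂ nk = trans (g0 (noR j) (≢E nk (<⇒≤ j<k))) (sym (g0 (noR (suc j)) (≢E nk j<k)))
      right : ∀ {i j k} → i ≤ j → j < k → gapˡ (T i) ≡ 1 → gapˡ (T k) ≡ 0 → gapʳ (T j) ≡ gapʳ (T (suc j))
      right {i} {j} {k} i≤j j<k ai ak with gapˡ≡1 ai
      ... | inj₁ ri = ⊥-elim (noR i ri)
      ... | inj₂ ei = trans (≢R≢B⇒gapʳ≡1 (noR j) (≢B ei i≤j)) (sym (≢R≢B⇒gapʳ≡1 (noR (suc j)) (≢B ei (m≤n⇒m≤1+n i≤j))))

    flip-valid-noA : (∀ j → T j ≢ A) → Valid (λ j → flip (T j))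
    flip-valid-noA noA = flip-leftOK left , flip-rightOK right
      where
      left : ∀ {i j k} → i ≤ j → j < k → gapʳ (T i) ≡ 1 → gapʳ (T k) ≡ 0 → gapˡ (T j) ≡ gapˡ (T (suc j))
      left {i} {j} {k} i≤j j<k bi bk with gapʳ≡1 bi
      ... | inj₁ a = ⊥-elim (noA i a)
      ... | inj₂ ei = trans (g1 (noA j) (≢B ei i≤j)) (sym (g1 (noA (suc j)) (≢B ei (m≤n⇒m≤1+n i≤j))))
      right : ∀ {i j k} → i ≤ j → j < k → gapˡ (T i) ≡ 1 → gapˡ (T k) ≡ 0 → gapʳ (T j) ≡ gapʳ (T (suc j))
      right {i} {j} {k} i≤j j<k ai ak with gapˡ≡0 ak
      ... | inj₁ a = ⊥-elim (noA k a)
      ... | inj₂ nk = trans (≢A≢E⇒gapʳ≡0 (noA j) (≢E nk (<⇒≤ j<k))) (sym (≢A≢E⇒gapʳ≡0 (noA (suc j)) (≢E nk j<k)))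

  record Mirror (T T′ : ℕ → Pair) : Set where
    field
      valid   : Valid T′
      same    : ∀ j → gaps (T′ j) ≡ gaps (T j)
      counts  : countA K T′ ≡ countR K T
      -- Needed for regularity: an R followed by an A with O j = 0 encloses e beads.
      oldRA   : ∀ j → T′ j ≡ R → T′ (suc j) ≡ A → T j ≡ R × T (suc j) ≡ A

  -- If one letter is absent, flipping all letters suffices. If both occur, frame and cut are kept
  -- and the word is filled anew with `countR K T` letters A; the A at `α` keeps this count strictly
  -- below the number of one-bead pairs, as `thresholdWord` demands.
  mirror : ∀ {T} → Bounded T → Valid T → ∃ (Mirror T)
  mirror {T} bd valid with anyUpTo? (λ j → T j ≟ᴾ A) K | anyUpTo? (λ j → T j ≟ᴾ R) K
  ... | no ¬A | _ = _ , record
    { valid = flip-valid-noA valid noA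
    ; same = λ j → gaps-flip (T j)
    ; counts = sumTo-cong K (λ j _ → isA-flip (T j))
    ; oldRA = λ j r a → ⊥-elim (noA j (flip≡R r)) }
    where
    noA : ∀ j → T j ≢ A
    noA j a = ¬A (j , bounded bd (λ ()) a , a)
  ... | yes _ | no ¬R = _ , record
    { valid = flip-valid-noR valid noR
    ; same = λ j → gaps-flip (T j)
    ; counts = sumTo-cong K (λ j _ → isA-flip (T j))
    ; oldRA = λ j r a → ⊥-elim (noR (suc j) (flip≡A a)) }
    where
    noR : ∀ j → T j ≢ R
    noR j r = ¬R (j , bounded bd (λ ()) r , r)
  ... | yes (α , α<K , Aα) | yes (ρ , ρ<K , Rρ) with cut bd valid Aα Rρ
  ...   | c , F , thr with thresholdWord c K T (countR K T)
            (subst (countR K T <_) (countA+countR K T) (m<n+m (countR K T)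
              (subst (_< countA K T) (zero⇒sumTo≡0 K {λ _ → 0} (λ _ _ → refl)) (sumTo-mono-< K (λ _ _ → z≤n) α<K
                (subst (0 <_) (sym (cong isA Aα)) ≤-refl)))))
  ...     | T′ , thr′ , same , cnt = T′ , record
    { valid = Synthesis.leftOK F′ thr′ , Synthesis.rightOK F′ thr′
    ; same = same
    ; counts = cnt
    ; oldRA = Threshold-RA thr thr′ same Aα Rρ }
    where
    F′ = FrameOK-resp (λ j → sym (same j)) F

  -- If the cuts differed, `on` for the first and `off` for the second would both apply at the first
  -- one, constrained through `span`. As `noB` makes `s c` nonzero, `d` would divide two consecutive
  -- numbers.
  cut-unique : ∀ {s c c′} → FrameOK s c → FrameOK s c′ → 0 < c → c ≡ c′
  cut-unique {s} {suc l} {c′} F F′ 0<c with suc l ≟ c′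
  ... | yes eq = eq
  ... | no neq with FrameOK.span F 0<c
  ...   | i , k , s≤s i≤l , l<k , si , sk = ⊥-elim (clash (s (suc l)) refl)
    where
    clash : ∀ z → s (suc l) ≡ z → ⊥
    clash zero eq = FrameOK.noB F 0<c ≤-refl eq
    clash (suc z) eq = ∤consecutive
      (subst (λ y → d ∣ O l + pred y) eq (FrameOK.on F i≤l l<k (≤-reflexive (sym si)) (≤-reflexive sk) refl))
      (subst (d ∣_) (trans (cong (O l +_) eq) (+-suc (O l) z))
        (FrameOK.off F′ i≤l l<k (≤-reflexive (sym si)) (≤-reflexive sk) neq))

  countA-absent : ∀ {T} → (∀ j → j < K → T j ≢ A) → countA K T ≡ 0
  countA-absent noA = zero⇒sumTo≡0 K λ j j<K → isA≡0 (noA j j<K)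

  absent-A : ∀ {T} → countA K T ≡ 0 → ∀ j → j < K → T j ≢ A
  absent-A eq j j<K a with trans (sym (cong isA a)) (sumTo≡0 K eq j<K)
  ... | ()

  absent-R : ∀ {T} → countR K T ≡ 0 → ∀ j → j < K → T j ≢ R
  absent-R eq j j<K a with trans (sym (cong isR a)) (sumTo≡0 K eq j<K)
  ... | ()

  countR-same : ∀ {T T′} → (∀ j → gaps (T′ j) ≡ gaps (T j)) → countA K T ≡ countA K T′ → countR K T ≡ countR K T′
  countR-same {T} {T′} same cA = +-cancelˡ-≡ (countA K T) _ _ (trans (countA+countR K T)
    (trans (sumTo-cong K λ i _ → sym (single-gaps {T′ i} {T i} (same i)))
      (trans (sym (countA+countR K T′)) (cong (_+ countR K T′) (sym cA)))))

  -- At a place of difference one word has A and the other R, so equal counts force both words to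
  -- contain both letters. Then both have a cut, the cuts agree because they depend on the frame
  -- only, and `Threshold-<` contradicts the equality of the counts.
  unique : ∀ {T T′} → Bounded T → Bounded T′ → Valid T → Valid T′ → (∀ j → gaps (T′ j) ≡ gaps (T j)) →
    countA K T ≡ countA K T′ → ∀ j → T j ≡ T′ j
  unique {T} {T′} bd bd′ valid valid′ same cA j with j <? K
  ... | no j≮K = trans (bd (≮⇒≥ j≮K)) (sym (bd′ (≮⇒≥ j≮K)))
  ... | yes j<K with anyUpTo? (λ j → T j ≟ᴾ A) K | anyUpTo? (λ j → T j ≟ᴾ R) K
                   | anyUpTo? (λ j → T′ j ≟ᴾ A) K | anyUpTo? (λ j → T′ j ≟ᴾ R) K | gaps-differ (same j)
  ... | _ | _ | _ | _ | inj₁ eq = sym eq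
  ... | no ¬A | _ | _ | _ | inj₂ (inj₂ (_ , a)) = ⊥-elim (¬A (j , j<K , a))
  ... | no ¬A | _ | _ | _ | inj₂ (inj₁ (a , _)) =
        ⊥-elim (absent-A (trans (sym cA) (countA-absent λ i i<K p → ¬A (i , i<K , p))) j j<K a)
  ... | _ | _ | no ¬A | _ | inj₂ (inj₁ (a , _)) = ⊥-elim (¬A (j , j<K , a))
  ... | _ | _ | no ¬A | _ | inj₂ (inj₂ (_ , a)) =
        ⊥-elim (absent-A (trans cA (countA-absent λ i i<K p → ¬A (i , i<K , p))) j j<K a)
  ... | _ | no ¬R | _ | _ | inj₂ (inj₁ (_ , r)) = ⊥-elim (¬R (j , j<K , r))
  ... | _ | no ¬R | _ | _ | inj₂ (inj₂ (r , _)) =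
        ⊥-elim (absent-R (trans (sym (countR-same same cA)) (zero⇒sumTo≡0 K λ i i<K → isR≡0 λ p → ¬R (i , i<K , p))) j j<K r)
  ... | _ | _ | _ | no ¬R | inj₂ (inj₂ (r , _)) = ⊥-elim (¬R (j , j<K , r))
  ... | _ | _ | _ | no ¬R | inj₂ (inj₁ (_ , r)) =
        ⊥-elim (absent-R (trans (countR-same same cA) (zero⇒sumTo≡0 K λ i i<K → isR≡0 λ p → ¬R (i , i<K , p))) j j<K r)
  ... | yes (_ , _ , a) | yes (_ , _ , r) | yes (_ , _ , a′) | yes (_ , _ , r′) | inj₂ diff
        with cut bd valid a r | cut bd′ valid′ a′ r′
  ...   | c , F , thr | c′ , F′ , thr′ = ⊥-elim (go (c≡c′ c c′ F (FrameOK-resp same F′)) thr thr′ diff)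
    where
    c≡c′ : ∀ c c′ → FrameOK (λ j → gaps (T j)) c → FrameOK (λ j → gaps (T j)) c′ → c ≡ c′
    c≡c′ (suc _) _       F F′ = cut-unique F F′ (s≤s z≤n)
    c≡c′ zero    (suc _) F F′ = sym (cut-unique F′ F (s≤s z≤n))
    c≡c′ zero    zero    F F′ = refl
    go : ∀ {c c′} → c ≡ c′ → Threshold c T → Threshold c′ T′ → (T′ j ≡ A × T j ≡ R) ⊎ (T′ j ≡ R × T j ≡ A) → ⊥
    go refl thr thr′ (inj₁ (a , r)) = <⇒≢ (Threshold-< thr′ thr (λ i → sym (same i)) j<K a r) cA
    go refl thr thr′ (inj₂ (r , a)) = <⇒≢ (Threshold-< thr thr′ same j<K a r) (sym cA)

-- Abacus configurations

toPair : Bool → Bool → Pair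
toPair true  true  = B
toPair true  false = A
toPair false true  = R
toPair false false = E

leftBead rightBead : Pair → Bool
leftBead B = true
leftBead A = true
leftBead R = false
leftBead E = false
rightBead B = true
rightBead A = false
rightBead R = true
rightBead E = false

toPair-beads : ∀ t → toPair (leftBead t) (rightBead t) ≡ t
toPair-beads B = refl
toPair-beads A = refl
toPair-beads R = refl
toPair-beads E = refl

gapˡ-toPair : ∀ a b → gapˡ (toPair a b) ≡ gap a
gapˡ-toPair true  true  = refl
gapˡ-toPair true  false = refl
gapˡ-toPair false true  = refl
gapˡ-toPair false false = refl

gapʳ-toPair : ∀ a b → gapʳ (toPair a b) ≡ gap b
gapʳ-toPair true  true  = refl
gapʳ-toPair true  false = refl
gapʳ-toPair false true  = refl
gapʳ-toPair false false = refl

leftBead-toPair : ∀ a b → leftBead (toPair a b) ≡ a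
leftBead-toPair true  true  = refl
leftBead-toPair true  false = refl
leftBead-toPair false true  = refl
leftBead-toPair false false = refl

rightBead-toPair : ∀ a b → rightBead (toPair a b) ≡ b
rightBead-toPair true  true  = refl
rightBead-toPair true  false = refl
rightBead-toPair false true  = refl
rightBead-toPair false false = refl

gap≡1 : ∀ {b} → gap b ≡ 1 → b ≡ false
gap≡1 {false} _ = refl

gap≡0 : ∀ {b} → gap b ≡ 0 → b ≡ true
gap≡0 {true} _ = refl

isB : Pair → ℕ
isB B = 1
isB _ = 0

isB-gaps : ∀ {t t′} → gaps t ≡ gaps t′ → isB t ≡ isB t′
isB-gaps {t} {t′} eq with gaps-differ {t} {t′} eq
... | inj₁ refl = refl
... | inj₂ (inj₁ (refl , refl)) = refl
... | inj₂ (inj₂ (refl , refl)) = refl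

bead-left : ∀ a b → bead a ≡ isB (toPair a b) + isA (toPair a b)
bead-left true  true  = refl
bead-left true  false = refl
bead-left false true  = refl
bead-left false false = refl

bead-right : ∀ a b → bead b ≡ isB (toPair a b) + isR (toPair a b)
bead-right true  true  = refl
bead-right true  false = refl
bead-right false true  = refl
bead-right false false = refl

beads-gaps : ∀ {a b a′ b′} → gaps (toPair a b) ≡ gaps (toPair a′ b′) → bead a + bead b ≡ bead a′ + bead b′
beads-gaps {a} {b} {a′} {b′} eq = +-cancelʳ-≡ (gap a + gap b) _ _ (trans (total a b)
  (trans (sym (total a′ b′)) (cong (bead a′ + bead b′ +_) (trans (sym (two a′ b′)) (trans (sym eq) (two a b))))))
  where
  two : ∀ a b → gaps (toPair a b) ≡ gap a + gap b
  two true  true  = refl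
  two true  false = refl
  two false true  = refl
  two false false = refl
  total : ∀ a b → bead a + bead b + (gap a + gap b) ≡ 2
  total true  true  = refl
  total true  false = refl
  total false true  = refl
  total false false = refl

gapsBelow beadsBelow : (ℕ → Bool) → ℕ → ℕ
gapsBelow f n = sumTo n λ x → gap (f x)
beadsBelow f n = sumTo n λ x → bead (f x)

beads+gaps : ∀ f n → beadsBelow f n + gapsBelow f n ≡ n
beads+gaps f zero = refl
beads+gaps f (suc n) = begin
  beadsBelow f n + bead (f n) + (gapsBelow f n + gap (f n))
    ≡⟨ interchange (beadsBelow f n) (bead (f n)) (gapsBelow f n) (gap (f n)) ⟩
  beadsBelow f n + gapsBelow f n + (bead (f n) + gap (f n))
    ≡⟨ cong₂ _+_ (beads+gaps f n) (bead+gap (f n)) ⟩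
  n + 1
    ≡⟨ +-comm n 1 ⟩
  suc n ∎
  where
  open ≡-Reasoning

sumTo-positive : ∀ n h → 1 ≤ sumTo n h → ∃ λ i → i < n × 1 ≤ h i
sumTo-positive (suc n) h p with h n in eq
... | suc _ = n , ≤-refl , subst (1 ≤_) (sym eq) (s≤s z≤n)
... | zero with sumTo-positive n h (subst (1 ≤_) (+-identityʳ _) p)
...   | i , i<n , q = i , m<n⇒m<1+n i<n , q

gapsBelow-gap : ∀ f y {x} → f y ≡ false → y < x → 1 ≤ gapsBelow f x
gapsBelow-gap f y {x} fy y<x = ≤-trans
  (subst (λ b → 1 ≤ gapsBelow f y + gap b) (sym fy) (m≤n+m 1 _)) (sumTo-≤-arg (λ x → gap (f x)) y<x)

gap-below : ∀ f x → 1 ≤ gapsBelow f x → ∃ λ y → y < x × f y ≡ false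
gap-below f x p with sumTo-positive x _ p
... | y , y<x , q = y , y<x , gap≡1 (≤-antisym (gap≤1 (f y)) q)

module Abacus (e′ : ℕ) where

  -- Runners 0 and 1 are the exchanged ones; `e′` counts the runners that stay fixed.
  e : ℕ
  e = 2 + e′

  window : (ℕ → Bool) → ℕ → ℕ
  window f x = sumTo e λ m → gap (f (suc x + m))

  gapsBelow-window : ∀ f x → gapsBelow f (suc x + e) ≡ gapsBelow f (suc x) + window f x
  gapsBelow-window f x = sumTo-split (suc x) e _

  -- For a gap and a later bead on the same runner, the arm length of the corresponding hook is the
  -- sum of the windows of the rows from the gap up to, but excluding, the bead. Here each window is
  -- required to be divisible separately; `balanced⇒` shows that this is no stronger.
  BalancedConfig : ℕ → (ℕ → Bool) → Set
  BalancedConfig d f = ∀ {r i j l} → r < e → i ≤ j → j < l →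
    f (r + i * e) ≡ false → f (r + l * e) ≡ true → d ∣ window f (r + j * e)

  RegularConfig : (ℕ → Bool) → Set
  RegularConfig f = ∀ x → 1 ≤ gapsBelow f (suc x) → 1 ≤ window f x

  pair : (ℕ → Bool) → ℕ → Pair
  pair f j = toPair (f (j * e)) (f (suc (j * e)))

  others : (ℕ → Bool) → ℕ → ℕ
  others f j = sumTo e′ λ m → gap (f (2 + j * e + m))

  record SameFrame (f f′ : ℕ → Bool) : Set where
    field
      others-same : ∀ j k → k < e′ → f (2 + k + j * e) ≡ f′ (2 + k + j * e)
      pairs-same  : ∀ j → gaps (pair f′ j) ≡ gaps (pair f j)

  SameFrame-sym : ∀ {f f′} → SameFrame f f′ → SameFrame f′ f
  SameFrame-sym S = record
    { others-same = λ j k k<e′ → sym (SameFrame.others-same S j k k<e′)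
    ; pairs-same = λ j → sym (SameFrame.pairs-same S j) }

  SameFrame-trans : ∀ {f g h} → SameFrame f g → SameFrame g h → SameFrame f h
  SameFrame-trans S S′ = record
    { others-same = λ j k k<e′ → trans (SameFrame.others-same S j k k<e′) (SameFrame.others-same S′ j k k<e′)
    ; pairs-same = λ j → trans (SameFrame.pairs-same S′ j) (SameFrame.pairs-same S j) }

  row-index : ∀ j k → 2 + k + j * e ≡ 2 + j * e + k
  row-index j k = cong (2 +_) (+-comm k (j * e))

  window-left : ∀ f j → window f (j * e) ≡ others f j + (gapʳ (pair f j) + gapˡ (pair f (suc j)))
  window-left f j = begin
    sumTo (suc e′) h + h (suc e′)
      ≡⟨ cong (_+ h (suc e′)) (sumTo-split 1 e′ h) ⟩
    h 0 + sumTo e′ (λ m → h (suc m)) + h (suc e′)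
      ≡⟨ cong₂ (λ x y → x + y + h (suc e′))
           (trans (cong (λ z → gap (f z)) (+-identityʳ _)) (sym (gapʳ-toPair (f (j * e)) _)))
           (sumTo-cong e′ λ m _ → cong (λ z → gap (f z)) (+-suc (suc (j * e)) m)) ⟩
    gapʳ (pair f j) + others f j + h (suc e′)
      ≡⟨ cong (gapʳ (pair f j) + others f j +_) (trans (cong (λ z → gap (f z)) next) (sym (gapˡ-toPair _ (f (suc (suc j * e)))))) ⟩
    gapʳ (pair f j) + others f j + gapˡ (pair f (suc j))
      ≡⟨ lemma (gapʳ (pair f j)) (others f j) _ ⟩
    others f j + (gapʳ (pair f j) + gapˡ (pair f (suc j))) ∎
    where
    open ≡-Reasoning
    h : ℕ → ℕ
    h m = gap (f (suc (j * e) + m))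
    next : suc (j * e) + suc e′ ≡ suc j * e
    next = trans (cong suc (+-suc (j * e) e′)) (cong (2 +_) (+-comm (j * e) e′))
    lemma : ∀ a b c → a + b + c ≡ b + (a + c)
    lemma = solve-∀

  window-right : ∀ f j → window f (suc (j * e)) ≡ others f j + gaps (pair f (suc j))
  window-right f j = begin
    others f j + h e′ + h (suc e′)
      ≡⟨ cong₂ (λ x y → others f j + x + y)
           (trans (cong (λ z → gap (f z)) next) (sym (gapˡ-toPair _ (f (suc (suc j * e))))))
           (trans (cong (λ z → gap (f z)) next′) (sym (gapʳ-toPair (f (suc j * e)) _))) ⟩
    others f j + gapˡ (pair f (suc j)) + gapʳ (pair f (suc j))
      ≡⟨ xy∙z≈x∙zy (others f j) (gapˡ (pair f (suc j))) (gapʳ (pair f (suc j))) ⟩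
    others f j + gaps (pair f (suc j)) ∎
    where
    open ≡-Reasoning
    h : ℕ → ℕ
    h m = gap (f (2 + j * e + m))
    next : 2 + j * e + e′ ≡ suc j * e
    next = cong (2 +_) (+-comm (j * e) e′)
    next′ : 2 + j * e + suc e′ ≡ suc (suc j * e)
    next′ = trans (+-suc (2 + j * e) e′) (cong suc next)

  module _ {f f′ : ℕ → Bool} (S : SameFrame f f′) where
    open SameFrame S

    others-eq : ∀ j → others f j ≡ others f′ j
    others-eq j = sumTo-cong e′ λ m m<e′ → cong gap
      (subst (λ z → f z ≡ f′ z) (row-index j m) (others-same j m m<e′))

    row-part : ∀ j k → k ≤ e′ →
      sumTo (2 + k) (λ m → gap (f (j * e + m))) ≡ sumTo (2 + k) (λ m → gap (f′ (j * e + m)))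
    row-part j k k≤e′ = trans (split f) (trans (cong₂ _+_ (sym (pairs-same j))
        (sumTo-cong k λ m m<k → cong gap (subst (λ z → f z ≡ f′ z) (index m) (others-same j m (<-≤-trans m<k k≤e′)))))
        (sym (split f′)))
      where
      index : ∀ m → 2 + m + j * e ≡ j * e + (2 + m)
      index m = +-comm (2 + m) (j * e)
      split : ∀ g → sumTo (2 + k) (λ m → gap (g (j * e + m))) ≡ gaps (pair g j) + sumTo k (λ m → gap (g (j * e + (2 + m))))
      split g = trans (sumTo-split 2 k _) (cong (_+ sumTo k (λ m → gap (g (j * e + (2 + m))))) two)
        where
        two : gap (g (j * e + 0)) + gap (g (j * e + 1)) ≡ gaps (pair g j)
        two rewrite +-identityʳ (j * e) | +-comm (j * e) 1 | gapʳ-toPair (g (j * e)) (g (suc (j * e)))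
          | gapˡ-toPair (g (j * e)) (g (suc (j * e))) = +-comm (gap (g (j * e))) _

    gapsBelow-row : ∀ j → gapsBelow f (j * e) ≡ gapsBelow f′ (j * e)
    gapsBelow-row zero = refl
    gapsBelow-row (suc j) = trans (sumTo-split′ e (j * e) _)
      (trans (cong₂ _+_ (gapsBelow-row j) (row-part j e′ ≤-refl)) (sym (sumTo-split′ e (j * e) _)))

    -- The bound `2 + k + j * e` never separates the two positions of a pair, so only whole pairs
    -- are counted. Windows on the runners from 2 on have both ends of this kind, which gives
    -- `window-same`.
    gapsBelow-same : ∀ j k → k ≤ e′ → gapsBelow f (2 + k + j * e) ≡ gapsBelow f′ (2 + k + j * e)
    gapsBelow-same j k k≤e′ = trans (sumTo-split′ (2 + k) (j * e) _)
      (trans (cong₂ _+_ (gapsBelow-row j) (row-part j k k≤e′)) (sym (sumTo-split′ (2 + k) (j * e) _)))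

    window-same : ∀ j k → k < e′ → window f (2 + k + j * e) ≡ window f′ (2 + k + j * e)
    window-same j k k<e′ = +-cancelˡ-≡ (gapsBelow f (suc x)) _ _ (begin
      gapsBelow f (suc x) + window f x     ≡⟨ gapsBelow-window f x ⟨
      gapsBelow f (suc x + e)              ≡⟨ cong (gapsBelow f) index ⟩
      gapsBelow f (2 + suc k + suc j * e)  ≡⟨ gapsBelow-same (suc j) (suc k) k<e′ ⟩
      gapsBelow f′ (2 + suc k + suc j * e) ≡⟨ cong (gapsBelow f′) index ⟨
      gapsBelow f′ (suc x + e)             ≡⟨ gapsBelow-window f′ x ⟩
      gapsBelow f′ (suc x) + window f′ x   ≡⟨ cong (_+ window f′ x) (gapsBelow-same j (suc k) k<e′) ⟨
      gapsBelow f (suc x) + window f′ x    ∎)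
      where
      open ≡-Reasoning
      x = 2 + k + j * e
      index : suc x + e ≡ 2 + suc k + suc j * e
      index = trans (+-assoc (3 + k) (j * e) e) (cong (3 + k +_) (+-comm (j * e) e))

    window-right-same : ∀ j → window f (suc (j * e)) ≡ window f′ (suc (j * e))
    window-right-same j = trans (window-right f j)
      (trans (cong₂ _+_ (others-eq j) (sym (pairs-same (suc j)))) (sym (window-right f′ j)))

  runner : ℕ → ℕ → (ℕ → Bool) → ℕ
  runner K r f = sumTo K λ j → bead (f (r + j * e))

  runner-left : ∀ K f → runner K 0 f ≡ sumTo K (λ j → isB (pair f j)) + countA K (pair f)
  runner-left K f = trans (sumTo-cong K λ j _ → bead-left _ (f (suc (j * e)))) (sumTo-+ K _ _)

  runner-right : ∀ K f → runner K 1 f ≡ sumTo K (λ j → isB (pair f j)) + countR K (pair f)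
  runner-right K f = trans (sumTo-cong K λ j _ → bead-right (f (j * e)) _) (sumTo-+ K _ _)

  weighted : ℕ → (ℕ → Bool) → ℕ
  weighted n f = sumTo n λ x → x * bead (f x)

  -- A pair that starts at position n and has beads l and r contributes n (l + r) + r, and the frame
  -- fixes l + r. The sum of the bead positions, which is the size up to a constant, thus depends on
  -- the word only through the beads on runner 1.
  weighted-row : ∀ {f f′} → SameFrame f f′ → ∀ K →
    weighted (K * e) f + runner K 1 f′ ≡ weighted (K * e) f′ + runner K 1 f
  weighted-row S zero = refl
  weighted-row {f} {f′} S (suc K) = begin
    weighted (suc K * e) f + (runner K 1 f′ + r f′)       ≡⟨ cong (_+ (runner K 1 f′ + r f′)) (sumTo-split′ e (K * e) _) ⟩
    weighted (K * e) f + row f + (runner K 1 f′ + r f′)   ≡⟨ interchange (weighted (K * e) f) (row f) (runner K 1 f′) (r f′) ⟩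
    weighted (K * e) f + runner K 1 f′ + (row f + r f′)   ≡⟨ cong₂ _+_ (weighted-row S K) rows ⟩
    weighted (K * e) f′ + runner K 1 f + (row f′ + r f)   ≡⟨ interchange (weighted (K * e) f′) (row f′) (runner K 1 f) (r f) ⟨
    weighted (K * e) f′ + row f′ + (runner K 1 f + r f)   ≡⟨ cong (_+ (runner K 1 f + r f)) (sumTo-split′ e (K * e) _) ⟨
    weighted (suc K * e) f′ + (runner K 1 f + r f)        ∎
    where
    open ≡-Reasoning
    open SameFrame S
    row l r : (ℕ → Bool) → ℕ
    row g = sumTo e λ m → (K * e + m) * bead (g (K * e + m))
    l g = bead (g (K * e))
    r g = bead (g (suc (K * e)))
    rest : (ℕ → Bool) → ℕ
    rest g = sumTo e′ λ m → (K * e + (2 + m)) * bead (g (K * e + (2 + m)))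
    row-eq : ∀ g → row g ≡ K * e * l g + suc (K * e) * r g + rest g
    row-eq g = trans (sumTo-split 2 e′ _) (cong (_+ rest g) two)
      where
      two : (K * e + 0) * bead (g (K * e + 0)) + (K * e + 1) * bead (g (K * e + 1)) ≡ K * e * l g + suc (K * e) * r g
      two rewrite +-identityʳ (K * e) | +-comm (K * e) 1 = refl
    rest-eq : rest f ≡ rest f′
    rest-eq = sumTo-cong e′ λ m m<e′ → cong (λ b → (K * e + (2 + m)) * bead b)
      (subst (λ z → f z ≡ f′ z) (+-comm (2 + m) (K * e)) (others-same K m m<e′))
    regroup : ∀ n a b t c → n * a + suc n * b + t + c ≡ n * (a + b) + (b + c) + t
    regroup = solve-∀
    rows : row f + r f′ ≡ row f′ + r f
    rows rewrite row-eq f | row-eq f′ | regroup (K * e) (l f) (r f) (rest f) (r f′)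
      | regroup (K * e) (l f′) (r f′) (rest f′) (r f) | rest-eq | +-comm (r f) (r f′) =
      cong (λ z → K * e * z + (r f′ + r f) + rest f′) (beads-gaps {f (K * e)} {_} {f′ (K * e)} (sym (pairs-same K)))

  quot-index : ∀ r j → r < e → (r + j * e) / e ≡ j
  quot-index r j r<e = trans (+-distrib-/-∣ʳ r (n∣m*n j)) (cong₂ _+_ (m<n⇒m/n≡0 r<e) (m*n/n≡m j e))

  rem-index : ∀ r j → r < e → (r + j * e) % e ≡ r
  rem-index r j r<e = trans ([m+kn]%n≡m%n r j e) (m<n⇒m%n≡m r<e)

  index : ∀ x → x ≡ x % e + x / e * e
  index x = m≡m%n+[m/n]*n x e

  next-row : ∀ r j → r + j * e + e ≡ r + suc j * e
  next-row r j = trans (+-assoc r _ e) (cong (r +_) (+-comm (j * e) e))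

  next-index : ∀ x → x + e ≡ x % e + suc (x / e) * e
  next-index x = trans (cong (_+ e) (index x)) (next-row (x % e) (x / e))

  insert : (ℕ → Pair) → (ℕ → Bool) → ℕ → ℕ → Bool
  insert T f x 0 = leftBead (T (x / e))
  insert T f x 1 = rightBead (T (x / e))
  insert T f x (suc (suc _)) = f x

  replacePairs : (ℕ → Pair) → (ℕ → Bool) → ℕ → Bool
  replacePairs T f x = insert T f x (x % e)

  module _ (T : ℕ → Pair) (f : ℕ → Bool) where

    pair-replace : ∀ j → pair (replacePairs T f) j ≡ T j
    pair-replace j
      rewrite rem-index 0 j (s≤s z≤n) | rem-index 1 j (s≤s (s≤s z≤n))
            | quot-index 0 j (s≤s z≤n) | quot-index 1 j (s≤s (s≤s z≤n)) = toPair-beads (T j)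

    others-replace : ∀ j k → k < e′ → replacePairs T f (2 + k + j * e) ≡ f (2 + k + j * e)
    others-replace j k k<e′ rewrite rem-index (2 + k) j (s≤s (s≤s k<e′)) = refl

    SameFrame-replace : (∀ j → gaps (T j) ≡ gaps (pair f j)) → SameFrame f (replacePairs T f)
    SameFrame-replace same = record
      { others-same = λ j k k<e′ → sym (others-replace j k k<e′)
      ; pairs-same = λ j → trans (cong gaps (pair-replace j)) (same j) }

  slide : ∀ f x → window f x + gap (f (suc x + e)) ≡ window f (suc x) + gap (f (suc x))
  slide f x = +-cancelˡ-≡ (gapsBelow f (suc x)) _ _ (begin
    gapsBelow f (suc x) + (window f x + gap (f (suc x + e)))  ≡⟨ +-assoc (gapsBelow f (suc x)) _ _ ⟨
    gapsBelow f (suc x) + window f x + gap (f (suc x + e))    ≡⟨ cong (_+ gap (f (suc x + e))) (gapsBelow-window f x) ⟨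
    gapsBelow f (suc (suc x) + e)                             ≡⟨ gapsBelow-window f (suc x) ⟩
    gapsBelow f (suc x) + gap (f (suc x)) + window f (suc x)  ≡⟨ xy∙z≈x∙zy (gapsBelow f (suc x)) _ _ ⟩
    gapsBelow f (suc x) + (window f (suc x) + gap (f (suc x))) ∎)
    where
    open ≡-Reasoning

  module _ {d : ℕ} (1<d : 1 < d) {f : ℕ → Bool} (bal : BalancedConfig d f) (reg : RegularConfig f) where

    -- A window can only lose a gap at a position which satisfies the divisibility condition.
    window≥d : ∀ {r i l} → r < e → i < l → f (r + i * e) ≡ false → f (r + l * e) ≡ true →
      ∀ x → r + i * e ≤ x → d ≤ window f x
    window≥d {r} {i} {l} r<e i<l fi fl x y≤x with m≤n⇒m<n∨m≡n y≤x
    ... | inj₂ refl = ∣⇒≤ ⦃ >-nonZero (reg _ (gapsBelow-gap f _ fi ≤-refl)) ⦄ (bal r<e ≤-refl i<l fi fl)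
    window≥d {r} {i} {l} r<e i<l fi fl (suc x) y≤x | inj₁ (s≤s y≤x′)
      with window≥d r<e i<l fi fl x y≤x′ | f (suc x) in eq | f (suc x + e) in eq′ | slide f x
    ... | ih | true  | b     | s = ≤-trans ih (≤-trans (m≤m+n _ (gap b)) (≤-reflexive (trans s (+-identityʳ _))))
    ... | ih | false | false | s = ≤-trans ih (≤-reflexive (+-cancelʳ-≡ 1 _ _ s))
    ... | ih | false | true  | s = ∣⇒≤ ⦃ >-nonZero (reg _ (gapsBelow-gap f _ eq ≤-refl)) ⦄
      (subst (λ z → d ∣ window f z) (sym (index (suc x)))
        (bal {l = suc (suc x / e)} (m%n<n (suc x) e) (≤-refl {suc x / e}) ≤-refl
          (trans (cong f (sym (index (suc x)))) eq) (trans (cong f (sym (next-index (suc x)))) eq′)))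

  rowOf-< : ∀ {y j} → y < j * e → y / e < j
  rowOf-< {y} {j} y<je = m<n*o⇒m/o<n y<je

  module _ {d : ℕ} (1<d : 1 < d) {f f′ : ℕ → Bool} (S : SameFrame f f′)
    (bal : BalancedConfig d f) (reg : RegularConfig f)
    (oldRA : ∀ j → pair f′ j ≡ R → pair f′ (suc j) ≡ A → pair f j ≡ R × pair f (suc j) ≡ A) where
    open SameFrame S

    private
      -- If this window were empty, there would be no gaps between the pairs `j` and `suc j`. The
      -- window at `suc (j * e)`, nonempty and the same for `f` and `f′`, then makes the pair
      -- `suc j` of `f′` an A, while its pair `j` is R or B.
      regular-left : ∀ j → 1 ≤ gapsBelow f′ (suc (j * e)) → window f′ (j * e) ≢ 0
      regular-left j p w≡0 = absurd
        where
        open ≤-Reasoning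
        T = pair f
        T′ = pair f′
        sum≡0 : others f′ j + (gapʳ (T′ j) + gapˡ (T′ (suc j))) ≡ 0
        sum≡0 = trans (sym (window-left f′ j)) w≡0
        others≡0 : others f j ≡ 0
        others≡0 = trans (others-eq S j) (m+n≡0⇒m≡0 (others f′ j) sum≡0)
        right≡0 : gapʳ (T′ j) ≡ 0
        right≡0 = m+n≡0⇒m≡0 (gapʳ (T′ j)) (m+n≡0⇒n≡0 (others f′ j) sum≡0)
        left≡0 : gapˡ (T′ (suc j)) ≡ 0
        left≡0 = m+n≡0⇒n≡0 (gapʳ (T′ j)) (m+n≡0⇒n≡0 (others f′ j) sum≡0)
        w-right : window f (suc (j * e)) ≡ gaps (T (suc j))
        w-right = trans (window-right f j) (cong (_+ gaps (T (suc j))) others≡0)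
        1≤gaps′ : 1 ≤ gaps (T (suc j))
        1≤gaps′ = subst (1 ≤_) w-right (reg (suc (j * e))
          (subst (1 ≤_) (sym (gapsBelow-same S j 0 z≤n)) (≤-trans p (m≤m+n _ _))))
        nextA : T′ (suc j) ≡ A
        nextA with gapˡ≡0 left≡0
        ... | inj₁ a = a
        ... | inj₂ n = ⊥-elim (n≮0 (subst (1 ≤_) (trans (sym (pairs-same (suc j))) (cong gaps n)) 1≤gaps′))
        w≡1 : window f (suc (j * e)) ≡ 1
        w≡1 = trans w-right (trans (sym (pairs-same (suc j))) (cong gaps nextA))
        absurd : ⊥
        absurd with gapʳ≡0 right≡0
        -- The same R and A occur in `f`, whose window after the left gap of the R would be empty.
        ... | inj₁ r with oldRA j r nextA
        ...   | r′ , a′ = n≮0 (subst (1 ≤_) wf≡0 (reg (j * e) (gapsBelow-gap f (j * e) left-gap ≤-refl)))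
          where
          wf≡0 : window f (j * e) ≡ 0
          wf≡0 = trans (window-left f j) (cong₂ _+_ others≡0 (cong₂ _+_ (cong gapʳ r′) (cong gapˡ a′)))
          left-gap : f (j * e) ≡ false
          left-gap = trans (sym (leftBead-toPair _ (f (suc (j * e))))) (cong leftBead r′)
        -- Row `j` of `f` consists of beads, so the gap `y` has a later bead on its runner. All
        -- windows from `y` on then have at least `d` gaps, but the one at `suc (j * e)` has a
        -- single one.
        absurd | inj₂ n with gap-below f (j * e) (subst (1 ≤_) below p)
          where
          below : gapsBelow f′ (suc (j * e)) ≡ gapsBelow f (j * e)
          below = trans (cong (gapsBelow f′ (j * e) +_)
              (trans (sym (gapˡ-toPair _ (f′ (suc (j * e))))) (cong gapˡ n)))
            (trans (+-identityʳ _) (sym (gapsBelow-row S j)))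
        ...   | y , y<je , fy = <⇒≱ 1<d (subst (d ≤_) w≡1
                (window≥d 1<d bal reg (m%n<n y e) (rowOf-< {y} {j} y<je)
                  (trans (cong f (sym (index y))) fy) (beads (y % e) (m%n<n y e)) (suc (j * e))
                  (subst (_≤ suc (j * e)) (index y) (<⇒≤ (m<n⇒m<1+n y<je)))))
          where
          nf : T j ≡ B
          nf = gaps≡0 (trans (sym (pairs-same j)) (cong gaps n))
          beads : ∀ r → r < e → f (r + j * e) ≡ true
          beads 0 _ = trans (sym (leftBead-toPair _ (f (suc (j * e))))) (cong leftBead nf)
          beads 1 _ = trans (sym (rightBead-toPair (f (j * e)) _)) (cong rightBead nf)
          beads (suc (suc k)) (s≤s (s≤s k<e′)) = gap≡0
            (trans (cong (λ z → gap (f z)) (row-index j k)) (sumTo≡0 e′ others≡0 k<e′))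

    regular-reflected : RegularConfig f′
    regular-reflected x = subst (λ x → 1 ≤ gapsBelow f′ (suc x) → 1 ≤ window f′ x) (sym (index x))
      (go (x % e) (x / e) (m%n<n x e))
      where
      go : ∀ r j → r < e → 1 ≤ gapsBelow f′ (suc (r + j * e)) → 1 ≤ window f′ (r + j * e)
      go 0 j _ p = n≢0⇒n>0 (regular-left j p)
      go 1 j _ p = subst (1 ≤_) (window-right-same S j)
        (reg _ (subst (1 ≤_) (sym (gapsBelow-same S j 0 z≤n)) p))
      go (suc (suc k)) j (s≤s (s≤s k<e′)) p = subst (1 ≤_) (window-same S j k k<e′)
        (reg _ (subst (1 ≤_) (sym (gapsBelow-same S j (suc k) k<e′)) p))

  module Reflect {d : ℕ} (1<d : 1 < d) (K : ℕ) where

    Vanishing : (ℕ → Bool) → Set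
    Vanishing f = ∀ {x} → K * e ≤ x → f x ≡ false

    module _ (f : ℕ → Bool) where
      open Reflection 1<d (others f) K

      valid-pairs : BalancedConfig d f → Valid (pair f)
      valid-pairs bal = left , right
        where
        left : ∀ {i j k} → i ≤ j → j < k → gapˡ (pair f i) ≡ 1 → gapˡ (pair f k) ≡ 0 → _
        left {i} {j} {k} i≤j j<k p q = subst (d ∣_) (window-left f j) (bal (s≤s z≤n) i≤j j<k
          (gap≡1 (trans (sym (gapˡ-toPair _ (f (suc (i * e))))) p)) (gap≡0 (trans (sym (gapˡ-toPair _ (f (suc (k * e))))) q)))
        right : ∀ {i j k} → i ≤ j → j < k → gapʳ (pair f i) ≡ 1 → gapʳ (pair f k) ≡ 0 → _
        right {i} {j} {k} i≤j j<k p q = subst (d ∣_) (window-right f j) (bal (s≤s (s≤s z≤n)) i≤j j<k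
          (gap≡1 (trans (sym (gapʳ-toPair (f (i * e)) _)) p)) (gap≡0 (trans (sym (gapʳ-toPair (f (k * e)) _)) q)))

      bounded-pairs : Vanishing f → Bounded (pair f)
      bounded-pairs van {j} K≤j rewrite van (*-monoˡ-≤ e K≤j) | van (m≤n⇒m≤1+n (*-monoˡ-≤ e K≤j)) = refl

    module _ {f f′ : ℕ → Bool} (S : SameFrame f f′) where
      open SameFrame S

      vanishing-same : Vanishing f → Vanishing f′
      vanishing-same van {x} Ke≤x = subst (λ x → f′ x ≡ false) (sym (index x))
        (go (x % e) (x / e) (m%n<n x e) (subst (K * e ≤_) (index x) Ke≤x)
          (subst (_≤ x / e) (m*n/n≡m K e) (/-monoˡ-≤ e Ke≤x)))
        where
        isE : ∀ {j} → K ≤ j → pair f′ j ≡ E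
        isE {j} K≤j = gaps≡2 (trans (pairs-same j)
          (cong gaps (cong₂ toPair (van (*-monoˡ-≤ e K≤j)) (van (m≤n⇒m≤1+n (*-monoˡ-≤ e K≤j))))))
        go : ∀ r j → r < e → K * e ≤ r + j * e → K ≤ j → f′ (r + j * e) ≡ false
        go 0 j _ _ K≤j = trans (sym (leftBead-toPair _ (f′ (suc (j * e))))) (cong leftBead (isE K≤j))
        go 1 j _ _ K≤j = trans (sym (rightBead-toPair (f′ (j * e)) _)) (cong rightBead (isE K≤j))
        go (suc (suc k)) j (s≤s (s≤s k<e′)) p K≤j = trans (sym (others-same j k k<e′)) (van p)

      runner-other : ∀ {r} → 2 ≤ r → r < e → runner K r f ≡ runner K r f′
      runner-other {suc (suc k)} _ (s≤s (s≤s k<e′)) = sumTo-cong K λ j _ → cong bead (others-same j k k<e′)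
      runner-other {1} (s≤s ()) _

      isB-same : sumTo K (λ j → isB (pair f′ j)) ≡ sumTo K (λ j → isB (pair f j))
      isB-same = sumTo-cong K λ j _ → isB-gaps {pair f′ j} (pairs-same j)

      runners-sum : runner K 0 f′ + runner K 1 f′ ≡ runner K 0 f + runner K 1 f
      runners-sum = trans (sym (sumTo-+ K _ _)) (trans
        (sumTo-cong K λ j _ → beads-gaps {f′ (j * e)} {_} {f (j * e)} (pairs-same j)) (sumTo-+ K _ _))

      beadsBelow-same : beadsBelow f (K * e) ≡ beadsBelow f′ (K * e)
      beadsBelow-same = +-cancelʳ-≡ (gapsBelow f (K * e)) _ _ (trans (beads+gaps f (K * e))
        (trans (sym (beads+gaps f′ (K * e))) (cong (beadsBelow f′ (K * e) +_) (sym (gapsBelow-row S K)))))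

    reflect : ∀ {f} → Vanishing f → BalancedConfig d f → RegularConfig f →
      ∃ λ f′ → SameFrame f f′ × BalancedConfig d f′ × RegularConfig f′ ×
        runner K 0 f′ ≡ runner K 1 f × runner K 1 f′ ≡ runner K 0 f
    reflect {f} van bal reg = f′ , S , balanced , regular-reflected 1<d S bal reg oldRA′ , swap₀ , swap₁
      where
      open Reflection 1<d (others f) K
      m = mirror (bounded-pairs f van) (valid-pairs f bal)
      T′ = proj₁ m
      open Mirror (proj₂ m)
      f′ = replacePairs T′ f
      pr : ∀ j → pair f′ j ≡ T′ j
      pr = pair-replace T′ f
      S : SameFrame f f′
      S = SameFrame-replace T′ f same
      open SameFrame S
      oldRA′ : ∀ j → pair f′ j ≡ R → pair f′ (suc j) ≡ A → pair f j ≡ R × pair f (suc j) ≡ A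
      oldRA′ j p q = oldRA j (trans (sym (pr j)) p) (trans (sym (pr (suc j))) q)
      balanced : BalancedConfig d f′
      balanced {0} {i} {j} {l} _ i≤j j<l p q = subst (d ∣_)
        (sym (trans (window-left f′ j) (cong₂ _+_ (sym (others-eq S j)) (cong₂ _+_ (cong gapʳ (pr j)) (cong gapˡ (pr (suc j)))))))
        (proj₁ valid i≤j j<l
          (trans (sym (cong gapˡ (pr i))) (trans (gapˡ-toPair _ (f′ (suc (i * e)))) (cong gap p)))
          (trans (sym (cong gapˡ (pr l))) (trans (gapˡ-toPair _ (f′ (suc (l * e)))) (cong gap q))))
      balanced {1} {i} {j} {l} _ i≤j j<l p q = subst (d ∣_)
        (sym (trans (window-right f′ j) (cong₂ _+_ (sym (others-eq S j)) (cong gaps (pr (suc j))))))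
        (proj₂ valid i≤j j<l
          (trans (sym (cong gapʳ (pr i))) (trans (gapʳ-toPair (f′ (i * e)) _) (cong gap p)))
          (trans (sym (cong gapʳ (pr l))) (trans (gapʳ-toPair (f′ (l * e)) _) (cong gap q))))
      balanced {suc (suc k)} {i} {j} {l} r<e@(s≤s (s≤s k<e′)) i≤j j<l p q = subst (d ∣_)
        (window-same S j k k<e′)
        (bal r<e i≤j j<l (trans (others-same i k k<e′) p) (trans (others-same l k k<e′) q))
      swap₀ : runner K 0 f′ ≡ runner K 1 f
      swap₀ = trans (runner-left K f′) (trans (cong₂ _+_ (isB-same S)
        (trans (sumTo-cong K λ j _ → cong isA (pr j)) counts)) (sym (runner-right K f)))
      swap₁ : runner K 1 f′ ≡ runner K 0 f
      swap₁ = +-cancelˡ-≡ (runner K 0 f′) _ _ (trans (runners-sum S) (trans (+-comm (runner K 0 f) _)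
        (cong (_+ runner K 0 f) (sym swap₀))))

    -- The frame fixes the number of B's, so equally many beads on runner 0 means equally many A's,
    -- and `unique` applies.
    reflect-unique : ∀ {f f′} → SameFrame f f′ → Vanishing f → BalancedConfig d f → BalancedConfig d f′ →
      runner K 0 f ≡ runner K 0 f′ → ∀ x → f x ≡ f′ x
    reflect-unique {f} {f′} S van bal bal′ eq x = subst (λ x → f x ≡ f′ x) (sym (index x))
        (go (x % e) (x / e) (m%n<n x e))
      where
      open Reflection 1<d (others f) K
      open SameFrame S
      van′ = vanishing-same S van
      valid′ : Valid (pair f′)
      valid′ = let L , Rt = valid-pairs f′ bal′ in
        (λ {i} {j} i≤j j<k p q → subst (λ o → d ∣ o + (gapʳ (pair f′ j) + gapˡ (pair f′ (suc j)))) (sym (others-eq S j)) (L i≤j j<k p q)) ,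
        (λ {i} {j} i≤j j<k p q → subst (λ o → d ∣ o + gaps (pair f′ (suc j))) (sym (others-eq S j)) (Rt i≤j j<k p q))
      pairs : ∀ j → pair f j ≡ pair f′ j
      pairs = unique (bounded-pairs f van) (bounded-pairs f′ van′) (valid-pairs f bal) valid′ pairs-same
        (+-cancelˡ-≡ _ _ _ (trans (sym (runner-left K f)) (trans eq (trans (runner-left K f′)
          (cong (_+ countA K (pair f′)) (isB-same S))))))
      go : ∀ r j → r < e → f (r + j * e) ≡ f′ (r + j * e)
      go 0 j _ = trans (sym (leftBead-toPair _ (f (suc (j * e))))) (trans (cong leftBead (pairs j)) (leftBead-toPair _ (f′ (suc (j * e)))))
      go 1 j _ = trans (sym (rightBead-toPair (f (j * e)) _)) (trans (cong rightBead (pairs j)) (rightBead-toPair (f′ (j * e)) _))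
      go (suc (suc k)) j (s≤s (s≤s k<e′)) = others-same j k k<e′

-- Partitions as configurations

-- The beads of config xs M are the elements of the β-set shifted by M; it is
-- meaningful only for length xs ≤ M.
config : List ℕ → ℕ → ℕ → Bool
config []       M       n = n <ᵇ M
config (x ∷ xs) zero    n = false
config (x ∷ xs) (suc M) n = (n ≡ᵇ x + M) ∨ config xs M n

<ᵇ-true : ∀ {m n} → m < n → (m <ᵇ n) ≡ true
<ᵇ-true m<n = Equivalence.to T-≡ (<⇒<ᵇ m<n)

<ᵇ-false : ∀ {m n} → n ≤ m → (m <ᵇ n) ≡ false
<ᵇ-false {m} {n} n≤m with m <ᵇ n in eq
... | false = refl
... | true = ⊥-elim (<⇒≱ (<ᵇ⇒< m n (Equivalence.from T-≡ eq)) n≤m)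

<ᵇ-true⁻ : ∀ {m n} → (m <ᵇ n) ≡ true → m < n
<ᵇ-true⁻ {m} {n} eq = <ᵇ⇒< m n (Equivalence.from T-≡ eq)

≡ᵇ-false : ∀ {m n} → m ≢ n → (m ≡ᵇ n) ≡ false
≡ᵇ-false {m} {n} m≢n with m ≡ᵇ n in eq
... | false = refl
... | true = ⊥-elim (m≢n (≡ᵇ⇒≡ m n (Equivalence.from T-≡ eq)))

config-top : ∀ x xs M → config (x ∷ xs) (suc M) (x + M) ≡ true
config-top x xs M rewrite Equivalence.to T-≡ (≡⇒≡ᵇ (x + M) (x + M) refl) = refl

config-other : ∀ x xs M {n} → n ≢ x + M → config (x ∷ xs) (suc M) n ≡ config xs M n
config-other x xs M {n} n≢ rewrite ≡ᵇ-false n≢ = refl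

config-bound : ∀ {x} xs M {n} → All (_≤ x) xs → length xs ≤ M → x + M ≤ n → config xs M n ≡ false
config-bound [] M {n} _ _ p = <ᵇ-false (≤-trans (m≤n+m M _) p)
config-bound {x} (y ∷ ys) (suc M) {n} (y≤x ∷ ≤x) (s≤s l) p = trans
  (config-other y ys M (λ { refl → <⇒≱ (≤-<-trans (+-monoˡ-≤ M y≤x) (+-monoʳ-< x (n<1+n M))) p }))
  (config-bound ys M ≤x l (≤-trans (+-monoʳ-≤ x (n≤1+n M)) p))

module _ {x xs M} (xs≤x : All (_≤ x) xs) (len : length xs ≤ M) where

  config-above : ∀ {n} → x + M < n → config (x ∷ xs) (suc M) n ≡ false
  config-above x+M<n = trans (config-other x xs M (λ { refl → <-irrefl refl x+M<n }))
    (config-bound xs M xs≤x len (<⇒≤ x+M<n))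

  config-below : ∀ {n} → n < x + M → config (x ∷ xs) (suc M) n ≡ config xs M n
  config-below n< = config-other x xs M λ { refl → <-irrefl refl n< }

  sumTo-config : ∀ (h : ℕ → Bool → ℕ) → (∀ i → h i false ≡ 0) → ∀ {n} → x + M < n →
    sumTo n (λ i → h i (config (x ∷ xs) (suc M) i)) ≡ sumTo (x + M) (λ i → h i (config xs M i)) + h (x + M) true
  sumTo-config h h0 x+M<n = trans
    (sumTo-extend _ x+M<n λ i p → trans (cong (h i) (config-above p)) (h0 i))
    (cong₂ _+_ (sumTo-cong (x + M) λ i i< → cong (h i) (config-below i<)) (cong (h (x + M)) (config-top x xs M)))

tri : ℕ → ℕ
tri M = sumTo M λ i → i

sumTo-empty : ∀ (h : ℕ → Bool → ℕ) → (∀ i → h i false ≡ 0) → ∀ {M n} → M ≤ n →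
  sumTo n (λ i → h i (i <ᵇ M)) ≡ sumTo M (λ i → h i true)
sumTo-empty h h0 {M} M≤n = trans (sumTo-extend _ M≤n λ i p → trans (cong (h i) (<ᵇ-false p)) (h0 i))
  (sumTo-cong M λ i i<M → cong (h i) (<ᵇ-true i<M))

sumTo-1 : ∀ n → sumTo n (λ _ → 1) ≡ n
sumTo-1 zero = refl
sumTo-1 (suc n) = trans (cong (_+ 1) (sumTo-1 n)) (+-comm n 1)

beadsBelow-config : ∀ {x} xs M {n} → All (_≤ x) xs → AllPairs _≥_ xs → length xs ≤ M → x + M ≤ n →
  beadsBelow (config xs M) n ≡ M
beadsBelow-config {x} [] M _ _ _ p =
  trans (sumTo-empty (λ _ → bead) (λ _ → refl) (≤-trans (m≤n+m M x) p)) (sumTo-1 M)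
beadsBelow-config {x} (y ∷ ys) (suc M) (y≤x ∷ _) (ys≤y ∷ srt) (s≤s l) p = trans
  (sumTo-config ys≤y l (λ _ → bead) (λ _ → refl) (≤-trans (≤-<-trans (+-monoˡ-≤ M y≤x) (+-monoʳ-< x (n<1+n M))) p))
  (trans (cong (_+ 1) (beadsBelow-config ys M ys≤y srt l ≤-refl)) (+-comm M 1))

gapsBelow-config : ∀ {x} xs M {n} → All (_≤ x) xs → AllPairs _≥_ xs → length xs ≤ M → x + M ≤ n →
  M + gapsBelow (config xs M) n ≡ n
gapsBelow-config xs M {n} a s l p = trans (cong (_+ gapsBelow (config xs M) n) (sym (beadsBelow-config xs M a s l p)))
  (beads+gaps (config xs M) n)

-- The bead of the `j`-th part lies at that part plus M - j, and the offsets M - j for `j` from 1 to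
-- `M` add up to `tri M`.
weighted-config : ∀ {x} xs M {n} → All (_≤ x) xs → AllPairs _≥_ xs → length xs ≤ M → x + M ≤ n →
  sumTo n (λ i → i * bead (config xs M i)) ≡ sum xs + tri M
weighted-config {x} [] M _ _ _ p = trans (sumTo-empty (λ i b → i * bead b) *-zeroʳ (≤-trans (m≤n+m M x) p))
  (sumTo-cong M λ i _ → *-identityʳ i)
weighted-config {x} (y ∷ ys) (suc M) (y≤x ∷ _) (ys≤y ∷ srt) (s≤s l) p = trans
  (sumTo-config ys≤y l (λ i b → i * bead b) *-zeroʳ (≤-trans (≤-<-trans (+-monoˡ-≤ M y≤x) (+-monoʳ-< x (n<1+n M))) p))
  (trans (cong₂ _+_ (weighted-config ys M ys≤y srt l ≤-refl) (*-identityʳ (y + M))) (lemma (sum ys) (tri M) y M))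
  where
  lemma : ∀ s t y m → s + t + (y + m) ≡ y + s + (t + m)
  lemma = solve-∀

gapsBelow-top : ∀ {x xs} M → AllPairs _≥_ (x ∷ xs) → length xs ≤ M →
  gapsBelow (config (x ∷ xs) (suc M)) (x + M) ≡ x
gapsBelow-top {x} {xs} M (xs≤x ∷ srt) l = trans
  (sumTo-cong (x + M) λ i i< → cong gap (config-below xs≤x l i<))
  (+-cancelˡ-≡ M _ _ (trans (gapsBelow-config xs M xs≤x srt l ≤-refl) (+-comm x M)))

row-bead : ∀ xs M → AllPairs _≥_ xs → length xs ≤ M → ∀ j → 1 ≤ j → j ≤ M →
  ∃ λ n → nth xs j + M ≡ n + j × config xs M n ≡ true × gapsBelow (config xs M) n ≡ nth xs j
row-bead [] M _ _ (suc j) _ j<M = M ∸ suc j , sym (m∸n+n≡m j<M) , <ᵇ-true (∸-monoʳ-< (s≤s z≤n) j<M) ,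
  zero⇒sumTo≡0 _ λ i i< → cong gap (<ᵇ-true (<-≤-trans i< (m∸n≤m M (suc j))))
row-bead (x ∷ xs) (suc M) srt (s≤s l) 1 _ _ =
  x + M , trans (+-suc x M) (+-comm 1 (x + M)) , config-top x xs M , gapsBelow-top M srt l
row-bead (x ∷ xs) (suc M) (xs≤x ∷ srt) (s≤s l) (suc (suc j)) _ (s≤s j≤M)
  with row-bead xs M srt l (suc j) (s≤s z≤n) j≤M
... | n , eq , true′ , below = n , trans (+-suc _ M) (trans (cong suc eq) (sym (+-suc n (suc j)))) ,
  trans (config-below xs≤x l n<) true′ ,
  trans (sumTo-cong n λ i i<n → cong gap (config-below xs≤x l (<-trans i<n n<))) below
  where
  n< : n < x + M
  n< = ≰⇒> λ p → true∧false true′ (config-bound xs M xs≤x l p)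

bead-row : ∀ xs M → length xs ≤ M → ∀ n → config xs M n ≡ true →
  ∃ λ j → 1 ≤ j × j ≤ M × nth xs j + M ≡ n + j
bead-row [] M _ n eq with <ᵇ-true⁻ {n} eq
... | n<M with M ∸ n in p
...   | zero = ⊥-elim (m>n⇒m∸n≢0 n<M p)
...   | suc j = suc j , s≤s z≤n , ≤-trans (≤-reflexive (sym p)) (m∸n≤m M n) ,
        trans (sym (m+[n∸m]≡n (<⇒≤ n<M))) (cong (n +_) p)
bead-row (x ∷ xs) (suc M) (s≤s l) n eq with n ≟ x + M
... | yes refl = 1 , ≤-refl , s≤s z≤n , trans (+-suc x M) (+-comm 1 (x + M))
... | no n≢ with bead-row xs M l n (trans (sym (config-other x xs M n≢)) eq)
...   | suc j , _ , j<M , p = suc (suc j) , s≤s z≤n , s≤s j<M ,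
        trans (+-suc _ M) (trans (cong suc p) (sym (+-suc n (suc j))))

-- The parts larger than the number g of gaps below `a` are the beads above `a`, and a - g beads lie
-- below `a`; together they are all `M` beads.
conj-gap : ∀ xs M → AllPairs _≥_ xs → length xs ≤ M → ∀ a → config xs M a ≡ false →
  length (filter (suc (gapsBelow (config xs M) a) ≤?_) xs) + a ≡ M + gapsBelow (config xs M) a
conj-gap [] M srt l a gp = sym (gapsBelow-config {0} [] M [] [] z≤n (≮⇒≥ λ a<M → true∧false (<ᵇ-true a<M) gp))
conj-gap (x ∷ xs) (suc M) srt@(xs≤x ∷ srt′) (s≤s l) a gp with <-cmp a (x + M)
... | tri≈ _ refl _ = true∧false (config-top x xs M) gp
... | tri> _ _ x+M<a = trans (cong (λ z → length z + a) (filter-none (suc g ≤?_) {x ∷ xs} (≤x⇒ ≤-refl ∷ All.map ≤x⇒ xs≤x)))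
      (sym (gapsBelow-config (x ∷ xs) (suc M) (≤-refl ∷ xs≤x) srt (s≤s l) (≤-trans (≤-reflexive (+-suc x M)) x+M<a)))
  where
  g = gapsBelow (config (x ∷ xs) (suc M)) a
  x≤g : x ≤ g
  x≤g = subst (_≤ g) (gapsBelow-top M srt l) (sumTo-≤-arg _ (<⇒≤ x+M<a))
  ≤x⇒ : ∀ {y} → y ≤ x → ¬ suc g ≤ y
  ≤x⇒ y≤x p = <⇒≱ (≤-trans p y≤x) x≤g
... | tri< a<x+M _ _ = trans (cong (λ z → length z + a) (filter-accept (suc g ≤?_) {x} {xs} g<x))
      (cong suc (subst (λ z → length (filter (suc z ≤?_) xs) + a ≡ M + z) (sym g≡)
        (conj-gap xs M srt′ l a (trans (sym (config-below xs≤x l a<x+M)) gp))))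
  where
  g = gapsBelow (config (x ∷ xs) (suc M)) a
  g≡ : g ≡ gapsBelow (config xs M) a
  g≡ = sumTo-cong a λ i i<a → cong gap (config-below xs≤x l (<-trans i<a a<x+M))
  g<x : g < x
  g<x = subst (g <_) (gapsBelow-top M srt l) (subst (_≤ gapsBelow (config (x ∷ xs) (suc M)) (x + M))
    (trans (cong (λ b → g + gap b) gp) (+-comm g 1)) (sumTo-≤-arg (λ i → gap (config (x ∷ xs) (suc M) i)) a<x+M))

-- The highest bead determines the first part, and removing it leaves the configuration of the tail
-- with one bead less. Positivity separates a genuine part from a bead that stands for a part 0.
config-injective : ∀ xs ys M → AllPairs _≥_ xs → AllPairs _≥_ ys → All (0 <_) xs → All (0 <_) ys →
  length xs ≤ M → length ys ≤ M → (∀ n → config xs M n ≡ config ys M n) → xs ≡ ys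
config-injective [] [] M _ _ _ _ _ _ _ = refl
config-injective [] (y ∷ ys) (suc M) _ _ _ (0<y ∷ _) _ _ eq =
  true∧false (trans (eq (y + M)) (config-top y ys M)) (<ᵇ-false (+-monoˡ-≤ M 0<y))
config-injective (x ∷ xs) [] (suc M) _ _ (0<x ∷ _) _ _ _ eq =
  true∧false (trans (sym (eq (x + M))) (config-top x xs M)) (<ᵇ-false (+-monoˡ-≤ M 0<x))
config-injective (x ∷ xs) (y ∷ ys) (suc M) (xs≤x ∷ sx) (ys≤y ∷ sy) (_ ∷ px) (_ ∷ py) (s≤s lx) (s≤s ly) eq = go x≡y
  where
  top≤ : ∀ {x y xs ys} → All (_≤ y) ys → length ys ≤ M → config (y ∷ ys) (suc M) (x + M) ≡ true → x ≤ y
  top≤ {x} {y} ys≤y ly p = ≮⇒≥ λ y<x → true∧false p (config-above ys≤y ly (+-monoˡ-< M y<x))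
  x≡y : x ≡ y
  x≡y = ≤-antisym (top≤ {xs = xs} ys≤y ly (trans (sym (eq (x + M))) (config-top x xs M)))
          (top≤ {xs = ys} xs≤x lx (trans (eq (y + M)) (config-top y ys M)))
  go : x ≡ y → x ∷ xs ≡ y ∷ ys
  go refl = cong (x ∷_) (config-injective xs ys M sx sy px py lx ly eq′)
    where
    eq′ : ∀ n → config xs M n ≡ config ys M n
    eq′ n with n ≟ x + M
    ... | yes refl = trans (config-bound xs M xs≤x lx ≤-refl) (sym (config-bound ys M ys≤y ly ≤-refl))
    ... | no n≢ = trans (sym (config-other x xs M n≢)) (trans (eq n) (config-other x ys M n≢))

-- Each of the `t` additional beads stands for a part 0 and enters at the bottom. This freedom
-- allows any chosen position to be brought onto runner 0.
config-shift : ∀ xs M → length xs ≤ M → ∀ t n → config xs (t + M) (t + n) ≡ config xs M n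
config-shift xs M l zero n = refl
config-shift xs M l (suc t) n = trans (one xs (t + M) (≤-trans l (m≤n+m M t)) (t + n)) (config-shift xs M l t n)
  where
  one : ∀ xs M → length xs ≤ M → ∀ n → config xs (suc M) (suc n) ≡ config xs M n
  one [] M _ n = refl
  one (x ∷ xs) (suc M) (s≤s l) n rewrite +-suc x M = cong ((n ≡ᵇ x + M) ∨_) (one xs M l n)

-- A bead gives a part equal to the number of gaps below it. Beads below the first gap would give
-- parts 0 and are dropped, so there may be fewer parts than beads.
addPart : Bool → ℕ → List ℕ → List ℕ
addPart true (suc g) xs = suc g ∷ xs
addPart _    _       xs = xs

toParts : (ℕ → Bool) → ℕ → List ℕ
toParts f zero    = []
toParts f (suc n) = addPart (f n) (gapsBelow f n) (toParts f n)

module _ (f : ℕ → Bool) where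

  toParts-≤ : ∀ n → All (_≤ gapsBelow f n) (toParts f n)
  toParts-≤ zero = []
  toParts-≤ (suc n) = add (f n) (gapsBelow f n) refl (All.map (λ p → ≤-trans p (m≤m+n _ _)) (toParts-≤ n))
    where
    add : ∀ b g {xs} → g ≡ gapsBelow f n → All (_≤ gapsBelow f (suc n)) xs → All (_≤ gapsBelow f (suc n)) (addPart b g xs)
    add true (suc g) eq a = subst (_≤ gapsBelow f (suc n)) (sym eq) (m≤m+n _ _) ∷ a
    add true zero eq a = a
    add false _ eq a = a

  toParts-sorted : ∀ n → AllPairs _≥_ (toParts f n)
  toParts-sorted zero = []
  toParts-sorted (suc n) = add (f n) (gapsBelow f n) (toParts-≤ n) (toParts-sorted n)
    where
    add : ∀ b g {xs} → All (_≤ g) xs → AllPairs _≥_ xs → AllPairs _≥_ (addPart b g xs)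
    add true (suc g) a s = a ∷ s
    add true zero a s = s
    add false _ a s = s

  toParts-positive : ∀ n → All (0 <_) (toParts f n)
  toParts-positive zero = []
  toParts-positive (suc n) = add (f n) (gapsBelow f n) (toParts-positive n)
    where
    add : ∀ b g {xs} → All (0 <_) xs → All (0 <_) (addPart b g xs)
    add true (suc g) a = s≤s z≤n ∷ a
    add true zero a = a
    add false _ a = a

  toParts-length : ∀ n → length (toParts f n) ≤ beadsBelow f n
  toParts-length zero = z≤n
  toParts-length (suc n) = ≤-trans (add (f n) (gapsBelow f n) _) (≤-trans (≤-reflexive (+-comm (bead (f n)) _)) (+-monoˡ-≤ _ (toParts-length n)))
    where
    add : ∀ b g xs → length (addPart b g xs) ≤ bead b + length xs
    add true (suc g) xs = ≤-refl
    add true zero xs = n≤1+n _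
    add false _ xs = ≤-refl

  toParts-empty : ∀ n → gapsBelow f n ≡ 0 → toParts f n ≡ []
  toParts-empty n eq = none (toParts-≤ n) (toParts-positive n)
    where
    none : ∀ {xs} → All (_≤ gapsBelow f n) xs → All (0 <_) xs → xs ≡ []
    none [] [] = refl
    none (x≤ ∷ _) (0<x ∷ _) = ⊥-elim (<⇒≱ 0<x (≤-trans x≤ (≤-reflexive eq)))

  config-toParts : ∀ n {i} → i < n → config (toParts f n) (beadsBelow f n) i ≡ f i
  config-toParts-≥ : ∀ n {i} → n ≤ i → config (toParts f n) (beadsBelow f n) i ≡ false

  config-toParts-≥ n {i} n≤i = config-bound (toParts f n) (beadsBelow f n) (toParts-≤ n) (toParts-length n)
    (≤-trans (≤-reflexive (trans (+-comm (gapsBelow f n) _) (beads+gaps f n))) n≤i)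

  config-toParts (suc n) {i} i<1+n with f n in eqf
  ... | false rewrite +-identityʳ (beadsBelow f n) with m<1+n⇒m<n∨m≡n i<1+n
  ...   | inj₁ i<n = config-toParts n i<n
  ...   | inj₂ refl = trans (config-toParts-≥ n ≤-refl) (sym eqf)
  config-toParts (suc n) {i} i<1+n | true rewrite +-comm (beadsBelow f n) 1 with gapsBelow f n in eqg
  ... | zero rewrite toParts-empty n eqg = trans (<ᵇ-true (≤-trans i<1+n (s≤s (≤-reflexive n≡)))) (sym fi)
    where
    n≡ : n ≡ beadsBelow f n
    n≡ = trans (sym (beads+gaps f n)) (trans (cong (beadsBelow f n +_) eqg) (+-identityʳ _))
    gap0 : ∀ {b} → gap b ≡ 0 → b ≡ true
    gap0 {true} _ = refl
    fi : f i ≡ true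
    fi with m<1+n⇒m<n∨m≡n i<1+n
    ... | inj₁ i<n = gap0 (sumTo≡0 n eqg i<n)
    ... | inj₂ refl = eqf
  ... | suc g = go (m<1+n⇒m<n∨m≡n i<1+n)
    where
    n≡ : suc g + beadsBelow f n ≡ n
    n≡ = trans (cong (_+ beadsBelow f n) (sym eqg)) (trans (+-comm (gapsBelow f n) _) (beads+gaps f n))
    go : i < n ⊎ i ≡ n → config (suc g ∷ toParts f n) (suc (beadsBelow f n)) i ≡ f i
    go (inj₁ i<n) = trans (config-other (suc g) (toParts f n) (beadsBelow f n) (λ i≡ → <-irrefl (trans i≡ n≡) i<n)) (config-toParts n i<n)
    go (inj₂ refl) = trans (trans (cong (config (suc g ∷ toParts f n) (suc (beadsBelow f n))) (sym n≡)) (config-top (suc g) (toParts f n) _)) (sym eqf)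

sorted : ∀ μ → AllPairs _≥_ (parts μ)
sorted μ = Linked⇒AllPairs (λ p q → ≤-trans q p) (decreasing μ)

≤sum : ∀ xs → All (_≤ sum xs) xs
≤sum [] = []
≤sum (x ∷ xs) = m≤m+n x _ ∷ All.map (λ p → ≤-trans p (m≤n+m _ x)) (≤sum xs)

length≤sum : ∀ {xs} → All (0 <_) xs → length xs ≤ sum xs
length≤sum [] = z≤n
length≤sum (p ∷ ps) = +-mono-≤ p (length≤sum ps)

numParts≤size : ∀ μ → numParts μ ≤ size μ
numParts≤size μ = length≤sum (positive μ)

partition-≡ : ∀ {μ ν} → parts μ ≡ parts ν → μ ≡ ν
partition-≡ {mkPartition xs d p} {mkPartition .xs d′ p′} refl =
  cong₂ (mkPartition xs) (Linked.irrelevant ≤-irrelevant d d′) (All.irrelevant ≤-irrelevant p p′)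

nth-positive : ∀ xs j → 1 ≤ nth xs j → j ≤ length xs
nth-positive [] zero p = z≤n
nth-positive [] (suc j) ()
nth-positive (x ∷ xs) zero p = z≤n
nth-positive (x ∷ xs) (suc zero) p = s≤s z≤n
nth-positive (x ∷ xs) (suc (suc j)) p = s≤s (nth-positive xs (suc j) p)

nth-≤ : ∀ {x} xs → All (_≤ x) xs → ∀ j → nth xs j ≤ x
nth-≤ xs a zero = z≤n
nth-≤ [] a (suc j) = z≤n
nth-≤ (y ∷ ys) (p ∷ a) (suc zero) = p
nth-≤ (y ∷ ys) (p ∷ a) (suc (suc j)) = nth-≤ ys a (suc j)

nth-conj : ∀ {xs} → AllPairs _≥_ xs → ∀ {c} → 1 ≤ c → ∀ j → c ≤ nth xs j → j ≤ length (filter (c ≤?_) xs)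
nth-conj _ 1≤c zero p = z≤n
nth-conj [] 1≤c (suc j) p = ⊥-elim (<⇒≱ 1≤c p)
nth-conj {x ∷ xs} _ {c} 1≤c (suc zero) p rewrite filter-accept (c ≤?_) {x} {xs} p = s≤s z≤n
nth-conj {x ∷ xs} (xs≤x ∷ s) {c} 1≤c (suc (suc j)) p
  rewrite filter-accept (c ≤?_) {x} {xs} (≤-trans p (nth-≤ xs xs≤x (suc j))) = s≤s (nth-conj s 1≤c (suc j) p)

count-conj : ∀ v xs → length (filter (v ≟_) xs) + length (filter (suc v ≤?_) xs) ≡ length (filter (v ≤?_) xs)
count-conj v [] = refl
count-conj v (x ∷ xs) with <-cmp v x
... | tri< v<x v≢x _ rewrite filter-reject (v ≟_) {x} {xs} v≢x | filter-accept (suc v ≤?_) {x} {xs} v<x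
        | filter-accept (v ≤?_) {x} {xs} (<⇒≤ v<x) = trans (+-suc _ _) (cong suc (count-conj v xs))
... | tri≈ v≮x refl _ rewrite filter-accept (v ≟_) {v} {xs} refl | filter-reject (suc v ≤?_) {v} {xs} v≮x
        | filter-accept (v ≤?_) {v} {xs} ≤-refl = cong suc (count-conj v xs)
... | tri> v≮x v≢x x<v rewrite filter-reject (v ≟_) {x} {xs} v≢x | filter-reject (suc v ≤?_) {x} {xs} v≮x
        | filter-reject (v ≤?_) {x} {xs} (<⇒≱ x<v) = count-conj v xs

remainder-∣ : ∀ m n d .⦃ _ : NonZero d ⦄ → (m + n) % d ≡ m % d → d ∣ n
remainder-∣ m n d eq = ∣m+n∣m⇒∣n (divides ((m + n) / d) (+-cancelˡ-≡ (m % d) _ _ (begin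
    m % d + (m / d * d + n)       ≡⟨ +-assoc (m % d) _ n ⟨
    m % d + m / d * d + n         ≡⟨ cong (_+ n) (m≡m%n+[m/n]*n m d) ⟨
    m + n                         ≡⟨ m≡m%n+[m/n]*n (m + n) d ⟩
    (m + n) % d + (m + n) / d * d ≡⟨ cong (_+ (m + n) / d * d) eq ⟩
    m % d + (m + n) / d * d       ∎)))
  (n∣m*n (m / d))
  where open ≡-Reasoning

module Translation (e′ : ℕ) (μ : Partition) (M : ℕ) (len : numParts μ ≤ M) where
  open Abacus e′

  f : ℕ → Bool
  f = config (parts μ) M

  private
    g : ℕ → ℕ
    g = gapsBelow f

  gap-exists : ∀ c → ∃ λ a → f a ≡ false × g a ≡ c
  gap-exists c with sumTo-hits n (λ i → gap (f i)) (λ i → gap≤1 (f i)) c c<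
    where
    -- This lies beyond the last bead, so exactly `size μ + suc c` gaps lie below it, which is more
    -- than `c`.
    n = size μ + M + suc c
    c< : c < g n
    c< = ≤-trans (m≤n+m (suc c) (size μ)) (≤-reflexive (sym (+-cancelˡ-≡ M _ _
      (trans (gapsBelow-config (parts μ) M (≤sum (parts μ)) (sorted μ) len (m≤m+n _ (suc c)))
        (lemma (size μ) M (suc c))))))
      where
      lemma : ∀ s m c → s + m + c ≡ m + (s + c)
      lemma = solve-∀
  ... | a , _ , eq , h = a , gap≡1 h , eq

  conj : ∀ a → f a ≡ false → conjugatePart μ (suc (g a)) + a ≡ M + g a
  conj = conj-gap (parts μ) M (sorted μ) len

  bead-as-row : ∀ {b} → f b ≡ true → ∃ λ j → 1 ≤ j × j ≤ M × part μ j + M ≡ b + j × g b ≡ part μ j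
  bead-as-row {b} fb with bead-row (parts μ) M len b fb
  ... | j , 1≤j , j≤M , eq with row-bead (parts μ) M (sorted μ) len j 1≤j j≤M
  ...   | n , eq′ , _ , gn = j , 1≤j , j≤M , eq ,
          trans (cong g (+-cancelʳ-≡ j _ _ (trans (sym eq) eq′))) gn

  g-mono : ∀ {m n} → m ≤ n → g m ≤ g n
  g-mono = sumTo-≤-arg _

  after-gap : ∀ {a} → f a ≡ false → g (suc a) ≡ suc (g a)
  after-gap {a} fa = trans (cong (λ b → g a + gap b) fa) (+-comm (g a) 1)

  after-bead : ∀ {a} → f a ≡ true → g (suc a) ≡ g a
  after-bead {a} fa = trans (cong (λ b → g a + gap b) fa) (+-identityʳ (g a))

  -- The hook of the node in row j whose column corresponds to the gap a.
  hook-length : ∀ {a b j} → f a ≡ false → part μ j + M ≡ b + j → suc (g a) ≤ part μ j →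
    a + hook μ j (suc (g a)) ≡ b
  hook-length {a} {b} {j} fa eq c≤ = solved (part μ j ∸ suc (g a)) (conjugatePart μ (suc (g a)) ∸ j) refl
    (m+[n∸m]≡n c≤) (m+[n∸m]≡n (nth-conj (sorted μ) (s≤s z≤n) j c≤))
    where
    solved : ∀ x y → part μ j ∸ suc (g a) + (conjugatePart μ (suc (g a)) ∸ j) + 1 ≡ x + y + 1 →
      suc (g a) + x ≡ part μ j → j + y ≡ conjugatePart μ (suc (g a)) → a + (x + y + 1) ≡ b
    solved x y _ p q = +-cancelʳ-≡ j _ _ (begin
      a + (x + y + 1) + j                     ≡⟨ arrange a x y j ⟩
      suc x + (j + y + a)                     ≡⟨ cong (λ z → suc x + (z + a)) q ⟩
      suc x + (conjugatePart μ (suc (g a)) + a) ≡⟨ cong (suc x +_) (conj a fa) ⟩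
      suc x + (M + g a)                       ≡⟨ arrange′ x M (g a) ⟩
      suc (g a) + x + M                       ≡⟨ cong (_+ M) p ⟩
      part μ j + M                            ≡⟨ eq ⟩
      b + j                                   ∎)
      where
      open ≡-Reasoning
      arrange : ∀ a x y j → a + (x + y + 1) + j ≡ suc x + (j + y + a)
      arrange = solve-∀
      arrange′ : ∀ x m h → suc x + (m + h) ≡ suc h + x + m
      arrange′ = solve-∀

  g-window : ∀ r j → g (suc (r + suc j * e)) ≡ g (suc (r + j * e)) + window f (r + j * e)
  g-window r j = trans (cong (λ z → g (suc z)) (sym (next-row r j))) (gapsBelow-window f (r + j * e))

  module _ {d : ℕ} (1<d : 1 < d) where

    instance
      nonZero-d : NonZero d
      nonZero-d = >-nonZero (<-trans (s≤s z≤n) 1<d)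

    -- The gap and the bead determine a node whose hook length is their distance, a multiple of `e`,
    -- and whose arm length is the number of gaps strictly between them.
    balanced-pair : Balanced d e μ → ∀ a k → f a ≡ false → f (a + suc k * e) ≡ true →
      g (suc (a + suc k * e)) % d ≡ g (suc a) % d
    balanced-pair bal a k fa fb with bead-as-row fb
    ... | j , 1≤j , j≤M , eq , gb = trans (cong (_% d) split) (%-remove-+ʳ _ d∣arm)
      where
      b = a + suc k * e
      c≤ : suc (g a) ≤ part μ j
      c≤ = subst₂ _≤_ (after-gap fa) gb (g-mono (m<m+n a (s≤s z≤n)))
      d∣arm : d ∣ arm μ j (suc (g a))
      d∣arm = bal j (suc (g a)) ((1≤j , nth-positive (parts μ) j (≤-trans (s≤s z≤n) c≤)) , s≤s z≤n , c≤)
        (divides (suc k) (+-cancelˡ-≡ a _ _ (hook-length fa eq c≤)))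
      split : g (suc b) ≡ g (suc a) + arm μ j (suc (g a))
      split = trans (after-bead fb) (trans gb (trans (sym (m+[n∸m]≡n c≤)) (cong (_+ arm μ j (suc (g a))) (sym (after-gap fa)))))

    balanced⇒ : Balanced d e μ → BalancedConfig d f
    balanced⇒ bal {r} {i} {j} {l} r<e i≤j j<l fi fl = remainder-∣ (X j) _ d
      (trans (cong (_% d) (sym (g-window r j))) (trans (level (m≤n⇒m≤1+n i≤j) j<l) (sym (level i≤j (<⇒≤ j<l)))))
      where
      X : ℕ → ℕ
      X m = g (suc (r + m * e))
      pr : ∀ {m n} → m < n → f (r + m * e) ≡ false → f (r + n * e) ≡ true → X n % d ≡ X m % d
      pr {m} {n} m<n fm fn with m<n⇒n≡m+1+k m<n
        where
        m<n⇒n≡m+1+k : ∀ {m n} → m < n → ∃ λ k → n ≡ suc k + m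
        m<n⇒n≡m+1+k {m} {n} m<n = n ∸ suc m , trans (sym (m∸n+n≡m m<n)) (+-suc _ m)
      ... | k , refl = subst (λ z → g (suc z) % d ≡ X m % d) (sym at)
              (balanced-pair bal (r + m * e) k fm (subst (λ z → f z ≡ true) at fn))
        where
        at : r + (suc k + m) * e ≡ r + m * e + suc k * e
        at = trans (cong (r +_) (trans (*-distribʳ-+ e (suc k) m) (+-comm (suc k * e) (m * e)))) (sym (+-assoc r _ _))
      -- A gap in row `m` is compared with the bead in row `l`; a bead in row `m` is compared with
      -- the gap in row `i`, and this gap with the bead in row `l`. Single windows are differences
      -- of consecutive values of `X`, so all of them are divisible by `d`.
      level : ∀ {m} → i ≤ m → m ≤ l → X m % d ≡ X l % d
      level {m} i≤m m≤l with true⊎false (f (r + m * e)) | m≤n⇒m<n∨m≡n i≤m | m≤n⇒m<n∨m≡n m≤l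
      ... | inj₂ fm | _ | inj₁ m<l = sym (pr m<l fm fl)
      ... | inj₂ fm | _ | inj₂ refl = refl
      ... | inj₁ fm | inj₁ i<m | _ = trans (pr i<m fi fm) (sym (pr (≤-<-trans i≤j j<l) fi fl))
      ... | inj₁ fm | inj₂ refl | _ = true∧false fm fi

    ⇒balanced : BalancedConfig d f → Balanced d e μ
    ⇒balanced bal j (suc c) ((1≤j , j≤n) , _ , c<) (divides q hk)
      with gap-exists c | row-bead (parts μ) M (sorted μ) len j 1≤j (≤-trans j≤n len)
    ... | a , fa , refl | b , eq , fb , gb = subst (d ∣_) arm-eq (proj₂ (proj₂ (climb q ≤-refl)))
      where
      r = a % e
      i = a / e
      at : ∀ m → r + (m + i) * e ≡ a + m * e
      at m = trans (cong (r +_) (trans (*-distribʳ-+ e m i) (+-comm (m * e) (i * e))))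
        (trans (sym (+-assoc r _ _)) (cong (_+ m * e) (sym (index a))))
      b≡ : b ≡ a + q * e
      b≡ = trans (sym (hook-length fa eq c<)) (cong (a +_) hk)
      climb : ∀ m → m ≤ q → ∃ λ t → g (suc (r + (m + i) * e)) ≡ g (suc a) + t × d ∣ t
      climb zero _ = 0 , trans (cong (λ z → g (suc z)) (sym (index a))) (sym (+-identityʳ _)) , d ∣0
      climb (suc m) m<q with climb m (<⇒≤ m<q)
      ... | t , eqt , d∣t = t + w , trans (g-window r (m + i)) (trans (cong (_+ w) eqt) (+-assoc (g (suc a)) t w)) ,
        ∣m∣n⇒∣m+n d∣t (bal (m%n<n a e) (m≤n+m i m) (+-monoˡ-< i m<q)
          (trans (cong f (sym (index a))) fa) (trans (cong f (trans (at q) (sym b≡))) fb))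
        where w = window f (r + (m + i) * e)
      t = proj₁ (climb q ≤-refl)
      arm-eq : t ≡ part μ j ∸ suc (g a)
      arm-eq = sym (trans (cong₂ _∸_ (trans (sym gb) (trans (sym (after-bead fb)) (trans (cong (λ z → g (suc z)) (trans b≡ (sym (at q))))
        (proj₁ (proj₂ (climb q ≤-refl)))))) (sym (after-gap fa))) (m+n∸m≡n (g (suc a)) t))

  -- The parts equal to `suc (g a)` are the beads between the consecutive gaps `a` and `a₂`. Their
  -- number is the difference of two neighbouring column lengths, both known from `conj`.
  count-between : ∀ {a a₂} → f a ≡ false → f a₂ ≡ false → g a₂ ≡ suc (g a) →
    length (filter (suc (g a) ≟_) (parts μ)) + suc a ≡ a₂
  count-between {a} {a₂} fa fa₂ eq = +-cancelˡ-≡ k₂ _ _ (begin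
    k₂ + (c + suc a)    ≡⟨ arrange k₂ c a ⟩
    suc (c + k₂ + a)    ≡⟨ cong (λ z → suc (z + a)) (count-conj (suc (g a)) (parts μ)) ⟩
    suc (k₁ + a)        ≡⟨ cong suc (conj a fa) ⟩
    suc (M + g a)       ≡⟨ +-suc M (g a) ⟨
    M + suc (g a)       ≡⟨ subst (λ z → conjugatePart μ (suc z) + a₂ ≡ M + z) eq (conj a₂ fa₂) ⟨
    k₂ + a₂             ∎)
    where
    open ≡-Reasoning
    c = length (filter (suc (g a) ≟_) (parts μ))
    k₁ = conjugatePart μ (suc (g a))
    k₂ = conjugatePart μ (suc (suc (g a)))
    arrange : ∀ k c a → k + (c + suc a) ≡ suc (c + k + a)
    arrange = solve-∀

  -- Let `a` be the last gap up to `x` and `a₂` the next one. An empty window pushes `a₂` beyond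
  -- `x + e`, so at least `e` beads lie between them, and these are equal parts.
  regular⇒ : Regular e μ → RegularConfig f
  regular⇒ reg x 1≤ = n≢0⇒n>0 λ w≡0 → contradiction′ w≡0
    where
    contradiction′ : window f x ≢ 0
    contradiction′ w≡0 with g (suc x) in eqv
    ... | suc v with gap-exists v | gap-exists (suc v)
    ...   | a , fa , refl | a₂ , fa₂ , ga₂ = <⇒≱ (reg (suc (g a)) member) e≤c
      where
      c = length (filter (suc (g a) ≟_) (parts μ))
      ca : c + suc a ≡ a₂
      ca = count-between fa fa₂ ga₂
      a≤x : a ≤ x
      a≤x = m<1+n⇒m≤n (≰⇒> λ x<a → <⇒≱ ≤-refl (subst (_≤ g a) eqv (g-mono x<a)))
      a₂≥ : suc x + e ≤ a₂
      a₂≥ = ≮⇒≥ λ a₂< → <⇒≱ ≤-refl (subst₂ _≤_ (trans (after-gap fa₂) (cong suc ga₂))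
        (trans (gapsBelow-window f x) (trans (cong₂ _+_ eqv w≡0) (+-identityʳ _))) (g-mono a₂<))
      e≤c : e ≤ c
      e≤c = +-cancelˡ-≤ (suc x) _ _ (≤-trans a₂≥ (≤-trans (≤-reflexive (trans (sym ca) (+-comm c (suc a)))) (+-monoˡ-≤ c (s≤s a≤x))))
      member : suc (g a) ∈ parts μ
      member = pick (filter (suc (g a) ≟_) (parts μ)) refl (≤-trans (s≤s z≤n) e≤c)
        where
        pick : ∀ ys → ys ≡ filter (suc (g a) ≟_) (parts μ) → 1 ≤ length ys → suc (g a) ∈ parts μ
        pick (y ∷ ys) eq _ with ∈-filter⁻ (suc (g a) ≟_) {xs = parts μ} (subst (y ∈_) eq (here refl))
        ... | y∈ , refl = y∈
    contradiction′ w≡0 | zero = n≮0 1≤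

  ⇒regular : RegularConfig f → Regular e μ
  ⇒regular reg zero v∈ = ⊥-elim (n≮0 (All.lookup (positive μ) v∈))
  ⇒regular reg (suc v) v∈ with gap-exists v | gap-exists (suc v)
  ... | a , fa , refl | a₂ , fa₂ , ga₂ = ≰⇒> λ e≤c → <⇒≱
    (≤-trans (≤-reflexive (+-comm 1 _)) (+-monoʳ-≤ (suc (g a)) (reg a (subst (1 ≤_) (sym (after-gap fa)) (s≤s z≤n)))))
    (subst₂ _≤_ (trans (gapsBelow-window f a) (cong (_+ window f a) (after-gap fa))) ga₂
      (g-mono (≤-trans (≤-trans (≤-reflexive (+-comm (suc a) e)) (+-monoˡ-≤ (suc a) e≤c))
        (≤-reflexive (count-between fa fa₂ ga₂)))))

-- β-sets, steps and cores

sumTo-update : ∀ n {h k : ℕ → ℕ} {p} → p < n → (∀ i → i ≢ p → h i ≡ k i) → sumTo n h + k p ≡ sumTo n k + h p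
sumTo-update (suc n) {h} {k} {p} p<1+n eq with m<1+n⇒m<n∨m≡n p<1+n
... | inj₂ refl = trans (xy∙z≈xz∙y (sumTo n h) (h n) (k n))
      (cong (λ z → z + k n + h n) (sumTo-cong n λ i i<n → eq i (<⇒≢ i<n)))
... | inj₁ p<n = begin
    sumTo n h + h n + k p   ≡⟨ xy∙z≈xz∙y (sumTo n h) (h n) (k p) ⟩
    sumTo n h + k p + h n   ≡⟨ cong₂ _+_ (sumTo-update n p<n eq) (eq n (λ n≡p → <⇒≢ p<n (sym n≡p))) ⟩
    sumTo n k + h p + k n   ≡⟨ xy∙z≈xz∙y (sumTo n k) (h p) (k n) ⟩
    sumTo n k + k n + h p   ∎
  where
  open ≡-Reasoning

sumTo-update₂ : ∀ n {h k : ℕ → ℕ} {p q} → p < n → q < n → p ≢ q → (∀ i → i ≢ p → i ≢ q → h i ≡ k i) →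
  sumTo n h + (k p + k q) ≡ sumTo n k + (h p + h q)
sumTo-update₂ n {h} {k} {p} {q} p<n q<n p≢q eq = begin
    sumTo n h + (k p + k q)   ≡⟨ +-assoc (sumTo n h) _ _ ⟨
    sumTo n h + k p + k q     ≡⟨ cong (_+ k q) (trans (cong (λ z → sumTo n h + z) (sym mp)) (sumTo-update n p<n λ i i≢p → sym (m≢ i i≢p))) ⟩
    sumTo n m + h p + k q     ≡⟨ xy∙z≈xz∙y (sumTo n m) (h p) (k q) ⟩
    sumTo n m + k q + h p     ≡⟨ cong (_+ h p) (sumTo-update n q<n agree) ⟩
    sumTo n k + m q + h p     ≡⟨ cong (λ z → sumTo n k + z + h p) (m≢ q (λ q≡p → p≢q (sym q≡p))) ⟩
    sumTo n k + h q + h p     ≡⟨ xy∙z≈x∙zy (sumTo n k) (h q) (h p) ⟩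
    sumTo n k + (h p + h q)   ∎
  where
  open ≡-Reasoning
  mix : ∀ {P : Set} → Dec P → ℕ → ℕ
  mix (yes _) i = k i
  mix (no _)  i = h i
  m : ℕ → ℕ
  m i = mix (i ≟ p) i
  m≢ : ∀ i → i ≢ p → m i ≡ h i
  m≢ i i≢p with i ≟ p
  ... | yes i≡p = ⊥-elim (i≢p i≡p)
  ... | no _ = refl
  mp : m p ≡ k p
  mp with p ≟ p
  ... | yes _ = refl
  ... | no n = ⊥-elim (n refl)
  agree : ∀ i → i ≢ q → m i ≡ k i
  agree i i≢q with i ≟ p
  ... | yes _ = refl
  ... | no i≢p = eq i i≢p i≢q

difference-≡ : ∀ {a b c d} → pos a ℤ.- pos b ≡ pos c ℤ.- pos d → a + d ≡ c + b
difference-≡ {a} {b} {c} {d} eq = ℤ.+-injective (begin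
  pos a ℤ.+ pos d                         ≡⟨ expand (pos a) (pos b) (pos d) ⟩
  (pos a ℤ.- pos b) ℤ.+ (pos b ℤ.+ pos d)     ≡⟨ cong (ℤ._+ (pos b ℤ.+ pos d)) eq ⟩
  (pos c ℤ.- pos d) ℤ.+ (pos b ℤ.+ pos d)     ≡⟨ collapse (pos c) (pos d) (pos b) ⟩
  pos c ℤ.+ pos b                         ∎)
  where
  open ≡-Reasoning
  expand : ∀ a b d → a ℤ.+ d ≡ (a ℤ.- b) ℤ.+ (b ℤ.+ d)
  expand = ℤSolver.solve-∀
  collapse : ∀ c d b → (c ℤ.- d) ℤ.+ (b ℤ.+ d) ≡ c ℤ.+ b
  collapse = ℤSolver.solve-∀

≡-difference : ∀ {a b c d} → a + d ≡ c + b → pos a ℤ.- pos b ≡ pos c ℤ.- pos d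
≡-difference {a} {b} {c} {d} eq = begin
  pos a ℤ.- pos b                         ≡⟨ expand (pos a) (pos b) (pos d) ⟩
  (pos a ℤ.+ pos d) ℤ.- (pos b ℤ.+ pos d)     ≡⟨ cong (λ z → pos z ℤ.- (pos b ℤ.+ pos d)) eq ⟩
  (pos c ℤ.+ pos b) ℤ.- (pos b ℤ.+ pos d)     ≡⟨ collapse (pos c) (pos d) (pos b) ⟩
  pos c ℤ.- pos d                         ∎
  where
  open ≡-Reasoning
  expand : ∀ a b d → a ℤ.- b ≡ (a ℤ.+ d) ℤ.- (b ℤ.+ d)
  expand = ℤSolver.solve-∀
  collapse : ∀ c d b → (c ℤ.+ b) ℤ.- (b ℤ.+ d) ≡ c ℤ.- d
  collapse = ℤSolver.solve-∀

-- Integers below -M lie in the β-set of every partition with at most `M` parts. Steps can therefore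
-- be followed on the positions of `config` alone.
position : ∀ M b → (∃ λ n → b ≡ pos n ℤ.- pos M) ⊎ (∃ λ k → b ≡ pos 0 ℤ.- pos (M + suc k))
position M (pos x) = inj₁ (x + M , trans (cong pos (sym (+-identityʳ x)))
  (≡-difference {x} {0} {x + M} {M} (sym (+-identityʳ (x + M)))))
position M -[1+ x ] with suc x ≤? M
... | yes x<M = inj₁ (M ∸ suc x , ≡-difference {0} {suc x} {M ∸ suc x} {M} (sym (m∸n+n≡m x<M)))
... | no x≮M = inj₂ (x ∸ M , cong (λ z → pos 0 ℤ.- pos z) (sym (trans (+-suc M (x ∸ M)) (cong suc (m+[n∸m]≡n (m<1+n⇒m≤n (≰⇒> x≮M)))))))

part-zero : ∀ μ {j} → numParts μ < j → part μ j ≡ 0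
part-zero μ {j} l<j = n<1⇒n≡0 (≰⇒> λ p → <⇒≱ l<j (nth-positive (parts μ) j p))

β-below : ∀ μ {j} → numParts μ < j → β-set μ (pos 0 ℤ.- pos j)
β-below μ {j} l<j = j , ≤-trans (s≤s z≤n) l<j , cong (λ z → pos z ℤ.- pos j) (sym (part-zero μ l<j))

module _ (μ : Partition) {M : ℕ} (len : numParts μ ≤ M) where

  bead⇒β : ∀ {n} → config (parts μ) M n ≡ true → β-set μ (pos n ℤ.- pos M)
  bead⇒β {n} eq with bead-row (parts μ) M len n eq
  ... | j , 1≤j , _ , p = j , 1≤j , ≡-difference {n} {M} {part μ j} {j} (sym p)

  β⇒bead : ∀ {n} → β-set μ (pos n ℤ.- pos M) → config (parts μ) M n ≡ true
  β⇒bead {n} (j , 1≤j , eq) with difference-≡ {n} {M} {part μ j} {j} eq | j ≤? M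
  ... | p | no j≰M = ⊥-elim (j≰M (≤-trans (m≤n+m j n) (≤-reflexive (trans p (cong (_+ M) (part-zero μ (≤-<-trans len (≰⇒> j≰M))))))))
  ... | p | yes j≤M with row-bead (parts μ) M (sorted μ) len j 1≤j j≤M
  ...   | n′ , p′ , bd , _ = subst (λ z → config (parts μ) M z ≡ true) (+-cancelʳ-≡ j _ _ (trans (sym p′) (sym p))) bd

  β-under : ∀ k → β-set μ (pos 0 ℤ.- pos (M + suc k))
  β-under k = β-below μ (≤-<-trans len (m<m+n M (s≤s z≤n)))

toPartition : (ℕ → Bool) → ℕ → Partition
toPartition f n = mkPartition (toParts f n) (AllPairs⇒Linked (toParts-sorted f n)) (toParts-positive f n)

module _ (f : ℕ → Bool) (n : ℕ) (vanish : ∀ {i} → n ≤ i → f i ≡ false) where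

  config-toPartition : ∀ i → config (toParts f n) (beadsBelow f n) i ≡ f i
  config-toPartition i with i <? n
  ... | yes i<n = config-toParts f n i<n
  ... | no i≮n = trans (config-toParts-≥ f n (≮⇒≥ i≮n)) (sym (vanish (≮⇒≥ i≮n)))

  weighted-toPartition : sumTo n (λ i → i * bead (f i)) ≡ size (toPartition f n) + tri (beadsBelow f n)
  weighted-toPartition = trans (sumTo-cong n λ i _ → cong (λ b → i * bead b) (sym (config-toPartition i)))
    (weighted-config (toParts f n) (beadsBelow f n) (toParts-≤ f n) (toParts-sorted f n) (toParts-length f n)
      (≤-reflexive (trans (+-comm (gapsBelow f n) _) (beads+gaps f n))))

module _ (μ : Partition) {M : ℕ} (len : numParts μ ≤ M) where

  config-vanish : ∀ {n i} → size μ + M ≤ n → n ≤ i → config (parts μ) M i ≡ false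
  config-vanish p n≤i = config-bound (parts μ) M (≤sum (parts μ)) len (≤-trans p n≤i)

  beadsBelow-partition : ∀ {n} → size μ + M ≤ n → beadsBelow (config (parts μ) M) n ≡ M
  beadsBelow-partition = beadsBelow-config (parts μ) M (≤sum (parts μ)) (sorted μ) len

  weighted-partition : ∀ {n} → size μ + M ≤ n → sumTo n (λ i → i * bead (config (parts μ) M i)) ≡ size μ + tri M
  weighted-partition = weighted-config (parts μ) M (≤sum (parts μ)) (sorted μ) len

partition-injective : ∀ {μ ν M} → numParts μ ≤ M → numParts ν ≤ M →
  (∀ n → config (parts μ) M n ≡ config (parts ν) M n) → μ ≡ ν
partition-injective {μ} {ν} {M} l l′ eq = partition-≡
  (config-injective (parts μ) (parts ν) M (sorted μ) (sorted ν) (positive μ) (positive ν) l l′ eq)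

module Cores (e′ : ℕ) where
  open Abacus e′

  record Moved (f f′ : ℕ → Bool) (x : ℕ) : Set where
    field
      wasGap  : f x ≡ false
      wasBead : f (x + e) ≡ true
      nowBead : f′ x ≡ true
      nowGap  : f′ (x + e) ≡ false
      rest    : ∀ {n} → n ≢ x → n ≢ x + e → f′ n ≡ f n

  SortedConfig : (ℕ → Bool) → Set
  SortedConfig f = ∀ x → f x ≡ false → f (x + e) ≡ true → ⊥

  x≢x+e : ∀ x → x ≢ x + e
  x≢x+e x = <⇒≢ (m<m+n x (s≤s z≤n))

  minus-e : ∀ x M → (pos (x + e) ℤ.- pos M) ℤ.- pos e ≡ pos x ℤ.- pos M
  minus-e x M = lemma (pos x) (pos e) (pos M)
    where
    lemma : ∀ x e m → ((x ℤ.+ e) ℤ.- m) ℤ.- e ≡ x ℤ.- m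
    lemma = ℤSolver.solve-∀

  minus-e⁻ : ∀ {b x M} → b ℤ.- pos e ≡ pos x ℤ.- pos M → b ≡ pos (x + e) ℤ.- pos M
  minus-e⁻ {b} {x} {M} eq = trans (lemma b (pos e)) (trans (cong (ℤ._+ pos e) eq) (lemma′ (pos x) (pos e) (pos M)))
    where
    lemma : ∀ b e → b ≡ (b ℤ.- e) ℤ.+ e
    lemma = ℤSolver.solve-∀
    lemma′ : ∀ x e m → (x ℤ.- m) ℤ.+ e ≡ (x ℤ.+ e) ℤ.- m
    lemma′ = ℤSolver.solve-∀

  canMove⇒ : ∀ {μ M b} → numParts μ ≤ M → CanMove e μ b →
    ∃ λ x → config (parts μ) M x ≡ false × config (parts μ) M (x + e) ≡ true × b ≡ pos (x + e) ℤ.- pos M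
  canMove⇒ {μ} {M} {b} len (βb , ¬β) with position M (b ℤ.- pos e)
  ... | inj₂ (k , eq) = ⊥-elim (¬β (subst (β-set μ) (sym eq) (β-under μ len k)))
  ... | inj₁ (x , eq) = x , gapx , β⇒bead μ len (subst (β-set μ) b≡ βb) , b≡
    where
    b≡ = minus-e⁻ {b} {x} {M} eq
    gapx : config (parts μ) M x ≡ false
    gapx with true⊎false (config (parts μ) M x)
    ... | inj₂ p = p
    ... | inj₁ p = ⊥-elim (¬β (subst (β-set μ) (sym eq) (bead⇒β μ len p)))

  ⇒canMove : ∀ {μ M x} → numParts μ ≤ M → config (parts μ) M x ≡ false → config (parts μ) M (x + e) ≡ true →
    CanMove e μ (pos (x + e) ℤ.- pos M)
  ⇒canMove {μ} {M} {x} len p q = bead⇒β μ len q , λ β → true∧false (β⇒bead μ len (subst (β-set μ) (minus-e x M) β)) p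

  step⇒moved : ∀ {μ ν M} → numParts μ ≤ M → Step e μ ν →
    numParts ν ≤ M × ∃ (Moved (config (parts μ) M) (config (parts ν) M))
  step⇒moved {μ} {ν} {M} len (b , can , iff) with canMove⇒ {μ} len can
  ... | x , gx , bx , refl = lenν , x , record
      { wasGap = gx ; wasBead = bx
      ; nowBead = β⇒bead ν lenν (subst (β-set ν) (minus-e x M) (Equivalence.from (iff _) (inj₁ refl)))
      ; nowGap = ≢true λ p → [ (λ eq → x≢x+e x (sym (cancel (trans eq (minus-e x M))))) , (λ q → proj₂ q refl) ]′
          (Equivalence.to (iff _) (bead⇒β ν lenν p))
      ; rest = λ {n} n≢x n≢x+e → same (λ p → [ (λ eq → ⊥-elim (n≢x (cancel (trans eq (minus-e x M))))) , (λ q → β⇒bead μ len (proj₁ q)) ]′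
            (Equivalence.to (iff _) (bead⇒β ν lenν p)))
          (λ p → β⇒bead ν lenν (Equivalence.from (iff _) (inj₂ (bead⇒β μ len p , λ eq → n≢x+e (cancel eq)))))
      }
    where
    cancel : ∀ {m n} → pos m ℤ.- pos M ≡ pos n ℤ.- pos M → m ≡ n
    cancel {m} {n} eq = +-cancelʳ-≡ M _ _ (difference-≡ {m} {M} {n} {M} eq)
    ≢true : ∀ {c} → ¬ c ≡ true → c ≡ false
    ≢true {false} _ = refl
    ≢true {true} n = ⊥-elim (n refl)
    same : ∀ {c c′} → (c ≡ true → c′ ≡ true) → (c′ ≡ true → c ≡ true) → c ≡ c′
    same {true} {c′} p q = sym (p refl)
    same {false} {true} p q = q refl
    same {false} {false} p q = refl
    -- `Step` by itself says nothing about the length of `ν`. If `ν` had L > `M` parts, -L would lie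
    -- in the β-set of `μ` and survive the move; but the L-th part of `ν` is positive, so -L is
    -- skipped in the β-set of `ν`.
    lenν : numParts ν ≤ M
    lenν = ≮⇒≥ λ M<L → noRow M<L (Equivalence.from (iff (pos 0 ℤ.- pos (numParts ν)))
      (inj₂ (β-below μ (≤-<-trans len M<L) , λ eq → low M<L (difference-≡ {0} {numParts ν} {x + e} {M} eq))))
      where
      low : M < numParts ν → 0 + M ≡ x + e + numParts ν → ⊥
      low M<L eq = <⇒≱ M<L (≤-trans (m≤n+m (numParts ν) (x + e)) (≤-reflexive (sym eq)))
      noRow : M < numParts ν → ¬ β-set ν (pos 0 ℤ.- pos (numParts ν))
      noRow M<L (j , 1≤j , eq) with difference-≡ {0} {numParts ν} {part ν j} {j} eq
      ... | j≡ = <⇒≱ 0<p (≤-reflexive p≡0)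
        where
        L≤j : numParts ν ≤ j
        L≤j = ≤-trans (m≤n+m _ (part ν j)) (≤-reflexive (sym j≡))
        j≤L : j ≤ numParts ν
        j≤L = ≮⇒≥ λ L<j → <-irrefl (sym (trans j≡ (cong (_+ numParts ν) (part-zero ν L<j)))) L<j
        p≡0 : part ν j ≡ 0
        p≡0 = m+n≡0⇒m≡0 (part ν j) {0} (trans (+-identityʳ _) (+-cancelʳ-≡ (numParts ν) _ 0 (trans (sym j≡) (≤-antisym j≤L L≤j))))
        0<p : 0 < part ν j
        0<p = nth>0 (parts ν) (positive ν) j 1≤j j≤L
          where
          nth>0 : ∀ xs → All (0 <_) xs → ∀ j → 1 ≤ j → j ≤ length xs → 0 < nth xs j
          nth>0 (x ∷ xs) (p ∷ ps) (suc zero) _ _ = p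
          nth>0 (x ∷ xs) (p ∷ ps) (suc (suc j)) _ (s≤s q) = nth>0 xs ps (suc j) (s≤s z≤n) q

  moved⇒step : ∀ {μ ν M x} → numParts μ ≤ M → numParts ν ≤ M →
    Moved (config (parts μ) M) (config (parts ν) M) x → Step e μ ν
  moved⇒step {μ} {ν} {M} {x} len lenν mv = pos (x + e) ℤ.- pos M , ⇒canMove {μ} len wasGap wasBead , iff
    where
    open Moved mv
    iff : ∀ y → β-set ν y ⇔ (y ≡ (pos (x + e) ℤ.- pos M) ℤ.- pos e ⊎ (β-set μ y × y ≢ pos (x + e) ℤ.- pos M))
    iff y with position M y
    ... | inj₂ (k , refl) = mk⇔ (λ _ → inj₂ (β-under μ len k , λ eq → far (difference-≡ {0} {M + suc k} {x + e} {M} eq))) (λ _ → β-under ν lenν k)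
      where
      far : 0 + M ≡ x + e + (M + suc k) → ⊥
      far eq = <⇒≢ (≤-trans (m<m+n M (s≤s z≤n)) (m≤n+m (M + suc k) (x + e))) eq
    ... | inj₁ (n , refl) = mk⇔ to′ from′
      where
      to′ : β-set ν (pos n ℤ.- pos M) → _
      to′ β with n ≟ x | n ≟ x + e
      ... | yes refl | _ = inj₁ (sym (minus-e x M))
      ... | no _ | yes refl = true∧false (β⇒bead ν lenν β) nowGap
      ... | no n≢x | no n≢ = inj₂ (bead⇒β μ len (trans (sym (rest n≢x n≢)) (β⇒bead ν lenν β)) ,
              λ eq → n≢ (+-cancelʳ-≡ M _ _ (difference-≡ {n} {M} {x + e} {M} eq)))
      from′ : _ → β-set ν (pos n ℤ.- pos M)
      from′ (inj₁ eq) with +-cancelʳ-≡ M _ _ (difference-≡ {n} {M} {x} {M} (trans eq (minus-e x M)))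
      ... | refl = bead⇒β ν lenν nowBead
      from′ (inj₂ (β , ≢b)) with n ≟ x
      ... | yes refl = bead⇒β ν lenν nowBead
      ... | no n≢x = bead⇒β ν lenν (trans (rest n≢x λ { refl → ≢b refl }) (β⇒bead μ len β))

  module _ (K : ℕ) where

    VanishingFrom : (ℕ → Bool) → Set
    VanishingFrom f = ∀ {x} → K * e ≤ x → f x ≡ false

    module _ {f f′ : ℕ → Bool} {x : ℕ} (mv : Moved f f′ x) (van : VanishingFrom f) where
      open Moved mv

      moved-inside : x + e < K * e
      moved-inside = ≰⇒> λ p → true∧false wasBead (van p)

      moved-vanish : VanishingFrom f′
      moved-vanish {n} p = trans (rest (λ { refl → <⇒≱ moved-inside (≤-trans p (m≤m+n x e)) }) (λ { refl → <⇒≱ moved-inside p })) (van p)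

      moved-sum : ∀ (h : ℕ → Bool → ℕ) →
        sumTo (K * e) (λ i → h i (f i)) + (h x true + h (x + e) false) ≡
        sumTo (K * e) (λ i → h i (f′ i)) + (h x false + h (x + e) true)
      moved-sum h = subst₂ (λ u v → sumTo (K * e) (λ i → h i (f i)) + u ≡ sumTo (K * e) (λ i → h i (f′ i)) + v)
        (cong₂ (λ a b → h x a + h (x + e) b) nowBead nowGap) (cong₂ (λ a b → h x a + h (x + e) b) wasGap wasBead)
        (sumTo-update₂ (K * e) (≤-<-trans (m≤m+n x e) moved-inside) moved-inside (x≢x+e x)
          λ i i≢ i≢′ → cong (h i) (sym (rest i≢ i≢′)))

      moved-runner : ∀ r → r < e → runner K r f ≡ runner K r f′
      moved-runner r r<e with r ≟ x % e
      ... | no r≢ = sumTo-cong K λ j _ → cong bead (sym (rest (off (x / e) {j} (index x))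
              (off (suc (x / e)) {j} (next-index x))))
        where
        off : ∀ {y} i {j} → y ≡ x % e + i * e → r + j * e ≢ y
        off {y} i {j} y≡ eq = r≢ (trans (sym (rem-index r j r<e)) (trans (cong (_% e) (trans eq y≡)) (rem-index (x % e) i (m%n<n x e))))
      ... | yes refl = +-cancelʳ-≡ 1 _ _ (subst₂ (λ u v → runner K (x % e) f + u ≡ runner K (x % e) f′ + v)
              (cong₂ (λ a b → bead a + bead b) (trans (cong f′ (sym (index x))) nowBead) (trans (cong f′ (sym next)) nowGap))
              (cong₂ (λ a b → bead a + bead b) (trans (cong f (sym (index x))) wasGap) (trans (cong f (sym next)) wasBead))
              (sumTo-update₂ K {p = x / e} {suc (x / e)} (<-trans (n<1+n _) i<K) i<K (<⇒≢ (n<1+n _))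
                λ i i≢ i≢′ → cong bead (sym (rest (λ eq → i≢ (row eq (index x))) (λ eq → i≢′ (row eq next))))))
        where
        next : x + e ≡ x % e + suc (x / e) * e
        next = next-index x
        row : ∀ {i j y} → x % e + i * e ≡ y → y ≡ x % e + j * e → i ≡ j
        row {i} {j} eq y≡ = trans (sym (quot-index (x % e) i r<e)) (trans (cong (_/ e) (trans eq y≡)) (quot-index (x % e) j r<e))
        i<K : suc (x / e) < K
        i<K = *-cancelʳ-< e _ K (≤-<-trans (≤-trans (m≤n+m _ (x % e)) (≤-reflexive (sym next))) moved-inside)

    sorted-down : ∀ {f} → SortedConfig f → ∀ r {i} j → i ≤ j → f (r + j * e) ≡ true → f (r + i * e) ≡ true
    sorted-down srt r {i} j i≤j p with m≤n⇒m<n∨m≡n i≤j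
    sorted-down srt r {i} j i≤j p | inj₂ refl = p
    sorted-down {f} srt r {i} (suc j) _ p | inj₁ (s≤s i≤j) with true⊎false (f (r + j * e))
    ... | inj₁ q = sorted-down {f} srt r j i≤j q
    ... | inj₂ q = ⊥-elim (srt (r + j * e) q (trans (cong f (next-row r j)) p))

    -- On each runner of a sorted configuration the beads form an initial segment. On the runner of
    -- `x` the segment of `f` reaches `x` and that of `f′` does not, so one properly contains the
    -- other.
    sorted-count-< : ∀ {f f′} → SortedConfig f → SortedConfig f′ → VanishingFrom f →
      ∀ x → f x ≡ true → f′ x ≡ false → runner K (x % e) f′ < runner K (x % e) f
    sorted-count-< {f} {f′} srt srt′ van x p q = sumTo-mono-< K (λ j _ → le j) {x / e} (rowOf-< {x} {K} x<Ke)
      (subst₂ (λ a b → bead a < bead b) (sym (trans (cong f′ (sym (index x))) q)) (sym (trans (cong f (sym (index x))) p)) ≤-refl)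
      where
      x<Ke : x < K * e
      x<Ke = ≰⇒> λ Ke≤x → true∧false p (van Ke≤x)
      le : ∀ j → bead (f′ (x % e + j * e)) ≤ bead (f (x % e + j * e))
      le j with ≤-total j (x / e)
      ... | inj₁ j≤ rewrite sorted-down {f} srt (x % e) (x / e) j≤ (trans (cong f (sym (index x))) p) = bead≤1 (f′ (x % e + j * e))
        where
        bead≤1 : ∀ b → bead b ≤ 1
        bead≤1 true = ≤-refl
        bead≤1 false = z≤n
      ... | inj₂ ≤j with true⊎false (f′ (x % e + j * e))
      ...   | inj₂ z rewrite z = z≤n
      ...   | inj₁ t = true∧false (trans (cong f′ (index x)) (sorted-down {f′} srt′ (x % e) j ≤j t)) q

    sorted-unique : ∀ {f f′} → SortedConfig f → SortedConfig f′ → VanishingFrom f → VanishingFrom f′ →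
      (∀ r → r < e → runner K r f ≡ runner K r f′) → ∀ x → f x ≡ f′ x
    sorted-unique {f} {f′} s s′ v v′ eq x with true⊎false (f x) | true⊎false (f′ x)
    ... | inj₁ p | inj₁ q = trans p (sym q)
    ... | inj₂ p | inj₂ q = trans p (sym q)
    ... | inj₁ p | inj₂ q = ⊥-elim (<⇒≢ (sorted-count-< s s′ v x p q) (sym (eq _ (m%n<n x e))))
    ... | inj₂ p | inj₁ q = ⊥-elim (<⇒≢ (sorted-count-< s′ s v′ x q p) (eq _ (m%n<n x e)))

    hasCore⇒runners : ∀ {μ γ M} → numParts μ ≤ M → VanishingFrom (config (parts μ) M) → HasCore e μ γ →
      ∀ r → r < e → runner K r (config (parts μ) M) ≡ runner K r (config (parts γ) M)
    hasCore⇒runners {μ} {M = M} len van (steps , _) = go {μ} len van steps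
      where
      go : ∀ {μ γ} → numParts μ ≤ M → VanishingFrom (config (parts μ) M) → Star (Step e) μ γ →
        ∀ r → r < e → runner K r (config (parts μ) M) ≡ runner K r (config (parts γ) M)
      go len van ε r r<e = refl
      go {μ} len van (_◅_ {j = ν} s ss) r r<e with step⇒moved {μ} {ν} len s
      ... | len′ , x , mv = trans (moved-runner mv van r r<e) (go {ν} len′ (moved-vanish mv van) ss r r<e)

    isCore⇒sorted : ∀ {γ M} → numParts γ ≤ M → IsCore e γ → SortedConfig (config (parts γ) M)
    isCore⇒sorted {γ} len (_ , ¬can) x p q = ¬can (_ , ⇒canMove {γ} len p q)

    sorted⇒isCore : ∀ {γ M} → numParts γ ≤ M → SortedConfig (config (parts γ) M) → IsCore e γ
    sorted⇒isCore {γ} len srt = ε , λ (b , can) → let x , p , q , _ = canMove⇒ {γ} len can in srt x p q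

    move : (ℕ → Bool) → ℕ → ℕ → Bool
    move f x n = choose (n ≟ x) (n ≟ x + e)
      where
      choose : ∀ {P Q : Set} → Dec P → Dec Q → Bool
      choose (yes _) _ = true
      choose (no _) (yes _) = false
      choose (no _) (no _) = f n

    move-moved : ∀ {f x} → f x ≡ false → f (x + e) ≡ true → Moved f (move f x) x
    move-moved {f} {x} p q = record { wasGap = p ; wasBead = q ; nowBead = nb ; nowGap = ng ; rest = rs }
      where
      nb : move f x x ≡ true
      nb with x ≟ x
      ... | yes _ = refl
      ... | no n = ⊥-elim (n refl)
      ng : move f x (x + e) ≡ false
      ng with x + e ≟ x | x + e ≟ x + e
      ... | yes r | _ = ⊥-elim (x≢x+e x (sym r))
      ... | no _ | yes _ = refl
      ... | no _ | no n = ⊥-elim (n refl)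
      rs : ∀ {n} → n ≢ x → n ≢ x + e → move f x n ≡ f n
      rs {n} a b with n ≟ x | n ≟ x + e
      ... | yes r | _ = ⊥-elim (a r)
      ... | no _ | yes r = ⊥-elim (b r)
      ... | no _ | no _ = refl

    Moved-resp : ∀ {f f′ f″ x} → Moved f f′ x → (∀ n → f″ n ≡ f′ n) → Moved f f″ x
    Moved-resp mv eq = record { wasGap = wasGap ; wasBead = wasBead ; nowBead = trans (eq _) nowBead
      ; nowGap = trans (eq _) nowGap ; rest = λ a b → trans (eq _) (rest a b) }
      where open Moved mv

    module _ {γ : Partition} {M : ℕ} (lenγ : numParts γ ≤ M) (core : IsCore e γ)
             (fitγ : size γ + M ≤ K * e) where

      -- Induction on a bound for the size. A possible move lowers the size by `e` and keeps the
      -- number of beads on every runner; if no move is possible, the configuration is sorted and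
      -- its bead counts identify it with that of `γ`.
      runners⇒hasCore : ∀ n {μ} → size μ ≤ n → numParts μ ≤ M → size μ + M ≤ K * e →
        (∀ r → r < e → runner K r (config (parts μ) M) ≡ runner K r (config (parts γ) M)) → HasCore e μ γ
      runners⇒hasCore n {μ} μ≤n len fit eq
        with anyUpTo? (λ x → (config (parts μ) M x Bool.≟ false) ×-dec (config (parts μ) M (x + e) Bool.≟ true)) (K * e)
      ... | no ¬can = subst (λ μ → HasCore e μ γ) (sym μ≡γ) core
        where
        f = config (parts μ) M
        van : VanishingFrom f
        van = config-vanish μ len fit
        srt : SortedConfig f
        srt x p q = ¬can (x , ≰⇒> (λ Ke≤x → true∧false q (van (≤-trans Ke≤x (m≤m+n x e)))) , p , q)
        μ≡γ : μ ≡ γ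
        μ≡γ = partition-injective {μ} {γ} len lenγ (sorted-unique srt (isCore⇒sorted {γ} lenγ core) van (config-vanish γ lenγ fitγ) eq)
      runners⇒hasCore n {μ} μ≤n len fit eq | yes (x , _ , p , q) = stepped n μ≤n
        where
        f = config (parts μ) M
        van : VanishingFrom f
        van = config-vanish μ len fit
        mv = move-moved {f} {x} p q
        f′ = move f x
        van′ : VanishingFrom f′
        van′ = moved-vanish mv van
        ν = toPartition f′ (K * e)
        total : beadsBelow f′ (K * e) ≡ M
        total = trans (sym (+-cancelʳ-≡ 1 _ _ (moved-sum mv van (λ _ → bead)))) (beadsBelow-partition μ len fit)
        lenν : numParts ν ≤ M
        lenν = ≤-trans (toParts-length f′ (K * e)) (≤-reflexive total)
        config-ν : ∀ i → config (parts ν) M i ≡ f′ i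
        config-ν i = trans (cong (λ z → config (parts ν) z i) (sym total)) (config-toPartition f′ (K * e) van′ i)
        smaller : size ν + e ≡ size μ
        smaller = +-cancelʳ-≡ (tri M + x) _ _ (begin
          size ν + e + (tri M + x)                     ≡⟨ arrange (size ν) e (tri M) x ⟩
          size ν + tri M + (x + e)                     ≡⟨ cong (λ z → size ν + tri z + (x + e)) (sym total) ⟩
          size ν + tri (beadsBelow f′ (K * e)) + (x + e) ≡⟨ cong (_+ (x + e)) (weighted-toPartition f′ (K * e) van′) ⟨
          weighted (K * e) f′ + (x + e)                ≡⟨ cong (weighted (K * e) f′ +_) (zeros x (x + e)) ⟨
          weighted (K * e) f′ + (x * 0 + (x + e) * 1)  ≡⟨ moved-sum mv van (λ i b → i * bead b) ⟨
          weighted (K * e) f + (x * 1 + (x + e) * 0)   ≡⟨ cong₂ _+_ (weighted-partition μ len fit) (zeros′ x (x + e)) ⟩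
          size μ + tri M + x                           ≡⟨ +-assoc (size μ) (tri M) x ⟩
          size μ + (tri M + x)                         ∎)
          where
          open ≡-Reasoning
          arrange : ∀ s e t x → s + e + (t + x) ≡ s + t + (x + e)
          arrange = solve-∀
          zeros : ∀ x y → x * 0 + y * 1 ≡ y
          zeros = solve-∀
          zeros′ : ∀ x y → x * 1 + y * 0 ≡ x
          zeros′ = solve-∀
        ν≤μ : size ν ≤ size μ
        ν≤μ = subst (size ν ≤_) smaller (m≤m+n _ e)
        stepped : ∀ n → size μ ≤ n → HasCore e μ γ
        stepped zero p = ⊥-elim (<⇒≱ (≤-trans (s≤s z≤n) (≤-trans (m≤n+m e (size ν)) (≤-reflexive smaller))) p)
        stepped (suc n) p with runners⇒hasCore n {ν} (m<1+n⇒m≤n (≤-trans (subst (size ν <_) smaller (m<m+n _ (s≤s z≤n))) p)) lenν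
            (≤-trans (+-monoˡ-≤ M ν≤μ) fit)
            (λ r r<e → trans (sumTo-cong K λ j _ → cong bead (config-ν _)) (trans (sym (moved-runner mv van r r<e)) (eq r r<e)))
        ... | steps , fin = moved⇒step {μ} {ν} len lenν (Moved-resp mv config-ν) ◅ steps , fin

-- Transfer of a count along a bijective relation

module _ {P Q : Pred Partition 0ℓ} (_∼_ : Partition → Partition → Set)
  (total : ∀ μ → P μ → ∃ λ ν → Q ν × μ ∼ ν) (onto : ∀ ν → Q ν → ∃ λ μ → P μ × μ ∼ ν)
  (injective : ∀ {μ μ′ ν} → P μ → P μ′ → μ ∼ ν → μ′ ∼ ν → μ ≡ μ′)
  (functional : ∀ {μ ν ν′} → Q ν → Q ν′ → μ ∼ ν → μ ∼ ν′ → ν ≡ ν′) where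

  private
    images : ∀ {L} → All P L → List Partition
    images [] = []
    images {μ ∷ _} (p ∷ ps) = proj₁ (total μ p) ∷ images ps

    images-length : ∀ {L} (ps : All P L) → length (images ps) ≡ length L
    images-length [] = refl
    images-length (p ∷ ps) = cong suc (images-length ps)

    images⁻ : ∀ {L} (ps : All P L) {ν} → ν ∈ images ps → Q ν × ∃ λ μ → μ ∈ L × μ ∼ ν
    images⁻ {μ ∷ _} (p ∷ ps) (here refl) = let _ , q , r = total μ p in q , μ , here refl , r
    images⁻ (p ∷ ps) (there ν∈) = let q , μ , μ∈ , r = images⁻ ps ν∈ in q , μ , there μ∈ , r

    images⁺ : ∀ {L} (ps : All P L) {μ ν} → μ ∈ L → μ ∼ ν → Q ν → ν ∈ images ps
    images⁺ {μ ∷ _} (p ∷ ps) (here refl) r q = let _ , q′ , r′ = total μ p in here (functional q q′ r r′)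
    images⁺ (p ∷ ps) (there μ∈) r q = there (images⁺ ps μ∈ r q)

    images-unique : ∀ {L} (ps : All P L) → Unique L → Unique (images ps)
    images-unique [] [] = []
    images-unique {μ ∷ L} (p ∷ ps) (μ≢ ∷ u) = All.tabulate distinct ∷ images-unique ps u
      where
      distinct : ∀ {ν} → ν ∈ images ps → proj₁ (total μ p) ≢ ν
      distinct ν∈ refl with images⁻ ps ν∈
      ... | _ , μ′ , μ′∈ , r′ = All.lookup μ≢ μ′∈ (injective p (All.lookup ps μ′∈) (proj₂ (proj₂ (total μ p))) r′)

  -- A relation is used in place of a function because having the same frame is symmetric: existence
  -- and uniqueness proved in one direction serve for the other one as well.
  count-transfer : ∀ {N} → Count P N → Count Q N
  count-transfer (L , u , mem , len) = images ps , images-unique ps u ,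
      (λ ν → mk⇔ (λ ν∈ → proj₁ (images⁻ ps ν∈))
        (λ q → let μ , p , r = onto ν q in images⁺ ps (Equivalence.from (mem μ) p) r q)) ,
      trans (images-length ps) len
    where
    ps : All P L
    ps = All.tabulate λ {μ} → Equivalence.to (mem μ)

-- Blocks

module Blocks {d : ℕ} (1<d : 1 < d) (e′ : ℕ) (w : ℕ) where
  open Abacus e′
  open Cores e′

  Good : Partition → Pred Partition 0ℓ
  Good γ = Block e γ w ∩ Balanced d e ∩ Regular e

  window-cong : ∀ {f f′} → (∀ x → f x ≡ f′ x) → ∀ x → window f x ≡ window f′ x
  window-cong eq x = sumTo-cong e λ m _ → cong gap (eq (suc x + m))

  BalancedConfig-resp : ∀ {f f′} → (∀ x → f x ≡ f′ x) → BalancedConfig d f → BalancedConfig d f′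
  BalancedConfig-resp eq bal {r} {i} {j} {l} a b c p q = subst (d ∣_) (window-cong eq _)
    (bal {r} {i} {j} {l} a b c (trans (eq _) p) (trans (eq _) q))

  RegularConfig-resp : ∀ {f f′} → (∀ x → f x ≡ f′ x) → RegularConfig f → RegularConfig f′
  RegularConfig-resp eq reg x p = subst (1 ≤_) (window-cong eq x)
    (reg x (subst (1 ≤_) (sumTo-cong (suc x) λ i _ → cong gap (sym (eq i))) p))

  SameFrame-resp : ∀ {f f′ f″} → SameFrame f f′ → (∀ x → f′ x ≡ f″ x) → SameFrame f f″
  SameFrame-resp S eq = record
    { others-same = λ j k k<e′ → trans (others-same j k k<e′) (eq _)
    ; pairs-same = λ j → trans (cong gaps (cong₂ toPair (sym (eq _)) (sym (eq _)))) (pairs-same j) }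
    where open SameFrame S

  -- γ′ is obtained from γ by exchanging the runners 0 and 1 of the abacus with M beads and K rows.
  record Exchanged (M K : ℕ) (γ γ′ : Partition) : Set where
    field
      core    : IsCore e γ
      core′   : IsCore e γ′
      -- All members of the block have size `size γ + w * e`. Hence `M` beads represent each of
      -- them, and by `rows` these beads lie in the first `K` rows.
      fit     : size γ + w * e ≤ M
      fit′    : size γ′ + w * e ≤ M
      rows    : size γ + w * e + M ≤ K * e
      rows′   : size γ′ + w * e + M ≤ K * e
      runner₀ : runner K 0 (config (parts γ′) M) ≡ runner K 1 (config (parts γ) M)
      runner₁ : runner K 1 (config (parts γ′) M) ≡ runner K 0 (config (parts γ) M)
      runners : ∀ {r} → 2 ≤ r → r < e → runner K r (config (parts γ′) M) ≡ runner K r (config (parts γ) M)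
      sizes   : size γ + runner K 1 (config (parts γ′) M) ≡ size γ′ + runner K 1 (config (parts γ) M)

  Exchanged-sym : ∀ {M K γ γ′} → Exchanged M K γ γ′ → Exchanged M K γ′ γ
  Exchanged-sym X = record
    { core = core′ ; core′ = core ; fit = fit′ ; fit′ = fit ; rows = rows′ ; rows′ = rows
    ; runner₀ = sym runner₁ ; runner₁ = sym runner₀ ; runners = λ a b → sym (runners a b) ; sizes = sym sizes }
    where open Exchanged X

  module Realise (M K : ℕ) (μ : Partition) (len : numParts μ ≤ M) (rows : size μ + M ≤ K * e)
    {f′ : ℕ → Bool} (S : SameFrame (config (parts μ) M) f′) where
    open Reflect 1<d K

    private
      f : ℕ → Bool
      f = config (parts μ) M

    van : Vanishing f
    van = config-vanish μ len rows

    van′ : Vanishing f′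
    van′ = vanishing-same S van

    ν : Partition
    ν = toPartition f′ (K * e)

    total : beadsBelow f′ (K * e) ≡ M
    total = trans (sym (beadsBelow-same S)) (beadsBelow-partition μ len rows)

    lenν : numParts ν ≤ M
    lenν = ≤-trans (toParts-length f′ (K * e)) (≤-reflexive total)

    config-ν : ∀ i → config (parts ν) M i ≡ f′ i
    config-ν i = trans (cong (λ z → config (parts ν) z i) (sym total)) (config-toPartition f′ (K * e) van′ i)

    runner-ν : ∀ r → runner K r (config (parts ν) M) ≡ runner K r f′
    runner-ν r = sumTo-cong K λ j _ → cong bead (config-ν _)

    size-change : size μ + runner K 1 f′ ≡ size ν + runner K 1 f
    size-change = +-cancelʳ-≡ (tri M) _ _ (begin
      size μ + runner K 1 f′ + tri M          ≡⟨ xy∙z≈xz∙y (size μ) (runner K 1 f′) (tri M) ⟩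
      size μ + tri M + runner K 1 f′          ≡⟨ cong (_+ runner K 1 f′) (weighted-partition μ len rows) ⟨
      weighted (K * e) f + runner K 1 f′      ≡⟨ weighted-row S K ⟩
      weighted (K * e) f′ + runner K 1 f      ≡⟨ cong (_+ runner K 1 f) (trans (weighted-toPartition f′ (K * e) van′) (cong (λ z → size ν + tri z) total)) ⟩
      size ν + tri M + runner K 1 f           ≡⟨ xy∙z≈xz∙y (size ν) (tri M) (runner K 1 f) ⟩
      size ν + runner K 1 f + tri M           ∎)
      where
      open ≡-Reasoning

  module _ {M K : ℕ} where
    open Reflect 1<d K

    Related : Partition → Partition → Set
    Related μ ν = SameFrame (config (parts μ) M) (config (parts ν) M)

    module _ {γ γ′ : Partition} (X : Exchanged M K γ γ′) where
      open Exchanged X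

      fits : ∀ μ → Good γ μ → numParts μ ≤ M
      fits μ ((_ , sz) , _) = ≤-trans (numParts≤size μ) (≤-trans (≤-reflexive sz) fit)

      in-rows : ∀ μ → Good γ μ → size μ + M ≤ K * e
      in-rows μ ((_ , sz) , _) = ≤-trans (≤-reflexive (cong (_+ M) sz)) rows

      good-runners : ∀ μ → Good γ μ → ∀ r → r < e →
        runner K r (config (parts μ) M) ≡ runner K r (config (parts γ) M)
      good-runners μ g = hasCore⇒runners K {μ} {γ} (fits μ g) (config-vanish μ (fits μ g) (in-rows μ g)) (proj₁ (proj₁ g))

      module _ (μ : Partition) (g : Good γ μ) {f′ : ℕ → Bool} (S : SameFrame (config (parts μ) M) f′)
        (swap₀ : runner K 0 f′ ≡ runner K 1 (config (parts μ) M))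
        (swap₁ : runner K 1 f′ ≡ runner K 0 (config (parts μ) M)) where

        open Realise M K μ (fits μ g) (in-rows μ g) S

        private
          f fγ fγ′ : ℕ → Bool
          f = config (parts μ) M
          fγ = config (parts γ) M
          fγ′ = config (parts γ′) M

          r₀ : runner K 0 f ≡ runner K 1 fγ′
          r₀ = trans (good-runners μ g 0 (s≤s z≤n)) (sym runner₁)

          r₁ : runner K 1 f ≡ runner K 1 fγ
          r₁ = good-runners μ g 1 (s≤s (s≤s z≤n))

          runners-ν : ∀ r → r < e → runner K r f′ ≡ runner K r fγ′
          runners-ν 0 _ = trans swap₀ (trans r₁ (sym runner₀))
          runners-ν 1 _ = trans swap₁ r₀
          runners-ν (suc (suc k)) r<e = trans (sym (runner-other S (s≤s (s≤s z≤n)) r<e))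
            (trans (good-runners μ g (suc (suc k)) r<e) (sym (runners (s≤s (s≤s z≤n)) r<e)))

        realised-size : size ν ≡ size γ′ + w * e
        realised-size = +-cancelʳ-≡ (runner K 1 fγ) _ _ (begin
          size ν + runner K 1 fγ                  ≡⟨ cong (size ν +_) r₁ ⟨
          size ν + runner K 1 f                   ≡⟨ size-change ⟨
          size μ + runner K 1 f′                  ≡⟨ cong₂ _+_ (proj₂ (proj₁ g)) (trans swap₁ r₀) ⟩
          size γ + w * e + runner K 1 fγ′         ≡⟨ xy∙z≈xz∙y (size γ) (w * e) _ ⟩
          size γ + runner K 1 fγ′ + w * e         ≡⟨ cong (_+ w * e) sizes ⟩
          size γ′ + runner K 1 fγ + w * e         ≡⟨ xy∙z≈xz∙y (size γ′) _ (w * e) ⟩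
          size γ′ + w * e + runner K 1 fγ         ∎)
          where
          open ≡-Reasoning

        realised-core : HasCore e ν γ′
        realised-core = runners⇒hasCore K {γ′} {M}
          (≤-trans (numParts≤size γ′) (≤-trans (m≤m+n _ _) fit′)) core′ (≤-trans (+-monoˡ-≤ M (m≤m+n _ _)) rows′)
          (size ν) {ν} ≤-refl lenν (≤-trans (≤-reflexive (cong (_+ M) realised-size)) rows′)
          (λ r r<e → trans (runner-ν r) (runners-ν r r<e))

        realised : BalancedConfig d f′ → RegularConfig f′ → ∃ λ ν → Good γ′ ν × Related μ ν
        realised bal reg = ν , ((realised-core , realised-size) ,
            Translation.⇒balanced e′ ν M lenν 1<d (BalancedConfig-resp (λ i → sym (config-ν i)) bal) ,
            Translation.⇒regular e′ ν M lenν (RegularConfig-resp (λ i → sym (config-ν i)) reg)) ,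
          SameFrame-resp S (λ i → sym (config-ν i))

      exchange : ∀ μ → Good γ μ → ∃ λ ν → Good γ′ ν × Related μ ν
      exchange μ g =
        let f′ , S , bal , reg , swap₀ , swap₁ = reflect (config-vanish μ (fits μ g) (in-rows μ g))
              (Translation.balanced⇒ e′ μ M (fits μ g) 1<d (proj₁ (proj₂ g)))
              (Translation.regular⇒ e′ μ M (fits μ g) (proj₂ (proj₂ g)))
        in realised μ g S swap₀ swap₁ bal reg

      -- All members of a block have as many beads on runner 0 as its core, so a common frame leaves
      -- no choice.
      related-unique : ∀ μ μ′ → Good γ μ → Good γ μ′ → Related μ μ′ → μ ≡ μ′
      related-unique μ μ′ g g′ S = partition-injective {μ} {μ′} (fits μ g) (fits μ′ g′)
        (reflect-unique S (config-vanish μ (fits μ g) (in-rows μ g))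
          (Translation.balanced⇒ e′ μ M (fits μ g) 1<d (proj₁ (proj₂ g)))
          (Translation.balanced⇒ e′ μ′ M (fits μ′ g′) 1<d (proj₁ (proj₂ g′)))
          (trans (good-runners μ g 0 (s≤s z≤n)) (sym (good-runners μ′ g′ 0 (s≤s z≤n)))))

  exchanged-count : ∀ {M K γ γ′ N} → Exchanged M K γ γ′ → Count (Good γ) N → Count (Good γ′) N
  exchanged-count {M} {K} {γ} {γ′} X = count-transfer {Good γ} {Good γ′} (Related {M} {K}) (exchange X)
    (λ ν g → let μ , g′ , S = exchange (Exchanged-sym X) ν g in μ , g′ , SameFrame-sym S)
    (λ {μ} {μ′} g g′ S S′ → related-unique X μ μ′ g g′ (SameFrame-trans S (SameFrame-sym S′)))
    (λ {_} {ν} {ν′} g g′ S S′ → related-unique (Exchanged-sym X) ν ν′ g g′ (SameFrame-trans (SameFrame-sym S) S′))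

  gap-before-bead : ∀ f n → f n ≡ true → 1 ≤ gapsBelow f n → ∃ λ y → f y ≡ false × f (suc y) ≡ true
  gap-before-bead f (suc n) fn p with true⊎false (f n)
  ... | inj₂ q = n , q , fn
  ... | inj₁ q = gap-before-bead f n q (subst (1 ≤_) (trans (cong (λ b → gapsBelow f n + gap b) q) (+-identityʳ _)) p)

  leftBead-flip : ∀ t → leftBead (flip t) ≡ rightBead t
  leftBead-flip B = refl
  leftBead-flip A = refl
  leftBead-flip R = refl
  leftBead-flip E = refl
  rightBead-flip : ∀ t → rightBead (flip t) ≡ leftBead t
  rightBead-flip B = refl
  rightBead-flip A = refl
  rightBead-flip R = refl
  rightBead-flip E = refl

  module Exchange {γ : Partition} (core : IsCore e γ) {M K j₀ : ℕ}
    (fit : size γ + w * e ≤ M) (rows : size γ + w * e + M ≤ K * e)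
    (gap₀ : config (parts γ) M (j₀ * e) ≡ false) (bead₀ : config (parts γ) M (suc (j₀ * e)) ≡ true) where

    len : numParts γ ≤ M
    len = ≤-trans (numParts≤size γ) (≤-trans (m≤m+n _ _) fit)
    open Reflect 1<d K
    f = config (parts γ) M
    fitγ : size γ + M ≤ K * e
    fitγ = ≤-trans (+-monoˡ-≤ M (m≤m+n _ _)) rows
    van : Vanishing f
    van = config-vanish γ len fitγ
    srt : SortedConfig f
    srt = isCore⇒sorted K {γ} len core
    T′ : ℕ → Pair
    T′ j = flip (pair f j)
    f′ = replacePairs T′ f
    S : SameFrame f f′
    S = SameFrame-replace T′ f (λ j → gaps-flip (pair f j))
    left : ∀ j → f′ (j * e) ≡ f (suc (j * e))
    left j = trans (sym (leftBead-toPair _ (f′ (suc (j * e))))) (trans (cong leftBead (pair-replace T′ f j))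
      (trans (leftBead-flip (pair f j)) (rightBead-toPair (f (j * e)) _)))
    right : ∀ j → f′ (suc (j * e)) ≡ f (j * e)
    right j = trans (sym (rightBead-toPair (f′ (j * e)) _)) (trans (cong rightBead (pair-replace T′ f j))
      (trans (rightBead-flip (pair f j)) (leftBead-toPair _ (f (suc (j * e))))))
    r₀ : runner K 0 f′ ≡ runner K 1 f
    r₀ = sumTo-cong K λ j _ → cong bead (left j)
    r₁ : runner K 1 f′ ≡ runner K 0 f
    r₁ = sumTo-cong K λ j _ → cong bead (right j)
    srt′ : SortedConfig f′
    srt′ x p q = go (x % e) (x / e) (m%n<n x e) (trans (cong f′ (sym (index x))) p)
        (trans (cong f′ (sym (next-index x))) q)
      where
      go : ∀ r j → r < e → f′ (r + j * e) ≡ false → f′ (r + suc j * e) ≡ true → ⊥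
      go 0 j _ p q = srt (1 + j * e) (trans (sym (left j)) p) (trans (cong f (next-row 1 j)) (trans (sym (left (suc j))) q))
      go 1 j _ p q = srt (j * e) (trans (sym (right j)) p) (trans (cong f (next-row 0 j)) (trans (sym (right (suc j))) q))
      go (suc (suc k)) j (s≤s (s≤s k<e′)) p q = srt (2 + k + j * e) (trans (others-same j k k<e′) p)
          (trans (cong f (next-row (2 + k) j)) (trans (others-same (suc j) k k<e′) q))
        where open SameFrame S
    open Realise M K γ len fitγ S using (lenν; config-ν; runner-ν; size-change) renaming (ν to γ′) public
    sorted-γ′ : SortedConfig (config (parts γ′) M)
    sorted-γ′ x p q = srt′ x (trans (sym (config-ν x)) p) (trans (sym (config-ν (x + e))) q)
    -- In a core the beads of each runner form an initial segment. A gap of runner 0 beside a bead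
    -- of runner 1 thus means that the segment of runner 0 is the shorter one.
    runner-< : runner K 0 f < runner K 1 f
    runner-< = sumTo-mono-< K (λ j _ → le j) {j₀} j₀<K
      (subst₂ (λ a b → bead a < bead b) (sym gap₀) (sym bead₀) ≤-refl)
      where
      j₀<K : j₀ < K
      j₀<K = ≰⇒> λ K≤ → true∧false bead₀ (van (m≤n⇒m≤1+n (*-monoˡ-≤ e K≤)))
      le : ∀ j → bead (f (j * e)) ≤ bead (f (suc (j * e)))
      le j with true⊎false (f (j * e)) | true⊎false (f (suc (j * e)))
      ... | inj₂ p | _ rewrite p = z≤n
      ... | inj₁ p | inj₁ q rewrite p | q = ≤-refl
      ... | inj₁ p | inj₂ q with ≤-total j j₀
      ...   | inj₁ j≤ = true∧false (sorted-down K {f} srt 1 j₀ j≤ bead₀) q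
      ...   | inj₂ ≤j = true∧false (sorted-down K {f} srt 0 j ≤j p) gap₀
    -- Exchanging the runners moves the surplus beads of runner 1 down by one position each, and the
    -- size drops by their number.
    smaller : size γ′ < size γ
    smaller = +-cancelʳ-< (runner K 1 f) _ _ (subst (_< size γ + runner K 1 f) (trans (cong (size γ +_) (sym r₁)) size-change)
      (+-monoʳ-< (size γ) runner-<))

    exchanged : Exchanged M K γ γ′
    exchanged = record
      { core = core ; core′ = sorted⇒isCore K {γ′} lenν sorted-γ′
      ; fit = fit ; fit′ = ≤-trans (+-monoˡ-≤ (w * e) (<⇒≤ smaller)) fit
      ; rows = rows ; rows′ = ≤-trans (+-monoˡ-≤ M (+-monoˡ-≤ (w * e) (<⇒≤ smaller))) rows
      ; runner₀ = trans (runner-ν 0) r₀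
      ; runner₁ = trans (runner-ν 1) r₁
      ; runners = λ {r} a b → trans (runner-ν r) (sym (runner-other S a b))
      ; sizes = trans (cong (size γ +_) (runner-ν 1)) size-change }

  -- The number of beads is chosen such that a gap directly before a bead lies on runner 0.
  descent : ∀ γ → IsCore e γ → 1 ≤ size γ → ∃ λ γ′ → size γ′ < size γ × ∃₂ λ M K → Exchanged M K γ γ′
  descent γ core 1≤ = X.γ′ , X.smaller , _ , _ , X.exchanged
    where
    top : ∃ λ y → config (parts γ) (numParts γ) y ≡ false × config (parts γ) (numParts γ) (suc y) ≡ true
    top = go (parts γ) (sorted γ) (positive γ) 1≤
      where
      go : ∀ xs → AllPairs _≥_ xs → All (0 <_) xs → 1 ≤ sum xs →
        ∃ λ y → config xs (length xs) y ≡ false × config xs (length xs) (suc y) ≡ true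
      go (x ∷ xs) s (0<x ∷ _) _ = gap-before-bead _ (x + length xs) (config-top x xs (length xs))
        (≤-trans 0<x (≤-reflexive (sym (gapsBelow-top (length xs) s ≤-refl))))
    y = proj₁ top
    bound = size γ + w * e
    -- The first summand makes `t + y` a multiple of `e`; the second keeps it one and ensures that
    -- `M` is at least `bound`.
    t = y * suc e′ + e * bound
    M = t + numParts γ
    K = bound + M
    j₀ = y + bound
    t+y : t + y ≡ j₀ * e
    t+y = lemma y e′ bound
      where
      lemma : ∀ y k b → y * suc k + suc (suc k) * b + y ≡ (y + b) * suc (suc k)
      lemma = solve-∀
    fitM : bound ≤ M
    fitM = ≤-trans (m≤n*m bound e) (≤-trans (m≤n+m _ (y * suc e′)) (m≤m+n t _))
    rowsK : bound + M ≤ K * e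
    rowsK = m≤m*n K e
    gap₀ : config (parts γ) M (j₀ * e) ≡ false
    gap₀ = trans (cong (config (parts γ) M) (sym t+y)) (trans (config-shift (parts γ) (numParts γ) ≤-refl t y) (proj₁ (proj₂ top)))
    bead₀ : config (parts γ) M (suc (j₀ * e)) ≡ true
    bead₀ = trans (cong (config (parts γ) M) (trans (cong suc (sym t+y)) (sym (+-suc t y))))
      (trans (config-shift (parts γ) (numParts γ) ≤-refl t (suc y)) (proj₂ (proj₂ top)))
    module X = Exchange core {M} {K} {j₀} fitM rowsK gap₀ bead₀

-- Finite enumeration and decidability

_≟ᵖ_ : (μ ν : Partition) → Dec (μ ≡ ν)
μ ≟ᵖ ν = map′ partition-≡ (cong parts) (List.≡-dec _≟_ (parts μ) (parts ν))

empty : Partition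
empty = mkPartition [] [] []

boundedLists : ℕ → ℕ → List (List ℕ)
boundedLists zero    n = [] ∷ []
boundedLists (suc k) n = [] ∷ cartesianProductWith _∷_ (upTo (suc n)) (boundedLists k n)

∈-boundedLists : ∀ k {n} xs → length xs ≤ k → All (_≤ n) xs → xs ∈ boundedLists k n
∈-boundedLists zero    []       _ _ = here refl
∈-boundedLists (suc k) []       _ _ = here refl
∈-boundedLists (suc k) (x ∷ xs) (s≤s l) (x≤n ∷ xs≤n) =
  there (∈-cartesianProductWith⁺ _∷_ (∈-upTo⁺ (s≤s x≤n)) (∈-boundedLists k xs l xs≤n))

-- Lists that are not partitions all go to the default value `empty`. The repetitions that this
-- creates are the reason for the deduplication in `count-finite`.
asPartition : List ℕ → Partition
asPartition xs with Linked.linked? _≥?_ xs | All.all? (0 <?_) xs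
... | yes d | yes p = mkPartition xs d p
... | _     | _     = empty

asPartition-parts : ∀ μ → asPartition (parts μ) ≡ μ
asPartition-parts μ with Linked.linked? _≥?_ (parts μ) | All.all? (0 <?_) (parts μ)
... | yes _ | yes _ = partition-≡ refl
... | no n  | _     = ⊥-elim (n (decreasing μ))
... | yes _ | no n  = ⊥-elim (n (positive μ))

partitionsUpTo : ℕ → List Partition
partitionsUpTo n = map asPartition (boundedLists n n)

∈-partitionsUpTo : ∀ {n} μ → size μ ≤ n → μ ∈ partitionsUpTo n
∈-partitionsUpTo {n} μ s≤n = subst (_∈ partitionsUpTo n) (asPartition-parts μ)
  (∈-map⁺ asPartition (∈-boundedLists n (parts μ) (≤-trans (numParts≤size μ) s≤n) (All.map (λ p → ≤-trans p s≤n) (≤sum (parts μ)))))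

count-finite : ∀ {P : Pred Partition 0ℓ} n → Decidable P → (∀ μ → P μ → size μ ≤ n) → ∃ (Count P)
count-finite {P} n P? bound = length L , L , Unique.deduplicate-! _≟ᵖ_ (filter P? (partitionsUpTo n)) ,
    (λ μ → mk⇔
      (λ μ∈ → proj₂ (∈-filter⁻ P? {xs = partitionsUpTo n} (∈-deduplicate⁻ _≟ᵖ_ (filter P? (partitionsUpTo n)) μ∈)))
      (λ p → ∈-deduplicate⁺ _≟ᵖ_ (∈-filter⁺ P? (∈-partitionsUpTo μ (bound μ p)) p))) , refl
  where
  L = deduplicate _≟ᵖ_ (filter P? (partitionsUpTo n))

regular? : ∀ e → Decidable (Regular e)
regular? e μ = map′ (λ a x x∈ → All.lookup a x∈) (λ r → All.tabulate λ {x} → r x)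
  (All.all? (λ x → length (filter (x ≟_) (parts μ)) <? e) (parts μ))

node? : ∀ μ r c → Dec (Node μ r c)
node? μ r c = ((1 ≤? r) ×-dec (r ≤? numParts μ)) ×-dec ((1 ≤? c) ×-dec (c ≤? part μ r))

balanced? : ∀ d e → Decidable (Balanced d e)
balanced? d e μ = map′
  (λ b r c node → b {r} (s≤s (proj₂ (proj₁ node))) {c}
    (s≤s (≤-trans (proj₂ (proj₂ node)) (nth-≤ (parts μ) (≤sum (parts μ)) r))) node)
  (λ b {r} _ {c} _ → b r c)
  (allUpTo? (λ r → allUpTo? (λ c → node? μ r c →-dec ((e ∣? hook μ r c) →-dec (d ∣? arm μ r c))) (suc (size μ))) (suc (numParts μ)))

-- The block of the empty core and induction on the size of the core

module _ {d : ℕ} (1<d : 1 < d) (e′ : ℕ) (w : ℕ) where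
  open Abacus e′
  open Cores e′
  open Blocks 1<d e′ w

  empty-core : IsCore e empty
  empty-core = sorted⇒isCore 0 {empty} {0} z≤n λ x _ ()

  -- `HasCore` asks for a chain of steps of unspecified length. For the given size it is equivalent
  -- to the equality of finitely many bead counts with those of the empty partition, which can be
  -- tested.
  block-empty? : Decidable (Block e empty w)
  block-empty? μ with size μ ≟ w * e
  ... | no n = no λ b → n (proj₂ b)
  ... | yes sz = map′ (λ eq → runners⇒hasCore K {empty} {M} z≤n empty-core fit₀ (size μ) ≤-refl len fit (λ r r<e → eq {r} r<e) , sz)
          (λ b {r} r<e → hasCore⇒runners K {μ} {empty} len (config-vanish μ len fit) (proj₁ b) r r<e)
          (allUpTo? (λ r → runner K r (config (parts μ) M) ≟ runner K r (config [] M)) e)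
    where
    M = size μ
    K = size μ + M
    len : numParts μ ≤ M
    len = numParts≤size μ
    fit : size μ + M ≤ K * e
    fit = m≤m*n K e
    fit₀ : 0 + M ≤ K * e
    fit₀ = ≤-trans (m≤n+m M (size μ)) fit

  base : ∃ (Count (Good empty))
  base = count-finite (w * e) (λ μ → block-empty? μ ×-dec (balanced? d e μ ×-dec regular? e μ))
    λ μ g → ≤-reflexive (proj₂ (proj₁ g))

  size-zero : ∀ γ → size γ ≡ 0 → γ ≡ empty
  size-zero (mkPartition [] [] []) _ = refl
  size-zero (mkPartition (zero ∷ _) _ (() ∷ _)) _

  all-blocks : ∀ γ → IsCore e γ → Count (Good γ) (proj₁ base)
  all-blocks γ core = <-rec P step (size γ) γ refl core
    where
    P : ℕ → Set
    P n = ∀ γ → size γ ≡ n → IsCore e γ → Count (Good γ) (proj₁ base)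
    step : ∀ n → (∀ {m} → m < n → P m) → P n
    step zero    _   γ sz core = subst (λ γ → Count (Good γ) (proj₁ base)) (sym (size-zero γ sz)) (proj₂ base)
    step (suc n) rec γ sz core with descent γ core (≤-trans (s≤s z≤n) (≤-reflexive (sym sz)))
    ... | γ′ , γ′<γ , M , K , X = exchanged-count (Exchanged-sym X)
            (rec (subst (size γ′ <_) sz γ′<γ) γ′ refl (Exchanged.core′ X))

corollary4p5 : (d e w : ℕ) → 1 < d → 1 < e →
    ∃[ N ] (∀ γ → IsCore e γ → Count (Block e γ w ∩ Balanced d e ∩ Regular e) N)
corollary4p5 d (suc (suc e′)) w 1<d _ = proj₁ (base 1<d e′ w) , all-blocks 1<d e′ w
corollary4p5 d (suc zero) w _ (s≤s ())
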